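{- The problem \textsc{Trivially Perfect Editing} admits a proper kernel with $O(k^7)$ vertices. That is, there is a polynomial-time algorithm that, given an instance $(G,k)$ of \textsc{Trivially Perfect Editing}, outputs an instance $(G',k')$ such that $(G,k)$ is a yes-instance if and only if $(G',k')$ is a yes-instance, $k'\le k$, and $|V(G')|\le c\cdot k^7$ for an absolute constant $c$.
   Context: All graphs are finite, simple and undirected. A graph is trivially perfect if it contains neither the cycle $C_4$ nor the path $P_4$ on four vertices as an induced subgraph. For a graph $G$ and $F\subseteq\binom{V(G)}{2}$, $G\triangle F$ denotes the graph on vertex set $V(G)$ with edge set $E(G)\triangle F$ (symmetric difference). \textsc{Trivially Perfect Editing}: given a graph $G$ and a non-negative integer $k$ (the parameter), decide whether there is a set $S\subseteq\binom{V(G)}{2}$ with $|S|\le k$ such that $G\triangle S$ is trivially perfect. A kernel is a polynomial-time algorithm mapping an instance $(G,k)$ to an equivalent instance $(G',k')$ whose size is bounded by a function of $k$; it is proper if moreover $k'\le k$.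
   Formalization: The vertex bound is stated as c·(k+1)^7 instead of c·k^7, since at k = 0 the literal bound would force the empty graph, a yes-instance, even for the no-instance (C_4, 0); for k ≥ 1 the two bounds agree up to the constant. -}

module Defs where

open import Data.Nat using (ℕ; zero; suc; _+_; _*_; _^_; _≤_; _<ᵇ_)
open import Data.Bool using (Bool; true; false; _∧_; _xor_; if_then_else_)
open import Data.Fin using (Fin; toℕ; _↑ˡ_; _≟_)
open import Data.Fin.Patterns using (0F; 1F; 2F; 3F)
open import Data.List using (List; []; _∷_; _++_; map; concatMap; length; replicate; allFin; takeWhile)
open import Data.Product using (Σ; _×_; _,_; ∃)
open import Relation.Binary.PropositionalEquality using (_≡_; _≢_)
open import Relation.Nullary using (¬_; does)

record Graph : Set where
  field
    n    : ℕ
    adj  : Fin n → Fin n → Bool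
    sym  : ∀ i j → adj i j ≡ adj j i
    irr  : ∀ i → adj i i ≡ false

open Graph public

Adj : ∀ {n} → (Fin n → Fin n → Bool) → Fin n → Fin n → Set
Adj A i j = A i j ≡ true

NonAdj : ∀ {n} → (Fin n → Fin n → Bool) → Fin n → Fin n → Set
NonAdj A i j = A i j ≡ false

AllDistinct : ∀ {n} → Fin n → Fin n → Fin n → Fin n → Set
AllDistinct a b c d = a ≢ b × a ≢ c × a ≢ d × b ≢ c × b ≢ d × c ≢ d

InducedP4 : ∀ {n} → (Fin n → Fin n → Bool) → Fin n → Fin n → Fin n → Fin n → Set
InducedP4 A a b c d =
  AllDistinct a b c d × Adj A a b × Adj A b c × Adj A c d
  × NonAdj A a c × NonAdj A b d × NonAdj A a d

InducedC4 : ∀ {n} → (Fin n → Fin n → Bool) → Fin n → Fin n → Fin n → Fin n → Set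
InducedC4 A a b c d =
  AllDistinct a b c d × Adj A a b × Adj A b c × Adj A c d × Adj A d a
  × NonAdj A a c × NonAdj A b d

TriviallyPerfect : ∀ {n} → (Fin n → Fin n → Bool) → Set
TriviallyPerfect {n} A =
  (¬ Σ (Fin n) λ a → Σ (Fin n) λ b → Σ (Fin n) λ c → Σ (Fin n) λ d → InducedC4 A a b c d)
  × (¬ Σ (Fin n) λ a → Σ (Fin n) λ b → Σ (Fin n) λ c → Σ (Fin n) λ d → InducedP4 A a b c d)

count : ∀ {A : Set} → (A → Bool) → List A → ℕ
count p []       = 0
count p (x ∷ xs) = if p x then suc (count p xs) else count p xs

pairs : ∀ n → List (Fin n × Fin n)
pairs n = concatMap (λ i → map (λ j → (i , j)) (allFin n)) (allFin n)

editDistance : ∀ {n} → (Fin n → Fin n → Bool) → (Fin n → Fin n → Bool) → ℕ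
editDistance {n} A B = count (λ { (i , j) → (toℕ i <ᵇ toℕ j) ∧ (A i j xor B i j) }) (pairs n)

-- (G , k) is a yes-instance of Trivially Perfect Editing:
-- there is S with |S| ≤ k and G △ S trivially perfect; we quantify over the
-- resulting simple graph H = G △ S on V(G), with S = E(G) △ E(H).
YesInstance : Graph → ℕ → Set
YesInstance G k =
  Σ (Fin (n G) → Fin (n G) → Bool) λ H →
    (∀ i j → H i j ≡ H j i) × (∀ i → H i i ≡ false)
    × editDistance (adj G) H ≤ k × TriviallyPerfect H

-- Model of computation: deterministic single-tape Turing machines.
-- Tape alphabet Fin (4 + Γ); symbol 0F is the blank, and the input
-- alphabet is {1F = '0', 2F = '1', 3F = '#'} ⊆ Fin 4 (embedded by _↑ˡ Γ).

data Move : Set where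
  left right stay : Move

record TM : Set where
  field
    Q     : ℕ
    Γ     : ℕ
    start : Fin Q
    halt  : Fin Q
    δ     : Fin Q → Fin (4 + Γ) → Fin Q × Fin (4 + Γ) × Move

module _ (M : TM) where
  open TM M

  Sym : Set
  Sym = Fin (4 + Γ)

  blank : Sym
  blank = 0F ↑ˡ Γ

  -- state, left part of tape (nearest cell first), head cell, right part
  record Config : Set where
    constructor cfg
    field
      state : Fin Q
      lft   : List Sym
      hd    : Sym
      rgt   : List Sym

  step : Config → Config
  step (cfg q l h r) with does (q ≟ halt)
  ... | true  = cfg q l h r
  ... | false with δ q h
  ...   | (q' , w , left)  with l
  ...     | []     = cfg q' [] blank (w ∷ r)
  ...     | x ∷ l' = cfg q' l' x (w ∷ r)
  step (cfg q l h r) | false | (q' , w , right) with r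
  ...     | []     = cfg q' (w ∷ l) blank []
  ...     | x ∷ r' = cfg q' (w ∷ l) x r'
  step (cfg q l h r) | false | (q' , w , stay) = cfg q' l w r

  run : ℕ → Config → Config
  run zero    c = c
  run (suc t) c = run t (step c)

  initial : List (Fin 4) → Config
  initial []       = cfg start [] blank []
  initial (x ∷ xs) = cfg start [] (x ↑ˡ Γ) (map (_↑ˡ Γ) xs)

  output : Config → List Sym
  output (cfg _ _ h r) = takeWhile (λ s → Relation.Nullary.¬? (s ≟ blank)) (h ∷ r)

  HaltsWithin : List (Fin 4) → ℕ → List (Fin 4) → Set
  HaltsWithin w t out =
    Config.state (run t (initial w)) ≡ halt × output (run t (initial w)) ≡ map (_↑ˡ Γ) out

bit : Bool → Fin 4
bit false = 1F
bit true  = 2F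

encode : Graph → ℕ → List (Fin 4)
encode G k =
  replicate k 2F ++ (3F ∷ concatMap (λ i → map (λ j → bit (adj G i j)) (allFin (n G))) (allFin (n G)))

{-# OPTIONS --safe #-}
-- Fix an instance (G , k) and write q = k + 1.  Three rules delete a vertex v:
--   * v has more than 3q true twins;
--   * v lies in a trivially perfect module with more than 27q³ vertices, and no
--     vertex has more than 3q true twins (the module then contains an
--     independent set of more than 3q vertices);
--   * v lies inside a long comb: a chain of vertices with decreasing
--     neighbourhoods, together with the vertices hanging off it.
-- A solution of the smaller instance touches at most 2k vertices, so each rule
-- leaves untouched vertices: a twin of v; two nonadjacent vertices of the
-- module, which force its neighbourhood to be a clique; or one untouched vertex
-- above v, at v and below v in the comb, which force the solution to look like
-- the comb around v.  All edits at the module, or at that part of the comb, can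
-- then be undone and v put back.
--
-- Let conversely H solve an irreducible instance, and let X be the set of the at
-- most 2k touched vertices.  The vertices of the forest H above some vertex of X
-- fall into at most 4q² chains, each of O(q²) vertices as there is no long comb
-- and there are few twins.  The other vertices fall into trivially perfect
-- modules, one for each of these O(q⁴) vertices (its lowest neighbour) and one
-- more, of O(q³) vertices each.  Hence an irreducible instance with more than
-- 3440 q⁷ vertices has no solution, and (C₄ , 0) may be output instead.
--
-- The rules are first-order formulas with counting.  They are evaluated by
-- programs over unary registers, marked on tracks of the tape, and compiled to
-- a Turing machine whose primitive operations are passes over the tape.
module Submission where

open import Defs
open import Data.Nat
open import Data.Nat.Properties
open import Data.Nat.Tactic.RingSolver using (solve-∀)
open import Data.Bool using (Bool; true; false; _∧_; _∨_; not; if_then_else_; _xor_)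
import Data.Bool.Properties as Bool
open import Data.Empty using (⊥; ⊥-elim)
open import Data.Fin using (Fin; zero; suc; toℕ; fromℕ<; _↑ˡ_; _↑ʳ_; splitAt; join; combine; remQuot)
open import Data.Fin.Patterns using (0F; 1F; 2F; 3F)
open import Data.Fin.Properties using (splitAt-↑ˡ; splitAt-↑ʳ; splitAt-join; remQuot-combine; toℕ-fromℕ<; fromℕ<-toℕ; toℕ<n; toℕ-injective)
import Data.Fin.Properties as Fin
open import Data.List using (List; []; _∷_; _++_; _∷ʳ_; _ʳ++_; length; reverse; takeWhile; concatMap; replicate; allFin; tabulate)
import Data.List as List
import Data.List.Properties as List
open import Data.List.Relation.Binary.Pointwise using (Pointwise; []; _∷_)
import Data.List.Relation.Binary.Pointwise as Pointwise
open import Data.List.Relation.Unary.All using (All; []; _∷_)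
import Data.List.Relation.Unary.All.Properties as All
open import Data.Maybe using (Maybe; just; nothing)
open import Data.Product hiding (swap)
open import Data.Sum using (_⊎_; inj₁; inj₂; [_,_]′; swap)
import Data.Sum as Sum
open import Data.Unit using (⊤; tt)
open import Data.Vec using (Vec; []; _∷_; lookup; _[_]≔_)
import Data.Vec as Vec
import Data.Vec.Properties as Vec
open import Function using (_∘_; id)
open import Function.Bundles using (_⇔_; mk⇔)
open import Relation.Nullary
open import Relation.Nullary.Decidable using (map′; decidable-stable; _×-dec_; _→-dec_; _⊎-dec_; ¬?)
open import Relation.Binary.Definitions using (tri<; tri≈; tri>)
open import Relation.Binary.PropositionalEquality renaming (sym to symm)

-- Counting

-- Each rule deletes one vertex and keeps k, so the reduced graph is an induced subgraph: solutions
-- restrict to it by heredity, and only putting a vertex back needs an argument. A rule cannot see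
-- the solution. It therefore asks for more than 3q vertices of each kind that its proof uses; as 3q
-- ≥ 2k + 2, one of them is neither touched, nor v, nor one further vertex to be avoided. The 27q³
-- of the module rule is (3q)³: in a trivially perfect graph two leaves below a vertex determine it
-- up to twins. A rule must also be testable without searching for vertex sets, so few vertices name
-- its structure: a module is named by two vertices whose common closed neighbourhood cuts it off, a
-- comb by its two ends. The counting proof has to exhibit such names. For a module it takes a
-- nonadjacent pair with the fewest common neighbours, for a comb two chain members above the same
-- touched vertices. Finally 3440 = 110 + 30 + 110 · 30: at most 110q⁴ vertices lie above touched
-- ones, and each of the at most 110q⁴ + 1 modules has at most 30q³ vertices.

Is : Bool → Set
Is b = b ≡ true

is? : ∀ b → Dec (Is b)
is? b = b Bool.≟ true

sum : ℕ → (ℕ → ℕ) → ℕ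
sum zero    f = 0
sum (suc n) f = f n + sum n f

sum-mono : ∀ n {f g} → (∀ x → x < n → f x ≤ g x) → sum n f ≤ sum n g
sum-mono zero    h = z≤n
sum-mono (suc n) h = +-mono-≤ (h n ≤-refl) (sum-mono n λ x p → h x (m≤n⇒m≤1+n p))

sum-cong : ∀ n {f g} → (∀ x → x < n → f x ≡ g x) → sum n f ≡ sum n g
sum-cong zero    h = refl
sum-cong (suc n) h = cong₂ _+_ (h n ≤-refl) (sum-cong n λ x p → h x (m≤n⇒m≤1+n p))

+-interchange : ∀ a b c d → (a + b) + (c + d) ≡ (a + c) + (b + d)
+-interchange a b c d = begin
  (a + b) + (c + d) ≡⟨ +-assoc a b (c + d) ⟩
  a + (b + (c + d)) ≡⟨ cong (a +_) (symm (+-assoc b c d)) ⟩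
  a + ((b + c) + d) ≡⟨ cong (λ z → a + (z + d)) (+-comm b c) ⟩
  a + ((c + b) + d) ≡⟨ cong (a +_) (+-assoc c b d) ⟩
  a + (c + (b + d)) ≡⟨ symm (+-assoc a c (b + d)) ⟩
  (a + c) + (b + d) ∎
  where open ≡-Reasoning

sum-+ : ∀ n f g → sum n (λ x → f x + g x) ≡ sum n f + sum n g
sum-+ zero    f g = refl
sum-+ (suc n) f g =
  trans (cong ((f n + g n) +_) (sum-+ n f g)) (+-interchange (f n) (g n) (sum n f) (sum n g))

sum-const : ∀ n c → sum n (λ _ → c) ≡ n * c
sum-const zero    c = refl
sum-const (suc n) c = cong (c +_) (sum-const n c)

sum-0 : ∀ n → sum n (λ _ → 0) ≡ 0
sum-0 n = trans (sum-const n 0) (*-zeroʳ n)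

sum-*ʳ : ∀ n f c → sum n (λ x → f x * c) ≡ sum n f * c
sum-*ʳ zero    f c = refl
sum-*ʳ (suc n) f c = trans (cong (f n * c +_) (sum-*ʳ n f c)) (symm (*-distribʳ-+ c (f n) (sum n f)))

sum-swap : ∀ m n (f : ℕ → ℕ → ℕ) → sum m (λ x → sum n (f x)) ≡ sum n (λ y → sum m (λ x → f x y))
sum-swap zero    n f = symm (sum-0 n)
sum-swap (suc m) n f = trans (cong (sum n (f m) +_) (sum-swap m n f)) (symm (sum-+ n (f m) _))

term≤sum : ∀ n f {x} → x < n → f x ≤ sum n f
term≤sum (suc n) f {x} (s≤s p) with m≤n⇒m<n∨m≡n p
... | inj₁ q    = ≤-trans (term≤sum n f q) (m≤n+m _ (f n))
... | inj₂ refl = m≤m+n (f n) _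

ind : {P : Set} → Dec P → ℕ
ind p = if does p then 1 else 0

ind-mono : {P Q : Set} (p : Dec P) (q : Dec Q) → (P → Q) → ind p ≤ ind q
ind-mono (yes p) (yes q) f = ≤-refl
ind-mono (yes p) (no ¬q) f = ⊥-elim (¬q (f p))
ind-mono (no ¬p) q f = z≤n

ind-≤1 : {P : Set} (p : Dec P) → ind p ≤ 1
ind-≤1 (yes p) = ≤-refl
ind-≤1 (no p)  = z≤n

ind-yes : {P : Set} (p : Dec P) → P → ind p ≡ 1
ind-yes (yes _) p = refl
ind-yes (no ¬p) p = ⊥-elim (¬p p)

ind-no : {P : Set} (p : Dec P) → ¬ P → ind p ≡ 0
ind-no (yes p) ¬p = ⊥-elim (¬p p)
ind-no (no _)  ¬p = refl

Decidable : (ℕ → Set) → Set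
Decidable P = ∀ x → Dec (P x)

card : ℕ → {P : ℕ → Set} → Decidable P → ℕ
card N P? = sum N (λ x → ind (P? x))

any<? : ∀ N {P : ℕ → Set} → Decidable P → Dec (∃ λ x → x < N × P x)
any<? N P? = anyUpTo? P? N

all<? : ∀ N {P : ℕ → Set} → Decidable P → Dec (∀ x → x < N → P x)
all<? N P? = map′ (λ f x → f {x}) (λ f {x} → f x) (allUpTo? P? N)

module _ (N : ℕ) {P Q : ℕ → Set} (P? : Decidable P) (Q? : Decidable Q) where

  card-mono : (∀ x → x < N → P x → Q x) → card N P? ≤ card N Q?
  card-mono h = sum-mono N λ x p → ind-mono (P? x) (Q? x) (h x p)

  -- Pigeonhole. With `Q` the touched vertices and a few others, this is how untouched vertices are
  -- found.
  pick : card N Q? < card N P? → ∃ λ x → x < N × P x × ¬ Q x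
  pick lt with any<? N (λ x → P? x ×-dec ¬? (Q? x))
  ... | yes r = r
  ... | no ¬r = ⊥-elim (<⇒≱ lt (sum-mono N λ x p → ind-mono (P? x) (Q? x) λ px →
                  decidable-stable (Q? x) λ ¬q → ¬r (x , p , px , ¬q)))

module _ (N : ℕ) {P Q : ℕ → Set} (P? : Decidable P) (Q? : Decidable Q) where

  -- A subset that is not smaller is the whole set. This turns numerical comparison into inclusion:
  -- of degrees into neighbourhoods, of numbers of teeth into twins.
  card-⊇ : (∀ x → x < N → P x → Q x) → card N Q? ≤ card N P? → ∀ x → x < N → Q x → P x
  card-⊇ P⊆Q le x x<N qx = decidable-stable (P? x) λ ¬px →
    <⇒≱ (strictly ¬px) le
    where
    P∪x? : ∀ y → Dec (P y ⊎ y ≡ x)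
    P∪x? y = P? y ⊎-dec (y ≟ x)
    split : ¬ P x → ∀ n → x < n → suc (card n P?) ≤ card n P∪x?
    split ¬px (suc n) (s≤s p) with m≤n⇒m<n∨m≡n p
    ... | inj₁ q = ≤-trans (≤-reflexive (symm (+-suc _ _)))
                     (+-mono-≤ (ind-mono (P? n) (P∪x? n) inj₁) (split ¬px n q))
    ... | inj₂ refl = +-mono-≤ (≤-reflexive (trans (cong suc (ind-no (P? x) ¬px)) (symm (ind-yes (P∪x? x) (inj₂ refl)))))
                        (sum-mono n λ y _ → ind-mono (P? y) (P∪x? y) inj₁)
    strictly : ¬ P x → card N P? < card N Q?
    strictly ¬px = ≤-trans (split ¬px N x<N)
      (card-mono N P∪x? Q? λ { y y<N (inj₁ p) → P⊆Q y y<N p ; y y<N (inj₂ refl) → qx })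

module _ (N : ℕ) {P Q R : ℕ → Set} (P? : Decidable P) (Q? : Decidable Q) (R? : Decidable R) where

  card-∪ : (∀ x → x < N → P x → Q x ⊎ R x) → card N P? ≤ card N Q? + card N R?
  card-∪ h = ≤-trans (sum-mono N go) (≤-reflexive (sum-+ N _ _))
    where
    go : ∀ x → x < N → ind (P? x) ≤ ind (Q? x) + ind (R? x)
    go x p with P? x
    ... | no _ = z≤n
    ... | yes px with h x p px
    ... | inj₁ q rewrite ind-yes (Q? x) q = s≤s z≤n
    ... | inj₂ r rewrite ind-yes (R? x) r = m≤n+m 1 _

card-none : ∀ N {P : ℕ → Set} (P? : Decidable P) → (∀ x → x < N → ¬ P x) → card N P? ≡ 0
card-none N P? h = trans (sum-cong N λ x p → ind-no (P? x) (h x p)) (sum-0 N)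

card-≟ : ∀ N a → card N (_≟ a) ≤ 1
card-≟ zero    a = z≤n
card-≟ (suc n) a = go (n ≟ a)
  where
  go : Dec (n ≡ a) → card (suc n) (_≟ a) ≤ 1
  go (no n≢a) = +-mono-≤ (≤-reflexive (ind-no (n ≟ a) n≢a)) (card-≟ n a)
  go (yes refl) = +-mono-≤ (ind-≤1 (n ≟ n)) (≤-reflexive (card-none n (_≟ n) λ { x p refl → <-irrefl refl p }))

card-≤ : ∀ N {P : ℕ → Set} (P? : Decidable P) → card N P? ≤ N
card-≤ N P? = ≤-trans (sum-mono N λ x _ → ind-≤1 (P? x)) (≤-reflexive (trans (sum-const N 1) (*-identityʳ N)))

-- Double counting of the pairs `(x, y)` with `Q y` and `R y x`: every `x` occurs in at least one of
-- them, every `y` in at most `m`.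
card-fibres : ∀ N M {P Q : ℕ → Set} {R : ℕ → ℕ → Set} (P? : Decidable P) (Q? : Decidable Q)
  (R? : ∀ y x → Dec (R y x)) m →
  (∀ x → x < N → P x → ∃ λ y → y < M × Q y × R y x) →
  (∀ y → y < M → Q y → card N (R? y) ≤ m) →
  card N P? ≤ card M Q? * m
card-fibres N M {P} {Q} {R} P? Q? R? m cover small = begin
  card N P?
    ≤⟨ sum-mono N covered ⟩
  sum N (λ x → sum M (λ y → ind (QR? x y)))
    ≡⟨ sum-swap N M _ ⟩
  sum M (λ y → sum N (λ x → ind (QR? x y)))
    ≤⟨ sum-mono M fibre ⟩
  sum M (λ y → ind (Q? y) * m)
    ≡⟨ sum-*ʳ M _ m ⟩
  card M Q? * m ∎
  where
  open ≤-Reasoning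
  QR? : ∀ x y → Dec (Q y × R y x)
  QR? x y = Q? y ×-dec R? y x
  covered : ∀ x → x < N → ind (P? x) ≤ sum M (λ y → ind (QR? x y))
  covered x p with P? x
  ... | no _ = z≤n
  ... | yes px with cover x p px
  ... | y , y<M , qy , ryx =
    ≤-trans (≤-reflexive (symm (ind-yes (QR? x y) (qy , ryx)))) (term≤sum M (λ y → ind (QR? x y)) y<M)
  fibre : ∀ y → y < M → sum N (λ x → ind (QR? x y)) ≤ ind (Q? y) * m
  fibre y y<M with Q? y
  ... | yes q = ≤-trans (sum-mono N λ x _ → ind-mono (yes q ×-dec R? y x) (R? y x) proj₂)
                  (≤-trans (small y y<M q) (≤-reflexive (symm (+-identityʳ m))))
  ... | no ¬q = ≤-reflexive (card-none N (λ x → no ¬q ×-dec R? y x) λ x _ → ¬q ∘ proj₁)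

card-fibres′ : ∀ N M {P : ℕ → Set} {R : ℕ → ℕ → Set} (P? : Decidable P)
  (R? : ∀ y x → Dec (R y x)) m →
  (∀ x → x < N → P x → ∃ λ y → y < M × R y x) →
  (∀ y → y < M → card N (R? y) ≤ m) →
  card N P? ≤ M * m
card-fibres′ N M P? R? m cover small =
  ≤-trans (card-fibres N M P? (λ _ → yes tt) R? m
            (λ x p px → let (y , y<M , r) = cover x p px in y , y<M , tt , r)
            (λ y p _ → small y p))
          (*-monoˡ-≤ m (card-≤ M (λ _ → yes tt)))

minimise : {A : Set} (f : A → ℕ) → (∀ m → Dec (∃ λ a → f a < m)) → A → ∃ λ a → ∀ b → f a ≤ f b
minimise {A} f below? a = go (f a) a ≤-refl
  where
  go : ∀ fuel a → f a ≤ fuel → ∃ λ a → ∀ b → f a ≤ f b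
  go fuel a le with below? (f a)
  go fuel a le | no ¬b = a , λ b → ≮⇒≥ λ lt → ¬b (b , lt)
  go zero a le | yes (b , lt) = ⊥-elim (n≮0 (≤-trans lt le))
  go (suc fuel) a le | yes (b , lt) = go fuel b (s≤s⁻¹ (≤-trans lt le))

module _ (N : ℕ) {P : ℕ → Set} (P? : Decidable P) (P< : ∀ x → P x → x < N) (f : ℕ → ℕ) where

  argmin : ∃ P → ∃ λ a → P a × ∀ b → P b → f a ≤ f b
  argmin s with minimise {∃ P} (f ∘ proj₁)
         (λ m → map′ (λ { (x , _ , px , lt) → (x , px) , lt }) (λ { ((x , px) , lt) → x , P< x px , px , lt })
                  (any<? N (λ x → P? x ×-dec (f x <? m)))) s
  ... | (a , pa) , h = a , pa , λ b pb → h (b , pb)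

  private
    bounded : ∀ b → P b → f b ≤ sum N f
    bounded b pb = term≤sum N f (P< b pb)

  argmax : ∃ P → ∃ λ a → P a × ∀ b → P b → f b ≤ f a
  -- Truncated subtraction from `sum N f` reverses the order here, because the sum bounds every
  -- value of `f` on `P`.
  argmax s with minimise {∃ P} (λ a → sum N f ∸ f (proj₁ a))
         (λ m → map′ (λ { (x , _ , px , lt) → (x , px) , lt }) (λ { ((x , px) , lt) → x , P< x px , px , lt })
                  (any<? N (λ x → P? x ×-dec (sum N f ∸ f x <? m)))) s
  ... | (a , pa) , h = a , pa , λ b pb →
          ≮⇒≥ λ lt → <⇒≱ (∸-monoʳ-< lt (bounded b pb)) (h (b , pb))

-- The reduction rules

infixr 6 _∧ᶠ_
infixr 5 _∨ᶠ_
infixr 4 _⇒ᶠ_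

-- A syntax, since each rule is read twice: as a property by `⟦_⟧` and as a tape program by
-- `translate`. The quantifier `many c e` means more than c(k+1)^e vertices.
data GF (m : ℕ) : Set where
  adjᶠ           : Fin m → Fin m → GF m
  _∧ᶠ_ _∨ᶠ_ _⇒ᶠ_ : GF m → GF m → GF m
  ¬ᶠ_            : GF m → GF m
  ∀ᶠ ∃ᶠ          : GF (suc m) → GF m
  many           : ℕ → ℕ → GF (suc m) → GF m

module Semantics (N k : ℕ) (V : ℕ → Bool) (V< : ∀ x → Is (V x) → x < N) (E : ℕ → ℕ → Bool) where

  V? : Decidable (λ x → Is (V x))
  V? x = is? (V x)

  ∀V? : {P : ℕ → Set} → Decidable P → Dec (∀ x → Is (V x) → P x)
  ∀V? P? = map′ (λ f x v → f x (V< x v) v) (λ f x _ → f x) (all<? N (λ x → V? x →-dec P? x))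

  ∃V? : {P : ℕ → Set} → Decidable P → Dec (∃ λ x → Is (V x) × P x)
  ∃V? P? = map′ (λ { (x , _ , r) → x , r }) (λ { (x , v , r) → x , V< x v , v , r })
             (any<? N (λ x → V? x ×-dec P? x))

  mutual
    ⟦_⟧ : ∀ {m} → GF m → Vec ℕ m → Set
    ⟦ adjᶠ i j ⟧   ρ = Is (E (lookup ρ i) (lookup ρ j))
    ⟦ φ ∧ᶠ ψ ⟧     ρ = ⟦ φ ⟧ ρ × ⟦ ψ ⟧ ρ
    ⟦ φ ∨ᶠ ψ ⟧     ρ = ⟦ φ ⟧ ρ ⊎ ⟦ ψ ⟧ ρ
    ⟦ φ ⇒ᶠ ψ ⟧     ρ = ⟦ φ ⟧ ρ → ⟦ ψ ⟧ ρ
    ⟦ ¬ᶠ φ ⟧       ρ = ¬ ⟦ φ ⟧ ρ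
    ⟦ ∀ᶠ φ ⟧       ρ = ∀ x → Is (V x) → ⟦ φ ⟧ (x ∷ ρ)
    ⟦ ∃ᶠ φ ⟧       ρ = ∃ λ x → Is (V x) × ⟦ φ ⟧ (x ∷ ρ)
    ⟦ many c e φ ⟧ ρ = suc k ^ e * c < card N (λ x → V? x ×-dec dec φ (x ∷ ρ))

    dec : ∀ {m} (φ : GF m) ρ → Dec (⟦ φ ⟧ ρ)
    dec (adjᶠ i j)   ρ = is? _
    dec (φ ∧ᶠ ψ)     ρ = dec φ ρ ×-dec dec ψ ρ
    dec (φ ∨ᶠ ψ)     ρ = dec φ ρ ⊎-dec dec ψ ρ
    dec (φ ⇒ᶠ ψ)     ρ = dec φ ρ →-dec dec ψ ρ
    dec (¬ᶠ φ)       ρ = ¬? (dec φ ρ)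
    dec (∀ᶠ φ)       ρ = ∀V? (λ x → dec φ (x ∷ ρ))
    dec (∃ᶠ φ)       ρ = ∃V? (λ x → dec φ (x ∷ ρ))
    dec (many c e φ) ρ = _ <? _

pattern v0 = zero
pattern v1 = suc zero
pattern v2 = suc (suc zero)
pattern v3 = suc (suc (suc zero))

-- These speak of closed neighbourhoods: inclusion makes the two vertices adjacent, mutual inclusion
-- makes them true twins, and every vertex is its own twin.
subᶠ twinᶠ : ∀ {m} → Fin m → Fin m → GF m
subᶠ x y = ∀ᶠ (adjᶠ (suc x) v0 ⇒ᶠ adjᶠ (suc y) v0)
twinᶠ x y = subᶠ x y ∧ᶠ subᶠ y x

manyTwinsᶠ : ∀ {m} → Fin m → GF m
manyTwinsᶠ x = many 3 1 (twinᶠ (suc x) v0)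

offᶠ : ∀ {m} → Fin m → Fin m → Fin m → GF m
offᶠ a b z = ¬ᶠ (adjᶠ a z ∧ᶠ adjᶠ b z)

-- C₄ and P₄ at once: whether the ends `p` and `q` are adjacent is left open. As adjacency is
-- reflexive, the missing chords also keep the four vertices distinct.
obstructᶠ : ∀ {m} → Fin m → Fin m → Fin m → Fin m → GF m
obstructᶠ p u w q = adjᶠ p u ∧ᶠ adjᶠ u w ∧ᶠ adjᶠ w q ∧ᶠ ¬ᶠ adjᶠ p w ∧ᶠ ¬ᶠ adjᶠ u q

-- Reversal moves any vertex of an obstruction to its first or second place, which leaves two cases
-- for `x`.
badᶠ : ∀ {m} → Fin m → Fin m → Fin m → GF m
badᶠ a b x = ∃ᶠ (adjᶠ (suc a) v0 ∧ᶠ adjᶠ (suc b) v0 ∧ᶠ ¬ᶠ adjᶠ (suc x) v0)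
  ∨ᶠ ∃ᶠ (∃ᶠ (∃ᶠ (off‴ v0 ∧ᶠ off‴ v1 ∧ᶠ off‴ v2
       ∧ᶠ (obstructᶠ x‴ v2 v1 v0 ∨ᶠ obstructᶠ v2 x‴ v1 v0))))
  where
  x‴ = suc (suc (suc x))
  off‴ = offᶠ (suc (suc (suc a))) (suc (suc (suc b)))

-- The vertices whose component outside N[a] ∩ N[b] is trivially perfect and
-- complete to N[a] ∩ N[b]; such components have diameter at most two.
inModuleᶠ : ∀ {m} → Fin m → Fin m → Fin m → GF m
inModuleᶠ a b z = offᶠ a b z
  ∧ᶠ ∀ᶠ (∀ᶠ (offᶠ (suc (suc a)) (suc (suc b)) v1 ⇒ᶠ adjᶠ (suc (suc z)) v1
        ⇒ᶠ offᶠ (suc (suc a)) (suc (suc b)) v0 ⇒ᶠ adjᶠ v1 v0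
        ⇒ᶠ ¬ᶠ badᶠ (suc (suc a)) (suc (suc b)) v0))

moduleRuleᶠ : ∀ {m} → Fin m → GF m
moduleRuleᶠ v = ∀ᶠ (¬ᶠ manyTwinsᶠ v0)
  ∧ᶠ ∃ᶠ (∃ᶠ (inModuleᶠ v1 v0 (suc (suc v)) ∧ᶠ many 27 3 (inModuleᶠ v2 v1 v0)))

-- Between a vertex y and a vertex z below it, a comb consists of a shaft, the
-- vertices with neighbourhood between N[z] and N[y], and of teeth, the
-- vertices of N[y] outside N[z].
toothᶠ shaftᶠ bodyᶠ : ∀ {m} → Fin m → Fin m → Fin m → GF m
toothᶠ y z x = adjᶠ y x ∧ᶠ ¬ᶠ adjᶠ z x
shaftᶠ y z x = subᶠ z x ∧ᶠ subᶠ x y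
bodyᶠ y z x = toothᶠ y z x ∨ᶠ shaftᶠ y z x

-- The middle clause makes every outside neighbour of a tooth behave like a vertex above the whole
-- comb; the last clause forbids obstructions in the body.
combᶠ : ∀ {m} → Fin m → Fin m → GF m
combᶠ y z = subᶠ z y
  ∧ᶠ ∀ᶠ (∀ᶠ (toothᶠ (suc (suc y)) (suc (suc z)) v1 ⇒ᶠ ¬ᶠ bodyᶠ (suc (suc y)) (suc (suc z)) v0 ⇒ᶠ adjᶠ v1 v0
        ⇒ᶠ adjᶠ (suc (suc z)) v0 ∧ᶠ ∀ᶠ (toothᶠ (suc (suc (suc y))) (suc (suc (suc z))) v0 ⇒ᶠ adjᶠ v0 v1)))
  ∧ᶠ ∀ᶠ (∀ᶠ (∀ᶠ (∀ᶠ (body⁗ v3 ⇒ᶠ body⁗ v2 ⇒ᶠ body⁗ v1 ⇒ᶠ body⁗ v0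
        ⇒ᶠ adjᶠ v3 v2 ⇒ᶠ adjᶠ v2 v1 ⇒ᶠ adjᶠ v1 v0 ⇒ᶠ adjᶠ v3 v1 ∨ᶠ adjᶠ v2 v0))))
  where body⁗ = bodyᶠ (suc (suc (suc (suc y)))) (suc (suc (suc (suc z))))

-- Downwards the chain is y, v, w, z, with indices `v2`, `v‴`, `v0`, `v1`. The three counts supply a
-- tooth lost between y and v, a shaft vertex from v to w, and a tooth lost between w and z.
combRuleᶠ : ∀ {m} → Fin m → GF m
combRuleᶠ v = ∃ᶠ (∃ᶠ (∃ᶠ (combᶠ v2 v1 ∧ᶠ subᶠ v‴ v2 ∧ᶠ subᶠ v1 v0 ∧ᶠ subᶠ v0 v‴
  ∧ᶠ many 3 1 (toothᶠ v3 v2 v0 ∧ᶠ ¬ᶠ adjᶠ (suc v‴) v0)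
  ∧ᶠ many 3 1 (subᶠ v1 v0 ∧ᶠ subᶠ v0 (suc v‴))
  ∧ᶠ many 3 1 (toothᶠ v3 v2 v0 ∧ᶠ adjᶠ v1 v0))))
  where v‴ = suc (suc (suc v))

reducibleᶠ : ∀ {m} → Fin m → GF m
reducibleᶠ v = manyTwinsᶠ v ∨ᶠ moduleRuleᶠ v ∨ᶠ combRuleᶠ v

-- Trivially perfect graphs

Rel₂ : Set
Rel₂ = ℕ → ℕ → Bool

-- Adjacency is taken reflexive throughout: then C₄ and P₄ are excluded
-- together by the one condition below, and true twins are equal rows.
TPon : (ℕ → Set) → Rel₂ → Set
TPon P H = ∀ p u w q → P p → P u → P w → P q →
  Is (H p u) → Is (H u w) → Is (H w q) → Is (H p w) ⊎ Is (H u q)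

TPon-⊆ : ∀ {P Q : ℕ → Set} {H} → (∀ x → Q x → P x) → TPon P H → TPon Q H
TPon-⊆ s tp p u w q Pp Pu Pw Pq = tp p u w q (s p Pp) (s u Pu) (s w Pw) (s q Pq)

TPon-≗ : ∀ {P : ℕ → Set} {H K} → (∀ x y → P x → P y → H x y ≡ K x y) → TPon P H → TPon P K
TPon-≗ {P} {H} {K} eq tp p u w q Pp Pu Pw Pq pu uw wq
  rewrite symm (eq p u Pp Pu) | symm (eq u w Pu Pw) | symm (eq w q Pw Pq)
        | symm (eq p w Pp Pw) | symm (eq u q Pu Pq) = tp p u w q Pp Pu Pw Pq pu uw wq

-- A module `W` whose neighbourhood is a clique is put in place of the vertex `a`. Contracting `W`
-- to `a` turns a possible obstruction into a walk that has a chord by `tp-a`. The chord lifts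
-- unless both its ends lie in `W`; `both` settles that case by the position of the other two
-- vertices.
module Substitution (H : Rel₂) (H-sym : ∀ x y → Is (H x y) → Is (H y x)) (H-refl : ∀ x → Is (H x x))
  {P W : ℕ → Set} (W? : Decidable W)
  (module-W : ∀ x x′ y → W x → W x′ → P y → ¬ W y → Is (H x y) → Is (H x′ y))
  (clique-N : ∀ x p q → W x → P p → P q → ¬ W p → ¬ W q → Is (H x p) → Is (H x q) → Is (H p q))
  (tp-W : TPon (λ x → P x × W x) H)
  (a : ℕ) (Pa : P a) (Wa : W a)
  (tp-a : TPon (λ x → P x × (W x → x ≡ a)) H)
  where

  private
    φ : ∀ x → Dec (W x) → ℕ
    φ x (yes _) = a
    φ x (no _)  = x

    Pφ : ∀ x d → P x → P (φ x d) × (W (φ x d) → φ x d ≡ a)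
    Pφ x (yes _) px = Pa , λ _ → refl
    Pφ x (no ¬w) px = px , λ w → ⊥-elim (¬w w)

    φ-edge : ∀ x y d e → P x → P y → Is (H x y) → Is (H (φ x d) (φ y e))
    φ-edge x y (yes _) (yes _) _ _ _ = H-refl a
    φ-edge x y (yes w) (no ¬w) px py xy = module-W x a y w Wa py ¬w xy
    φ-edge x y (no ¬w) (yes w) px py xy = H-sym _ _ (module-W y a x w Wa px ¬w (H-sym _ _ xy))
    φ-edge x y (no _) (no _) px py xy = xy

    unφ : ∀ x y d e → P x → P y → Is (H (φ x d) (φ y e)) → Is (H x y) ⊎ (W x × W y)
    unφ x y (yes w) (yes w′) _ _ _ = inj₂ (w , w′)
    unφ x y (yes w) (no ¬w) px py xy = inj₁ (module-W a x y Wa w py ¬w xy)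
    unφ x y (no ¬w) (yes w) px py xy = inj₁ (H-sym _ _ (module-W a y x Wa w px ¬w (H-sym _ _ xy)))
    unφ x y (no _) (no _) px py xy = inj₁ xy

    both : ∀ p u w q → P p → P u → P w → P q →
      Is (H p u) → Is (H u w) → Is (H w q) → W p → W w → Is (H p w) ⊎ Is (H u q)
    both p u w q Pp Pu Pw Pq pu uw wq Wp Ww with W? u | W? q
    ... | yes Wu | yes Wq = tp-W p u w q (Pp , Wp) (Pu , Wu) (Pw , Ww) (Pq , Wq) pu uw wq
    ... | yes Wu | no ¬q  = inj₂ (module-W w u q Ww Wu Pq ¬q wq)
    ... | no ¬u  | yes Wq = inj₂ (H-sym _ _ (module-W p q u Wp Wq Pu ¬u pu))
    ... | no ¬u  | no ¬q  = inj₂ (clique-N w u q Ww Pu Pq ¬u ¬q (H-sym _ _ uw) wq)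

  substitution : TPon P H
  substitution p u w q Pp Pu Pw Pq pu uw wq
    with tp-a (φ p (W? p)) (φ u (W? u)) (φ w (W? w)) (φ q (W? q))
           (Pφ p (W? p) Pp) (Pφ u (W? u) Pu) (Pφ w (W? w) Pw) (Pφ q (W? q) Pq)
           (φ-edge p u (W? p) (W? u) Pp Pu pu) (φ-edge u w (W? u) (W? w) Pu Pw uw) (φ-edge w q (W? w) (W? q) Pw Pq wq)
  substitution p u w q Pp Pu Pw Pq pu uw wq | inj₁ e with unφ p w (W? p) (W? w) Pp Pw e
  ... | inj₁ pw = inj₁ pw
  ... | inj₂ (Wp , Ww) = both p u w q Pp Pu Pw Pq pu uw wq Wp Ww
  substitution p u w q Pp Pu Pw Pq pu uw wq | inj₂ e with unφ u q (W? u) (W? q) Pu Pq e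
  ... | inj₁ uq = inj₂ uq
  ... | inj₂ (Wu , Wq) with both q w u p Pq Pw Pu Pp (H-sym _ _ wq) (H-sym _ _ uw) (H-sym _ _ pu) Wq Wu
  ...   | inj₁ qu = inj₂ (H-sym _ _ qu)
  ...   | inj₂ wp = inj₁ (H-sym _ _ wp)


-- The forest order of a trivially perfect graph

module Order (N : ℕ) (H : Rel₂) (H-refl : ∀ x → Is (H x x)) (H-sym : ∀ x y → Is (H x y) → Is (H y x))
  {P : ℕ → Set} (P? : Decidable P) (P< : ∀ x → P x → x < N) (tp : TPon P H) where

  infix 4 _⊑_ _⊑?_

  -- The ancestor order of the rooted forest behind a trivially perfect graph, with ancestors larger
  -- and true twins equivalent.
  _⊑_ : ℕ → ℕ → Set
  x ⊑ y = ∀ z → P z → Is (H x z) → Is (H y z)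

  ⊑-trans : ∀ {x y z} → x ⊑ y → y ⊑ z → x ⊑ z
  ⊑-trans f g w pw = g w pw ∘ f w pw

  ∀P? : {Q : ℕ → Set} → Decidable Q → Dec (∀ x → P x → Q x)
  ∀P? Q? = map′ (λ f x p → f x (P< x p) p) (λ f x _ → f x) (all<? N (λ x → P? x →-dec Q? x))

  ∃P? : {Q : ℕ → Set} → Decidable Q → Dec (∃ λ x → P x × Q x)
  ∃P? Q? = map′ (λ { (x , _ , r) → x , r }) (λ { (x , v , r) → x , P< x v , v , r })
             (any<? N (λ x → P? x ×-dec Q? x))

  ∄⇒∀ : {Q R : ℕ → Set} → Decidable R → ¬ (∃ λ x → P x × Q x × ¬ R x) → ∀ x → P x → Q x → R x
  ∄⇒∀ R? ∄ x px qx = decidable-stable (R? x) λ ¬r → ∄ (x , px , qx , ¬r)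

  ¬∀⇒∃ : {Q R : ℕ → Set} → Decidable Q → Decidable R → ¬ (∀ x → P x → Q x → R x) → ∃ λ x → P x × Q x × ¬ R x
  ¬∀⇒∃ Q? R? ¬∀ = decidable-stable (∃P? (λ x → Q? x ×-dec ¬? (R? x))) λ ∄ → ¬∀ (∄⇒∀ R? ∄)

  _⊑?_ : ∀ x y → Dec (x ⊑ y)
  x ⊑? y = ∀P? (λ z → is? (H x z) →-dec is? (H y z))

  -- A neighbour `z` of `x` alone and a neighbour `q` of `y` alone would make `z x y q` an
  -- obstruction.
  comparable : ∀ {x y} → P x → P y → Is (H x y) → x ⊑ y ⊎ y ⊑ x
  comparable {x} {y} px py xy with ∃P? (λ z → is? (H x z) ×-dec ¬? (is? (H y z)))
  ... | no ∄ = inj₁ (∄⇒∀ (λ z → is? (H y z)) ∄)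
  ... | yes (z , pz , xz , ¬yz) = inj₂ λ q pq yq →
          [ (λ zy → ⊥-elim (¬yz (H-sym _ _ zy))) , id ]′ (tp z x y q pz px py pq (H-sym _ _ xz) xy yq)

  deg : ℕ → ℕ
  deg x = card N (λ z → P? z ×-dec is? (H x z))

  -- Degree ranks comparable vertices, so highest and lowest vertices can be selected by degree.
  ⊑-antisym : ∀ {x y} → x ⊑ y → deg y ≤ deg x → y ⊑ x
  ⊑-antisym {x} {y} s le z pz yz =
    proj₂ (card-⊇ N (λ z → P? z ×-dec is? (H x z)) (λ z → P? z ×-dec is? (H y z))
             (λ { z _ (pz , xz) → pz , s z pz xz }) le z (P< z pz) (pz , yz))

-- Leaves and least common ancestors

module Leaves (N : ℕ) (E : Rel₂) (E-refl : ∀ x → Is (E x x)) (E-sym : ∀ x y → Is (E x y) → Is (E y x))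
  {P : ℕ → Set} (P? : Decidable P) (P< : ∀ x → P x → x < N) (tp : TPon P E) where

  open Order N E E-refl E-sym P? P< tp

  Leaf : ℕ → Set
  Leaf l = P l × (∀ y → P y → Is (E l y) → l ⊑ y)

  leaf? : Decidable Leaf
  leaf? l = P? l ×-dec ∀P? (λ y → is? (E l y) →-dec (l ⊑? y))

  -- The least leaf of each class of adjacent (hence twin) leaves.
  LeastLeaf : ℕ → Set
  LeastLeaf l = Leaf l × (∀ x → x < l → Leaf x → ¬ Is (E l x))

  leastLeaf? : Decidable LeastLeaf
  leastLeaf? l = leaf? l ×-dec all<? l (λ x → leaf? x →-dec ¬? (is? (E l x)))

  leastLeaf-independent : ∀ {x y} → LeastLeaf x → LeastLeaf y → Is (E x y) → x ≡ y
  leastLeaf-independent {x} {y} (lx , mx) (ly , my) xy with <-cmp x y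
  ... | tri< x<y _ _ = ⊥-elim (my x x<y lx (E-sym _ _ xy))
  ... | tri≈ _ eq _  = eq
  ... | tri> _ _ y<x = ⊥-elim (mx y y<x ly xy)

  leaf-below : ∀ {z} → P z → ∃ λ l → Leaf l × l ⊑ z
  leaf-below {z} pz with argmin N (λ l → P? l ×-dec (l ⊑? z)) (λ l p → P< l (proj₁ p)) deg (z , pz , λ _ _ e → e)
  ... | l , (pl , l⊑z) , least = l , (pl , λ y py ly →
          [ id , (λ y⊑l → ⊑-antisym y⊑l (least y (py , ⊑-trans y⊑l l⊑z))) ]′ (comparable pl py ly)) , l⊑z

  leastLeaf-below : ∀ {z} → P z → ∃ λ l → LeastLeaf l × l ⊑ z
  leastLeaf-below {z} pz with leaf-below pz
  ... | m , Lm , m⊑z with argmin N (λ l → leaf? l ×-dec is? (E m l)) (λ l p → P< l (proj₁ (proj₁ p))) id (m , Lm , E-refl m)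
  ... | l , (Ll , ml) , least = l , (Ll , λ x x<l Lx lx → <⇒≱ x<l (least x (Lx , l⊑m x (proj₁ Lx) lx))) , ⊑-trans l⊑m m⊑z
    where
    l⊑m : l ⊑ m
    l⊑m = proj₂ Ll m (proj₁ Lm) (E-sym _ _ ml)

  -- `w` is a least common ancestor of `l` and `m`, hence unique up to twins.
  Tight : ℕ → ℕ → ℕ → Set
  Tight l m w = P w × l ⊑ w × m ⊑ w × (∀ x → P x → l ⊑ x → m ⊑ x → w ⊑ x)

  tight? : ∀ l m w → Dec (Tight l m w)
  tight? l m w = P? w ×-dec (l ⊑? w) ×-dec (m ⊑? w) ×-dec
    ∀P? (λ x → (l ⊑? x) →-dec (m ⊑? x) →-dec (w ⊑? x))

  -- As an ancestor, `x` is a neighbour of `l`, and `y` inherits all neighbours of `l`.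
  above-meet : ∀ {l x y} → P l → P x → l ⊑ x → l ⊑ y → Is (E y x)
  above-meet {l} {x} pl px l⊑x l⊑y = l⊑y x px (E-sym _ _ (l⊑x l pl (E-refl l)))

  private
    TightLeaves : ℕ → Set
    TightLeaves w = ∃ λ l → LeastLeaf l × (∃ λ m → LeastLeaf m × Tight l m w)

    leaf-tight : ∀ w → P w → (∀ x → P x → Is (E w x) → w ⊑ x) → TightLeaves w
    leaf-tight w pw minimal = let (l , Ll , l⊑w) = leastLeaf-below pw in
      l , Ll , l , Ll , pw , l⊑w , l⊑w , λ x px l⊑x _ →
        minimal x px (above-meet (proj₁ (proj₁ Ll)) px l⊑x l⊑w)

    -- Here `z` is a highest vertex strictly below `w`, and `q` lies below `w` but is not adjacent
    -- to `z`. A common ancestor `x` of leaves under both that is not above `w` would be adjacent to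
    -- `w` and lie strictly above `z`, against the choice of `z`.
    branching-tight : ∀ w z q → P w → P z → Is (E w z) → ¬ (w ⊑ z) →
      (∀ x → P x × Is (E w x) × ¬ (w ⊑ x) → deg x ≤ deg z) →
      P q → Is (E w q) → ¬ Is (E z q) → TightLeaves w
    branching-tight w z q pw pz wz w⋢z greatest pq wq ¬zq =
      let (l , Ll , l⊑z) = leastLeaf-below pz
          (m , Lm , m⊑q) = leastLeaf-below pq
      in l , Ll , m , Lm , pw , ⊑-trans l⊑z z⊑w , ⊑-trans m⊑q q⊑w ,
         least (proj₁ (proj₁ Ll)) (proj₁ (proj₁ Lm)) l⊑z m⊑q
      where
      z⊑w : z ⊑ w
      z⊑w = [ ⊥-elim ∘ w⋢z , id ]′ (comparable pw pz wz)
      q⊑w : q ⊑ w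
      q⊑w = [ (λ w⊑q → ⊥-elim (¬zq (E-sym _ _ (w⊑q z pz wz)))) , id ]′ (comparable pw pq wq)
      least : ∀ {l m} → P l → P m → l ⊑ z → m ⊑ q → ∀ x → P x → l ⊑ x → m ⊑ x → w ⊑ x
      least pl pm l⊑z m⊑q x px l⊑x m⊑x = decidable-stable (w ⊑? x) λ w⋢x →
        let wx  = above-meet pl px l⊑x (⊑-trans l⊑z z⊑w)
            xz  = above-meet pl pz l⊑z l⊑x
            xq  = above-meet pm pq m⊑q m⊑x
            x⋢z = λ (x⊑z : x ⊑ z) → ¬zq (x⊑z q pq xq)
        in [ x⋢z , (λ z⊑x → x⋢z (⊑-antisym z⊑x (greatest x (px , wx , w⋢x)))) ]′ (comparable px pz xz)

  -- Every vertex is the least common ancestor of two leaves.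
  tight-leaves : ∀ w → P w → ∃ λ l → LeastLeaf l × (∃ λ m → LeastLeaf m × Tight l m w)
  tight-leaves w pw = go (∃P? (λ z → is? (E w z) ×-dec ¬? (w ⊑? z)))
    where
    go : Dec (∃ λ z → P z × Is (E w z) × ¬ (w ⊑ z)) → TightLeaves w
    go (no ∄)  = leaf-tight w pw (∄⇒∀ (w ⊑?_) ∄)
    go (yes s) =
      let (z , (pz , wz , w⋢z) , greatest) =
            argmax N (λ z → P? z ×-dec is? (E w z) ×-dec ¬? (w ⊑? z)) (λ z p → P< z (proj₁ p)) deg s
          (q , pq , wq , ¬zq) = ¬∀⇒∃ (λ q → is? (E w q)) (λ q → is? (E z q)) w⋢z
      in branching-tight w z q pw pz wz w⋢z greatest pq wq ¬zq

  module _ (θ : ℕ) (small : ∀ w → P w → card N (λ x → P? x ×-dec (w ⊑? x) ×-dec (x ⊑? w)) ≤ θ) where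

    tight-small : ∀ l m → card N (tight? l m) ≤ θ
    tight-small l m with any<? N (tight? l m)
    ... | no ∄ = ≤-trans (≤-reflexive (card-none N (tight? l m) λ x x<N t → ∄ (x , x<N , t))) z≤n
    ... | yes (w , _ , pw , l⊑w , m⊑w , lw) =
      ≤-trans (card-mono N (tight? l m) (λ x → P? x ×-dec (w ⊑? x) ×-dec (x ⊑? w))
                 λ { x _ (px , l⊑x , m⊑x , lx) → px , lw x px l⊑x m⊑x , lx w pw l⊑w m⊑w })
              (small w pw)

    -- Each vertex is charged to a pair of leaves, and a pair receives only the twins of one least
    -- common ancestor.
    card-via-leaves : card N P? ≤ card N leastLeaf? * (card N leastLeaf? * θ)
    card-via-leaves =
      card-fibres N N P? leastLeaf? (λ l x → any<? N (λ m → leastLeaf? m ×-dec tight? l m x)) _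
        (λ x _ px → let (l , Ll , m , Lm , t) = tight-leaves x px
                    in l , P< l (proj₁ (proj₁ Ll)) , Ll , m , P< m (proj₁ (proj₁ Lm)) , Lm , t)
        (λ l _ _ → card-fibres N N (λ x → any<? N (λ m → leastLeaf? m ×-dec tight? l m x)) leastLeaf? (tight? l) θ
                     (λ { _ _ (m , r) → m , r }) (λ m _ _ → tight-small l m))

-- Safety of the reduction rules

Bool-iff : ∀ {a b : Bool} → (Is a → Is b) → (Is b → Is a) → a ≡ b
Bool-iff {true}  {true}  f g = refl
Bool-iff {true}  {false} f g = symm (f refl)
Bool-iff {false} {true}  f g = g refl
Bool-iff {false} {false} f g = refl

module Editing (N k : ℕ) (E : Rel₂) (E-refl : ∀ x → Is (E x x)) (E-sym : ∀ x y → Is (E x y) → Is (E y x)) where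

  Differ : (ℕ → Bool) → Rel₂ → ℕ → ℕ → Set
  Differ V H x y = Is (V x) × Is (V y) × ¬ E x y ≡ H x y

  differ? : ∀ V H x y → Dec (Differ V H x y)
  differ? V H x y = is? (V x) ×-dec is? (V y) ×-dec ¬? (E x y Bool.≟ H x y)

  -- Ordered pairs are counted, so an edit set of size k has distance 2 k.
  distance : (ℕ → Bool) → Rel₂ → ℕ
  distance V H = sum N λ x → sum N λ y → ind (differ? V H x y)

  -- `H` lives on all of ℕ, while edits are counted inside `V` only, so the same relation can be
  -- reused when `V` shrinks.
  record Solution (V : ℕ → Bool) : Set where
    field
      H      : Rel₂
      H-refl : ∀ x → Is (H x x)
      H-sym  : ∀ x y → Is (H x y) → Is (H y x)
      H-tp   : TPon (λ x → Is (V x)) H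
      H-few  : distance V H ≤ 2 * k

  module Touching (V : ℕ → Bool) (V< : ∀ x → Is (V x) → x < N) (S : Solution V) where
    open Solution S

    Touched : ℕ → Set
    Touched x = ∃ λ y → y < N × Differ V H x y

    touched? : Decidable Touched
    touched? x = any<? N (differ? V H x)

    few-touched : card N touched? ≤ 2 * k
    few-touched = ≤-trans (sum-mono N go) H-few
      where
      go : ∀ x → x < N → ind (touched? x) ≤ sum N (λ y → ind (differ? V H x y))
      go x p with touched? x
      ... | no _ = z≤n
      ... | yes (y , y<N , d) = ≤-trans (≤-reflexive (symm (ind-yes (differ? V H x y) d)))
                                  (term≤sum N (λ y → ind (differ? V H x y)) y<N)

    untouched : ∀ x y → Is (V x) → Is (V y) → ¬ Touched x → E x y ≡ H x y
    untouched x y vx vy ¬t = decidable-stable (E x y Bool.≟ H x y) λ ne → ¬t (y , V< y vy , vx , vy , ne)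

    E⇒H : ∀ x y → Is (V x) → Is (V y) → ¬ Touched x → Is (E x y) → Is (H x y)
    E⇒H x y vx vy ¬t e = trans (symm (untouched x y vx vy ¬t)) e

    H⇒E : ∀ x y → Is (V x) → Is (V y) → ¬ Touched x → Is (H x y) → Is (E x y)
    H⇒E x y vx vy ¬t e = trans (untouched x y vx vy ¬t) e

  2k+2≤θ : 2 * k + 2 ≤ suc k ^ 1 * 3
  2k+2≤θ = begin
    2 * k + 2       ≡⟨ cong (_+ 2) (*-comm 2 k) ⟩
    k * 2 + 2       ≡⟨ +-comm (k * 2) 2 ⟩
    suc k * 2       ≤⟨ *-monoʳ-≤ (suc k) {2} {3} (s≤s (s≤s z≤n)) ⟩
    suc k * 3       ≡⟨ cong (_* 3) (symm (*-identityʳ (suc k))) ⟩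
    suc k ^ 1 * 3   ∎
    where open ≤-Reasoning

  module Deletion (V V′ : ℕ → Bool) (V< : ∀ x → Is (V x) → x < N) (v : ℕ)
    (V∋v : Is (V v)) (V′⊆V : ∀ x → Is (V′ x) → Is (V x)) (V′∌v : ∀ x → Is (V′ x) → x ≢ v)
    (V∖v : ∀ x → Is (V x) → x ≢ v → Is (V′ x)) (S : Solution V′) where

    open Solution S
    open Touching V′ (λ x p → V< x (V′⊆V x p)) S
    open Semantics N k V V< E

    -- At most 2k + 2 vertices are excluded: the touched ones, `v`, and a spare `a` for the case
    -- that two different vertices are wanted.
    pick-untouched : ∀ a {P : ℕ → Set} (P? : Decidable P) → suc k ^ 1 * 3 < card N P? →
      ∃ λ x → P x × ¬ Touched x × x ≢ v × x ≢ a
    pick-untouched a P? big =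
      let (x , _ , px , ¬q) = pick N P? Q? (≤-<-trans few big)
      in x , px , ¬q ∘ inj₁ , ¬q ∘ inj₂ ∘ inj₁ , ¬q ∘ inj₂ ∘ inj₂
      where
      Q? : Decidable (λ x → Touched x ⊎ x ≡ v ⊎ x ≡ a)
      Q? x = touched? x ⊎-dec (x ≟ v) ⊎-dec (x ≟ a)
      or? : Decidable (λ x → x ≡ v ⊎ x ≡ a)
      or? x = (x ≟ v) ⊎-dec (x ≟ a)
      few : card N Q? ≤ suc k ^ 1 * 3
      few = begin
        card N Q?                                          ≤⟨ card-∪ N Q? touched? or? (λ _ _ → id) ⟩
        card N touched? + card N or?
          ≤⟨ +-mono-≤ few-touched (≤-trans (card-∪ N or? (_≟ v) (_≟ a) (λ _ _ → id)) (+-mono-≤ (card-≟ N v) (card-≟ N a))) ⟩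
        2 * k + 2                                          ≤⟨ 2k+2≤θ ⟩
        suc k ^ 1 * 3                                      ∎
        where open ≤-Reasoning

    -- The cost does not grow, because every pair edited by `H⁺` avoids `v` and was edited by `H`
    -- already.
    extend : (H⁺ : Rel₂) → (∀ x → Is (H⁺ x x)) → (∀ x y → Is (H⁺ x y) → Is (H⁺ y x)) → TPon (λ x → Is (V x)) H⁺ →
      (∀ x y → Is (V x) → Is (V y) → ¬ E x y ≡ H⁺ x y → x ≢ v × y ≢ v × H⁺ x y ≡ H x y) → Solution V
    extend H⁺ H⁺-refl H⁺-sym H⁺-tp new = record
      { H = H⁺ ; H-refl = H⁺-refl ; H-sym = H⁺-sym ; H-tp = H⁺-tp
      ; H-few = ≤-trans (sum-mono N λ x _ → sum-mono N λ y _ →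
                  ind-mono (differ? V H⁺ x y) (differ? V′ H x y) (go x y)) H-few }
      where
      go : ∀ x y → Differ V H⁺ x y → Differ V′ H x y
      go x y (vx , vy , ne) with new x y vx vy ne
      ... | x≢v , y≢v , eq = V∖v x vx x≢v , V∖v y vy y≢v , λ e → ne (trans e (symm eq))

    -- The new solution treats `v` as a copy of an untouched twin `w`. The rows of `v` and `w` agree
    -- in `E`, and `H` keeps the row of `w`, so no pair at `v` is edited.
    twin-safe : ⟦ manyTwinsᶠ v0 ⟧ (v ∷ []) → Solution V
    twin-safe big with pick-untouched v (λ x → V? x ×-dec dec (twinᶠ v1 v0) (x ∷ v ∷ [])) big
    ... | w , (Vw , v⊑w , w⊑v) , ¬tw , w≢v , _ = extend H⁺ (λ x → H-refl _) (λ x y → H-sym _ _)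
            (λ p u w q Pp Pu Pw Pq → H-tp _ _ _ _ (V′φ p Pp) (V′φ u Pu) (V′φ w Pw) (V′φ q Pq)) new
      where
      φ′ : ∀ x → Dec (x ≡ v) → ℕ
      φ′ x (yes _) = w
      φ′ x (no _)  = x
      φ : ℕ → ℕ
      φ x = φ′ x (x ≟ v)
      H⁺ : Rel₂
      H⁺ x y = H (φ x) (φ y)
      V′w : Is (V′ w)
      V′w = V∖v w Vw w≢v
      V′φ : ∀ x → Is (V x) → Is (V′ (φ x))
      V′φ x vx with x ≟ v
      ... | yes _ = V′w
      ... | no ne = V∖v x vx ne
      row : ∀ y → Is (V y) → y ≢ v → E v y ≡ H w y
      row y vy y≢v = trans (Bool-iff (v⊑w y vy) (w⊑v y vy)) (untouched w y V′w (V∖v y vy y≢v) ¬tw)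
      H-symm : ∀ x y → H x y ≡ H y x
      H-symm x y = Bool-iff (H-sym x y) (H-sym y x)
      new : ∀ x y → Is (V x) → Is (V y) → ¬ E x y ≡ H⁺ x y → x ≢ v × y ≢ v × H⁺ x y ≡ H x y
      new x y vx vy ne with x ≟ v | y ≟ v
      ... | no x≢v   | no y≢v   = x≢v , y≢v , refl
      ... | yes refl | no y≢v   = ⊥-elim (ne (row y vy y≢v))
      ... | no x≢v   | yes refl = ⊥-elim (ne (trans (Bool-iff (E-sym x y) (E-sym y x)) (trans (row x vx x≢v) (H-symm w x))))
      ... | yes refl | yes refl = ⊥-elim (ne (trans (E-refl v) (symm (H-refl w))))

    -- Edits at `M` are undone and all others kept. With `v` in `M` this restores `v` at no extra
    -- cost, and only the trivial perfection of `H⁺` remains to be proved.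
    module Reset {M : ℕ → Set} (M? : Decidable M) (Mv : M v) where

      private
        pickRow : ∀ {x y} → Dec (M x) → Dec (M y) → Bool
        pickRow {x} {y} (no _) (no _) = H x y
        pickRow {x} {y} _      _      = E x y

      H⁺ : Rel₂
      H⁺ x y = pickRow {x} {y} (M? x) (M? y)

      H⁺-refl : ∀ x → Is (H⁺ x x)
      H⁺-refl x with M? x
      ... | yes _ = E-refl x
      ... | no _  = H-refl x

      H⁺-sym : ∀ x y → Is (H⁺ x y) → Is (H⁺ y x)
      H⁺-sym x y with M? x | M? y
      ... | yes _ | yes _ = E-sym x y
      ... | yes _ | no _  = E-sym x y
      ... | no _  | yes _ = E-sym x y
      ... | no _  | no _  = H-sym x y

      inˡ : ∀ x y → M x → H⁺ x y ≡ E x y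
      inˡ x y mx with M? x
      ... | yes _ = refl
      ... | no ¬m = ⊥-elim (¬m mx)

      inʳ : ∀ x y → M y → H⁺ x y ≡ E x y
      inʳ x y my with M? x | M? y
      ... | yes _ | _     = refl
      ... | no _  | yes _ = refl
      ... | no _  | no ¬m = ⊥-elim (¬m my)

      out : ∀ x y → ¬ M x → ¬ M y → H⁺ x y ≡ H x y
      out x y ¬mx ¬my with M? x | M? y
      ... | yes m | _     = ⊥-elim (¬mx m)
      ... | no _  | yes m = ⊥-elim (¬my m)
      ... | no _  | no _  = refl

      V′-out : ∀ x → Is (V x) → ¬ M x → Is (V′ x)
      V′-out x vx ¬mx = V∖v x vx λ { refl → ¬mx Mv }

      -- On an untouched vertex of M, H⁺ and H still agree.
      at-untouched : ∀ a → M a → a ≢ v → ¬ Touched a → Is (V a) → ∀ x y →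
        Is (V x) → Is (V y) → (M x → x ≡ a) → (M y → y ≡ a) → H⁺ x y ≡ H x y
      at-untouched a Ma a≢v ¬ta va x y vx vy fx fy with M? x | M? y
      ... | no ¬mx | no ¬my = refl
      ... | yes mx | my? rewrite fx mx = untouched a y (V∖v a va a≢v) (V′y my?) ¬ta
        where
        V′y : Dec (M y) → Is (V′ y)
        V′y (yes my) = subst (Is ∘ V′) (symm (fy my)) (V∖v a va a≢v)
        V′y (no ¬my) = V′-out y vy ¬my
      ... | no ¬mx | yes my rewrite fy my = Bool-iff (λ e → H-sym a x (E⇒H a x V′a V′x ¬ta (E-sym x a e)))
                                              (λ h → E-sym a x (H⇒E a x V′a V′x ¬ta (H-sym x a h)))
        where
        V′a = V∖v a va a≢v
        V′x = V′-out x vx ¬mx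

      reset : TPon (λ x → Is (V x)) H⁺ → Solution V
      reset tp = extend H⁺ H⁺-refl H⁺-sym tp new
        where
        new : ∀ x y → Is (V x) → Is (V y) → ¬ E x y ≡ H⁺ x y → x ≢ v × y ≢ v × H⁺ x y ≡ H x y
        new x y vx vy ne = (λ { refl → ¬mx Mv }) , (λ { refl → ¬my Mv }) , out x y ¬mx ¬my
          where
          ¬mx = λ mx → ne (symm (inˡ x y mx))
          ¬my = λ my → ne (symm (inʳ x y my))

    -- Safety of the module rule

    module ModuleRule (tirr : ∀ x → Is (V x) → ¬ ⟦ manyTwinsᶠ v0 ⟧ (x ∷ v ∷ []))
      (a b : ℕ) (Va : Is (V a)) (Vb : Is (V b)) (inM-v : ⟦ inModuleᶠ v1 v0 v2 ⟧ (b ∷ a ∷ v ∷ []))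
      (big : ⟦ many 27 3 (inModuleᶠ v2 v1 v0) ⟧ (b ∷ a ∷ v ∷ [])) where

      private
        inM Bad Off : ℕ → Set
        inM z = ⟦ inModuleᶠ v1 v2 v0 ⟧ (z ∷ a ∷ b ∷ [])
        Bad z = ⟦ badᶠ v1 v2 v0 ⟧ (z ∷ a ∷ b ∷ [])
        Off z = ¬ (Is (E a z) × Is (E b z))

        M : ℕ → Set
        M z = Is (V z) × inM z

        M? : Decidable M
        M? z = V? z ×-dec dec (inModuleᶠ v1 v2 v0) (z ∷ a ∷ b ∷ [])

        Mv : M v
        Mv = V∋v , inM-v

        common? : ∀ y → Dec (Is (E a y) × Is (E b y))
        common? y = is? (E a y) ×-dec is? (E b y)

        good : ∀ z → M z → ¬ Bad z
        good z (vz , oz , h) = h z vz z vz oz (E-refl z) oz (E-refl z)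

        complete : ∀ z y → M z → Is (V y) → Is (E a y) → Is (E b y) → Is (E z y)
        complete z y mz vy ay by = decidable-stable (is? (E z y)) λ ¬zy → good z mz (inj₁ (y , vy , ay , by , ¬zy))

        -- This is why the formula may stop at distance two. A bad vertex `x` reached from `y`
        -- through `w` cannot be within two steps of `z`; then `z y w x` has no chords and `z`
        -- itself is bad.
        isolated : ∀ z y → M z → Is (V y) → Off y → Is (E z y) → M y
        isolated z y (vz , oz , h) vy oy zy = vy , oy , λ w vw x vx ow yw ox wx bx →
          good z (vz , oz , h) (inj₂ (y , vy , w , vw , x , vx , ox , ow , oy , inj₁
            (zy , yw , wx , (λ zw → h w vw x vx ow zw ox wx bx) , (λ yx → h y vy x vx oy zy ox yx bx))))

        tp-M : TPon M E
        tp-M p u w q mp@(vp , op , _) (vu , ou , _) (vw , ow , _) (vq , oq , _) pu uw wq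
          with is? (E p w) | is? (E u q)
        ... | yes pw | _      = inj₁ pw
        ... | no _   | yes uq = inj₂ uq
        ... | no ¬pw | no ¬uq = ⊥-elim (good p mp (inj₂ (u , vu , w , vw , q , vq , oq , ow , ou , inj₁ (pu , uw , wq , ¬pw , ¬uq))))

        is-module : ∀ x x′ y → M x → M x′ → Is (V y) → ¬ M y → Is (E x y) → Is (E x′ y)
        is-module x x′ y mx mx′ vy ¬my xy with common? y
        ... | yes (ay , by) = complete x′ y mx′ vy ay by
        ... | no oy = ⊥-elim (¬my (isolated x y mx vy oy xy))

        θ : ℕ
        θ = suc k ^ 1 * 3

        module L = Leaves N E E-refl E-sym M? (λ x m → V< x (proj₁ m)) tp-M
        module O = Order N E E-refl E-sym M? (λ x m → V< x (proj₁ m)) tp-M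

        -- Vertices of a module have the same neighbours outside it, so twins inside `M` are twins
        -- in the whole graph, and these are few by `tirr`.
        twins⊆ : ∀ {w x} → M w → M x → w O.⊑ x → ∀ z → Is (V z) → Is (E w z) → Is (E x z)
        twins⊆ {w} {x} mw mx s z vz wz = go (M? z)
          where
          go : Dec (M z) → Is (E x z)
          go (yes mz) = s z mz wz
          go (no ¬mz) = is-module w x z mw mx vz ¬mz wz

        small : ∀ w → M w → card N (λ x → M? x ×-dec (w O.⊑? x) ×-dec (x O.⊑? w)) ≤ θ
        small w mw = ≤-trans
          (card-mono N (λ x → M? x ×-dec (w O.⊑? x) ×-dec (x O.⊑? w)) (λ x → V? x ×-dec dec (twinᶠ v1 v0) (x ∷ w ∷ v ∷ []))
             λ { x _ (mx , s , t) → proj₁ mx , twins⊆ mw mx s , twins⊆ mx mw t })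
          (≮⇒≥ (tirr w (proj₁ mw)))

        I : ℕ
        I = card N L.leastLeaf?

        -- With at most θ independent leaves the module would have at most θ³ vertices, and θ³ is
        -- the threshold `suc k ^ 3 * 27` of the rule.
        θ<I : θ < I
        θ<I = ≰⇒> λ I≤θ → <⇒≱ big (begin
          card N (λ z → V? z ×-dec dec (inModuleᶠ v2 v1 v0) (z ∷ b ∷ a ∷ v ∷ [])) ≤⟨ card-mono N (λ z → V? z ×-dec dec (inModuleᶠ v2 v1 v0) (z ∷ b ∷ a ∷ v ∷ [])) M? (λ _ _ m → m) ⟩
          card N M?         ≤⟨ L.card-via-leaves θ small ⟩
          I * (I * θ)       ≤⟨ *-mono-≤ I≤θ (*-monoˡ-≤ θ I≤θ) ⟩
          θ * (θ * θ)       ≡⟨ cube (suc k) ⟩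
          suc k ^ 3 * 27    ∎)
          where
          open ≤-Reasoning
          cube : ∀ q → q * 1 * 3 * (q * 1 * 3 * (q * 1 * 3)) ≡ q * (q * (q * 1)) * 27
          cube = solve-∀

      safe : Solution V
      safe = conclude (pick-untouched v L.leastLeaf? θ<I)
        where
        open Reset M? Mv
        finish : ∀ c d → L.LeastLeaf c → L.LeastLeaf d → ¬ Touched c → ¬ Touched d → c ≢ v → d ≢ v → d ≢ c → Solution V
        -- In `H⁺` the module `M` replaces `c`: on `c` and the vertices outside `M` the relation is
        -- still `H`, because `c` is untouched.
        finish c d Lc Ld ¬tc ¬td c≢v d≢v d≢c = reset (Substitution.substitution H⁺ H⁺-sym H⁺-refl M?
            (λ x x′ y mx mx′ vy ¬my xy → trans (inˡ x′ y mx′) (is-module x x′ y mx mx′ vy ¬my (trans (symm (inˡ x y mx)) xy)))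
            clique
            (TPon-⊆ (λ _ → proj₂) (TPon-≗ (λ x y mx my → symm (inˡ x y mx)) tp-M))
            c (proj₁ mc) mc
            (TPon-≗ (λ { x y (vx , fx) (vy , fy) → symm (at-untouched c mc c≢v ¬tc (proj₁ mc) x y vx vy fx fy) })
              (TPon-⊆ V′-set H-tp)))
          where
          mc = proj₁ (proj₁ Lc)
          md = proj₁ (proj₁ Ld)
          V′c = V∖v c (proj₁ mc) c≢v
          V′d = V∖v d (proj₁ md) d≢v
          V′-set : ∀ x → Is (V x) × (M x → x ≡ c) → Is (V′ x)
          V′-set x (vx , fx) = V∖v x vx λ { refl → c≢v (symm (fx Mv)) }
          clique : ∀ x p q → M x → Is (V p) → Is (V q) → ¬ M p → ¬ M q → Is (H⁺ x p) → Is (H⁺ x q) → Is (H⁺ p q)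
          -- `c p d q` is a path in `H` whose chord `c d` is missing, as `c` and `d` are distinct
          -- least leaves and `c` is untouched; hence `p q` is an edge.
          clique x p q mx vp vq ¬mp ¬mq xp xq = trans (out p q ¬mp ¬mq)
            ([ (λ cd → ⊥-elim (d≢c (symm (L.leastLeaf-independent Lc Ld (H⇒E c d V′c V′d ¬tc cd))))) , id ]′
              (H-tp c p d q V′c (V′-out p vp ¬mp) V′d (V′-out q vq ¬mq)
                (edge c p mc V′c ¬tc vp ¬mp xp) (H-sym _ _ (edge d p md V′d ¬td vp ¬mp xp)) (edge d q md V′d ¬td vq ¬mq xq)))
            where
            edge : ∀ e r → M e → Is (V′ e) → ¬ Touched e → Is (V r) → ¬ M r → Is (H⁺ x r) → Is (H e r)
            edge e r me V′e ¬te vr ¬mr xr =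
              E⇒H e r V′e (V′-out r vr ¬mr) ¬te (is-module x e r mx me vr ¬mr (trans (symm (inˡ x r mx)) xr))
        conclude : (∃ λ c → L.LeastLeaf c × ¬ Touched c × c ≢ v × c ≢ v) → Solution V
        conclude (c , Lc , ¬tc , c≢v , _) =
          let (d , Ld , ¬td , d≢v , d≢c) = pick-untouched c L.leastLeaf? θ<I
          in finish c d Lc Ld ¬tc ¬td c≢v d≢v d≢c

    -- Safety of the comb rule

    module CombRule (y z w : ℕ) (Vy : Is (V y)) (Vz : Is (V z)) (Vw : Is (V w))
      (is-comb : ⟦ combᶠ v0 v1 ⟧ (y ∷ z ∷ []))
      (v⊑y : ⟦ subᶠ v0 v1 ⟧ (v ∷ y ∷ [])) (z⊑w : ⟦ subᶠ v0 v1 ⟧ (z ∷ w ∷ [])) (w⊑v : ⟦ subᶠ v0 v1 ⟧ (w ∷ v ∷ []))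
      where

      Tooth Shaft Body : ℕ → Set
      Tooth x = Is (E y x) × ¬ Is (E z x)
      Shaft x = ⟦ shaftᶠ v1 v2 v0 ⟧ (x ∷ y ∷ z ∷ [])
      Body x = Tooth x ⊎ Shaft x

      tooth? : Decidable Tooth
      tooth? x = is? (E y x) ×-dec ¬? (is? (E z x))

      shaft? : Decidable Shaft
      shaft? x = dec (shaftᶠ v1 v2 v0) (x ∷ y ∷ z ∷ [])

      tp-body : TPon (λ x → Is (V x) × Body x) E
      tp-body p u w q (vp , bp) (vu , bu) (vw , bw) (vq , bq) = proj₂ (proj₂ is-comb) p vp u vu w vw q vq bp bu bw bq

      outer : ∀ τ p → Is (V τ) → Is (V p) → Tooth τ → ¬ Body p → Is (E τ p) →
        Is (E z p) × (∀ τ′ → Is (V τ′) → Tooth τ′ → Is (E τ′ p))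
      outer τ p vτ vp = proj₁ (proj₂ is-comb) τ vτ p vp

      shaft-z : Shaft z
      shaft-z = (λ _ _ e → e) , proj₁ is-comb

      shaft~z : ∀ x → Shaft x → Is (E z x)
      shaft~z x (z⊑x , _) = E-sym _ _ (z⊑x z Vz (E-refl z))

      shaft-clique : ∀ p q → Is (V q) → Shaft p → Shaft q → Is (E p q)
      shaft-clique p q vq (z⊑p , _) sq = z⊑p q vq (shaft~z q sq)

      -- s, u, t are untouched: s hangs above v, t below w, and u is a shaft
      -- vertex in between.
      module Choice (s u t : ℕ) (Vs : Is (V s)) (Vu : Is (V u)) (Vt : Is (V t))
        (s-tooth : Tooth s) (t-tooth : Tooth t) (v≁s : ¬ Is (E v s)) (w~t : Is (E w t))
        (w⊑u : ⟦ subᶠ v0 v1 ⟧ (w ∷ u ∷ [])) (u⊑v : ⟦ subᶠ v0 v1 ⟧ (u ∷ v ∷ []))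
        (s≢v : s ≢ v) (u≢v : u ≢ v) (t≢v : t ≢ v) (¬ts : ¬ Touched s) (¬tu : ¬ Touched u) (¬tt : ¬ Touched t) where

        u~t : Is (E u t)
        u~t = w⊑u t Vt w~t

        u≁s : ¬ Is (E u s)
        u≁s us = v≁s (u⊑v s Vs us)

        -- `M` is the stretch of the comb to be reset: the shaft vertices that see `t` but not `s`,
        -- with the teeth hanging off them. `D` lies below this stretch, `U` above it and adjacent
        -- to all of it, and `R` beside it, with no edge to it. The vertices `u`, `v`, `t` belong to
        -- `M`, `z` to `D` and `s` to `R`.
        MS MT M D₁ D₂ D U R : ℕ → Set
        MS x = Shaft x × ¬ Is (E x s) × Is (E x t)
        MT x = Tooth x × (∃ λ r → Is (V r) × Shaft r × Is (E r x) × ¬ Is (E r s))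
                       × (∀ r → Is (V r) → Shaft r → Is (E r x) → Is (E r t))
        M x = Is (V x) × (MS x ⊎ MT x)
        D₁ x = ¬ Tooth x × Is (E z x) × ¬ Is (E x t) × ¬ Is (E x s)
        D₂ x = Tooth x × (∃ λ r → Is (V r) × Shaft r × Is (E r x) × ¬ Is (E r t))
        D x = Is (V x) × (D₁ x ⊎ D₂ x)
        U x = Is (V x) × ¬ Tooth x × Is (E x s)
        R x = (Tooth x × (∀ r → Is (V r) → Shaft r → Is (E r x) → Is (E r s))) ⊎ (¬ Tooth x × ¬ Is (E z x))

        M? : Decidable M
        M? x = V? x ×-dec ((shaft? x ×-dec ¬? (is? _) ×-dec is? _)
          ⊎-dec (tooth? x ×-dec ∃V? (λ r → shaft? r ×-dec is? (E r x) ×-dec ¬? (is? (E r s)))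
                          ×-dec ∀V? (λ r → shaft? r →-dec is? (E r x) →-dec is? (E r t))))

        D? : Decidable D
        D? x = V? x ×-dec ((¬? (tooth? x) ×-dec is? _ ×-dec ¬? (is? _) ×-dec ¬? (is? _))
          ⊎-dec (tooth? x ×-dec ∃V? (λ r → shaft? r ×-dec is? (E r x) ×-dec ¬? (is? (E r t)))))

        Mu : M u
        Mu = Vu , inj₁ (((λ x vx zx → w⊑u x vx (z⊑w x vx zx)) , (λ x vx ux → v⊑y x vx (u⊑v x vx ux))) , u≁s , u~t)

        shaft-u : Shaft u
        shaft-u = (λ x vx zx → w⊑u x vx (z⊑w x vx zx)) , (λ x vx ux → v⊑y x vx (u⊑v x vx ux))

        Mv : M v
        Mv = V∋v , inj₁ (((λ x vx zx → w⊑v x vx (z⊑w x vx zx)) , v⊑y) , v≁s , w⊑v t Vt w~t)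

        M⇒body : ∀ x → M x → Is (V x) × Body x
        M⇒body x (vx , inj₁ (sx , _)) = vx , inj₂ sx
        M⇒body x (vx , inj₂ (tx , _)) = vx , inj₁ tx

        Dz : D z
        Dz = Vz , inj₁ ((λ t → proj₂ t (E-refl z)) , E-refl z , proj₂ t-tooth , proj₂ s-tooth)

        D∌M : ∀ x → D x → ¬ M x
        D∌M x (_ , inj₁ (¬tx , _ , ¬xt , _)) (_ , inj₁ (_ , _ , xt)) = ¬xt xt
        D∌M x (_ , inj₁ (¬tx , _)) (_ , inj₂ (tx , _)) = ¬tx tx
        D∌M x (_ , inj₂ (tx , _)) (_ , inj₁ (sx , _)) = proj₂ tx (shaft~z x sx)
        D∌M x (_ , inj₂ (_ , r , vr , sr , rx , ¬rt)) (_ , inj₂ (_ , _ , h)) = ¬rt (h r vr sr rx)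

        classify : ∀ x → Is (V x) → ¬ M x → ¬ D x → U x ⊎ R x
        classify x vx ¬m ¬d = go (tooth? x) (is? (E x s)) (is? (E z x)) (is? (E x t)) (shaft? x)
          where
          go : Dec (Tooth x) → Dec (Is (E x s)) → Dec (Is (E z x)) → Dec (Is (E x t)) → Dec (Shaft x) → U x ⊎ R x
          go (yes tx) _ _ _ _ = inj₂ (inj₁ (tx , λ r vr sr rx → decidable-stable (is? (E r s)) λ ¬rs →
            ¬m (vx , inj₂ (tx , (r , vr , sr , rx , ¬rs) , λ r′ vr′ sr′ r′x → decidable-stable (is? (E r′ t)) λ ¬r′t →
              ¬d (vx , inj₂ (tx , r′ , vr′ , sr′ , r′x , ¬r′t))))))
          go (no ¬tx) (yes xs) _ _ _ = inj₁ (vx , ¬tx , xs)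
          go (no ¬tx) (no ¬xs) (no ¬zx) _ _ = inj₂ (inj₂ (¬tx , ¬zx))
          go (no ¬tx) (no ¬xs) (yes zx) (no ¬xt) _ = ⊥-elim (¬d (vx , inj₁ (¬tx , zx , ¬xt , ¬xs)))
          go (no ¬tx) (no ¬xs) (yes zx) (yes xt) (yes sx) = ⊥-elim (¬m (vx , inj₁ (sx , ¬xs , xt)))
          -- A vertex outside the body that sees the tooth `t` sees every tooth by `outer`, and so
          -- `s`.
          go (no ¬tx) (no ¬xs) (yes zx) (yes xt) (no ¬sx) = ⊥-elim (¬xs (E-sym _ _
            (proj₂ (outer t x Vt vx t-tooth [ ¬tx , ¬sx ]′ (E-sym _ _ xt)) s Vs s-tooth)))

        M~U : ∀ m x → M m → U x → Is (E m x)
        M~U m x Mm@(vm , Mm′) (vx , ¬tx , xs) = go (shaft? x) Mm′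
          where
          go : Dec (Shaft x) → MS m ⊎ MT m → Is (E m x)
          go (yes sx) (inj₁ (sm , _)) = shaft-clique m x vx sm sx
          go (yes sx) (inj₂ (tm , (r , vr , sr , rm , ¬rs) , _)) =
            [ (λ sr → ⊥-elim (¬rs (E-sym _ _ sr))) , E-sym _ _ ]′
              (tp-body s x r m (Vs , inj₁ s-tooth) (vx , inj₂ sx) (vr , inj₂ sr) (vm , inj₁ tm)
                (E-sym _ _ xs) (shaft-clique x r vr sx sr) rm)
          go (no ¬sx) m∈ with outer s x Vs vx s-tooth [ ¬tx , ¬sx ]′ (E-sym _ _ xs) | m∈
          ... | zx , _ | inj₁ ((z⊑m , _) , _) = z⊑m x vx zx
          ... | _ , τx | inj₂ (tm , _)        = τx m vm tm

        M≁R : ∀ m r → Is (V r) → M m → R r → ¬ Is (E m r)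
        M≁R m r vr (vm , inj₁ ((_ , m⊑y) , _)) (inj₂ (¬tr , ¬zr)) mr = ¬tr (m⊑y r vr mr , ¬zr)
        M≁R m r vr (vm , inj₂ (tm , _)) (inj₂ (¬tr , ¬zr)) mr =
          ¬zr (proj₁ (outer m r vm vr tm [ ¬tr , (λ sr → ¬zr (shaft~z r sr)) ]′ mr))
        M≁R m r vr (vm , inj₁ (sm , ¬ms , _)) (inj₁ (tr , h)) mr = ¬ms (h m vm sm mr)
        M≁R m r vr (vm , inj₂ (tm , (x , vx , sx , xm , ¬xs) , _)) (inj₁ (tr , h)) mr =
          [ (λ rx → ¬xs (h x vx sx (E-sym _ _ rx))) , (λ mz → proj₂ tm (E-sym _ _ mz)) ]′
            (tp-body r m x z (vr , inj₁ tr) (vm , inj₁ tm) (vx , inj₂ sx) (Vz , inj₂ shaft-z)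
              (E-sym _ _ mr) (E-sym _ _ xm) (E-sym _ _ (shaft~z x sx)))

        D~MS : ∀ d m → D d → Is (V m) → MS m → Is (E d m)
        D~MS d m (vd , inj₁ (_ , zd , _)) vm ((z⊑m , _) , _) = E-sym _ _ (z⊑m d vd zd)
        D~MS d m (vd , inj₂ (td , r , vr , sr , rd , ¬rt)) vm (sm , _ , mt) =
          [ (λ tr → ⊥-elim (¬rt (E-sym _ _ tr))) , E-sym _ _ ]′
            (tp-body t m r d (Vt , inj₁ t-tooth) (vm , inj₂ sm) (vr , inj₂ sr) (vd , inj₁ td)
              (E-sym _ _ mt) (shaft-clique m r vr sm sr) rd)

        D≁MT : ∀ d m → D d → Is (V m) → MT m → ¬ Is (E d m)
        D≁MT d m (vd , inj₁ (¬td , zd , ¬dt , ¬ds)) vm (tm , _ , h) dm = go (shaft? d)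
          where
          go : Dec (Shaft d) → ⊥
          go (yes sd) = ¬dt (h d vd sd dm)
          go (no ¬sd) = ¬ds (E-sym _ _ (proj₂ (outer m d vm vd tm [ ¬td , ¬sd ]′ (E-sym _ _ dm)) s Vs s-tooth))
        D≁MT d m (vd , inj₂ (td , r , vr , sr , rd , ¬rt)) vm (tm , _ , h) dm =
          [ (λ mr → ¬rt (h r vr sr (E-sym _ _ mr))) , (λ dz → proj₂ td (E-sym _ _ dz)) ]′
            (tp-body m d r z (vm , inj₁ tm) (vd , inj₁ td) (vr , inj₂ sr) (Vz , inj₂ shaft-z)
              (E-sym _ _ dm) (E-sym _ _ rd) (E-sym _ _ (shaft~z r sr)))

        open Reset M? Mv

        V′s : Is (V′ s)
        V′s = V∖v s Vs s≢v
        V′u : Is (V′ u)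
        V′u = V∖v u Vu u≢v
        V′t : Is (V′ t)
        V′t = V∖v t Vt t≢v

        -- `s x u p` is a path in `H`, since edges at `s` and `u` are those of `E`; its chord `s u`
        -- is missing, which leaves `x p`.
        U⊒u : ∀ x p → U x → ¬ M x → Is (V′ p) → Is (H u p) → Is (H x p)
        U⊒u x p Ux@(vx , _ , xs) ¬mx v′p up =
          [ (λ su → ⊥-elim (u≁s (H⇒E u s V′u V′s ¬tu (H-sym _ _ su)))) , id ]′
            (H-tp s x u p V′s V′x V′u v′p (E⇒H s x V′s V′x ¬ts (E-sym _ _ xs))
              (H-sym _ _ (E⇒H u x V′u V′x ¬tu (M~U u x Mu Ux))) up)
          where V′x = V′-out x vx ¬mx

        u~D : ∀ d → D d → Is (H u d)
        u~D d Dd = E⇒H u d V′u (V′-out d (proj₁ Dd) (D∌M d Dd)) ¬tu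
          (E-sym _ _ (D~MS d u Dd Vu (shaft-u , u≁s , u~t)))

        U~D : ∀ x d → U x → ¬ M x → D d → Is (H x d)
        U~D x d Ux ¬mx Dd = U⊒u x d Ux ¬mx (V′-out d (proj₁ Dd) (D∌M d Dd)) (u~D d Dd)

        U-clique : ∀ x x′ → U x → U x′ → ¬ M x → ¬ M x′ → Is (H x x′)
        U-clique x x′ Ux Ux′ ¬mx ¬mx′ = U⊒u x x′ Ux ¬mx V′x′ (E⇒H u x′ V′u V′x′ ¬tu (M~U u x′ Mu Ux′))
          where V′x′ = V′-out x′ (proj₁ Ux′) ¬mx′

        -- An edge `d r` would give the path `r d u t` of `H`. Its chords `r u` and `d t` are
        -- missing, because `u` and `t` are untouched.
        D≁R : ∀ d r → D d → Is (V r) → ¬ M r → R r → ¬ Is (H d r)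
        D≁R d r Dd vr ¬mr Rr dr =
          [ (λ ru → M≁R u r vr Mu Rr (H⇒E u r V′u V′r ¬tu (H-sym _ _ ru)))
          , (λ dt → D≁MT d t Dd Vt (t-tooth , (u , Vu , shaft-u , u~t , u≁s) , (λ _ _ _ e → e))
                      (E-sym _ _ (H⇒E t d V′t V′d ¬tt (H-sym _ _ dt)))) ]′
            (H-tp r d u t V′r V′d V′u V′t (H-sym _ _ dr) (H-sym _ _ (u~D d Dd)) (E⇒H u t V′u V′t ¬tu u~t))
          where
          V′r = V′-out r vr ¬mr
          V′d = V′-out d (proj₁ Dd) (D∌M d Dd)

        W : ℕ → Set
        W x = M x ⊎ D x

        W~U : ∀ x p → W x → U p → ¬ M p → Is (H⁺ x p)
        W~U x p (inj₁ mx) Up ¬mp = trans (inˡ x p mx) (M~U x p mx Up)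
        W~U x p (inj₂ dx) Up ¬mp = trans (out x p (D∌M x dx) ¬mp) (H-sym _ _ (U~D p x Up ¬mp dx))

        W≁R : ∀ x r → W x → Is (V r) → R r → ¬ M r → ¬ Is (H⁺ x r)
        W≁R x r (inj₁ mx) vr Rr ¬mr xr = M≁R x r vr mx Rr (trans (symm (inˡ x r mx)) xr)
        W≁R x r (inj₂ dx) vr Rr ¬mr xr = D≁R x r dx vr ¬mr Rr (trans (symm (out x r (D∌M x dx) ¬mr)) xr)

        nbr⇒U : ∀ x p → W x → Is (V p) → ¬ W p → Is (H⁺ x p) → U p
        nbr⇒U x p Wx vp ¬Wp xp =
          [ id , (λ Rp → ⊥-elim (W≁R x p Wx vp Rp (¬Wp ∘ inj₁) xp)) ]′ (classify p vp (¬Wp ∘ inj₁) (¬Wp ∘ inj₂))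

        -- Within `W` the set `D` is a module whose outside neighbours, all in `MS`, form a clique.
        -- Inside `D` the relation is `H`; contracting `D` to `z` leaves a part of the body, with
        -- the relation `E`.
        tp-W : TPon W H⁺
        tp-W = Substitution.substitution H⁺ H⁺-sym H⁺-refl D? modular clique
          (TPon-≗ (λ { x x′ (_ , dx) (_ , dx′) → symm (out x x′ (D∌M x dx) (D∌M x′ dx′)) })
            (TPon-⊆ (λ { x (_ , dx) → V′-out x (proj₁ dx) (D∌M x dx) }) H-tp))
          z (inj₂ Dz) Dz
          (TPon-≗ (λ { x x′ (wx , fx) (wx′ , fx′) → symm (asE x x′ wx wx′ fx fx′) })
            (TPon-⊆ (λ { x (wx , fx) → body x wx fx }) tp-body))
          where
          M-of : ∀ {x} → W x → ¬ D x → M x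
          M-of (inj₁ m) _ = m
          M-of (inj₂ d) ¬d = ⊥-elim (¬d d)
          modular : ∀ x x′ p → D x → D x′ → W p → ¬ D p → Is (H⁺ x p) → Is (H⁺ x′ p)
          modular x x′ p dx dx′ wp ¬dp xp with M-of wp ¬dp
          ... | mp@(vp , inj₁ ms) = trans (inʳ x′ p mp) (D~MS x′ p dx′ vp ms)
          ... | mp@(vp , inj₂ mt) = ⊥-elim (D≁MT x p dx vp mt (trans (symm (inʳ x p mp)) xp))
          clique : ∀ x p q → D x → W p → W q → ¬ D p → ¬ D q → Is (H⁺ x p) → Is (H⁺ x q) → Is (H⁺ p q)
          clique x p q dx wp wq ¬dp ¬dq xp xq with M-of wp ¬dp | M-of wq ¬dq
          ... | mp@(vp , inj₂ mt) | _ = ⊥-elim (D≁MT x p dx vp mt (trans (symm (inʳ x p mp)) xp))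
          ... | _ | mq@(vq , inj₂ mt) = ⊥-elim (D≁MT x q dx vq mt (trans (symm (inʳ x q mq)) xq))
          ... | mp@(_ , inj₁ (sp , _)) | (vq , inj₁ (sq , _)) = trans (inˡ p q mp) (shaft-clique p q vq sp sq)
          asE : ∀ x x′ → W x → W x′ → (D x → x ≡ z) → (D x′ → x′ ≡ z) → H⁺ x x′ ≡ E x x′
          asE x x′ (inj₁ mx) _ _ _ = inˡ x x′ mx
          asE x x′ (inj₂ _) (inj₁ mx′) _ _ = inʳ x x′ mx′
          asE x x′ (inj₂ dx) (inj₂ dx′) fx fx′ with fx dx | fx′ dx′
          ... | refl | refl = trans (H⁺-refl z) (symm (E-refl z))
          body : ∀ x → W x → (D x → x ≡ z) → Is (V x) × Body x
          body x (inj₁ mx) _ = M⇒body x mx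
          body x (inj₂ dx) fx with fx dx
          ... | refl = Vz , inj₂ shaft-z

        -- A second substitution, around the one in `tp-W`: `W` is a module whose outside neighbours
        -- lie in the clique `U`, and contracting it to the untouched `u` leaves a part of `H`.
        safe : Solution V
        safe = reset (Substitution.substitution H⁺ H⁺-sym H⁺-refl (λ x → M? x ⊎-dec D? x)
          (λ x x′ p Wx Wx′ vp ¬Wp xp → W~U x′ p Wx′ (nbr⇒U x p Wx vp ¬Wp xp) (¬Wp ∘ inj₁))
          (λ x p q Wx vp vq ¬Wp ¬Wq xp xq → trans (out p q (¬Wp ∘ inj₁) (¬Wq ∘ inj₁))
             (U-clique p q (nbr⇒U x p Wx vp ¬Wp xp) (nbr⇒U x q Wx vq ¬Wq xq) (¬Wp ∘ inj₁) (¬Wq ∘ inj₁)))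
          (TPon-⊆ (λ _ → proj₂) tp-W)
          u Vu (inj₁ Mu)
          (TPon-≗ (λ { x x′ (vx , fx) (vx′ , fx′) → symm (at-untouched u Mu u≢v ¬tu Vu x x′ vx vx′ (fx ∘ inj₁) (fx′ ∘ inj₁)) })
            (TPon-⊆ (λ { x (vx , fx) → V∖v x vx λ { refl → u≢v (symm (fx (inj₁ Mv))) } }) H-tp)))

    comb-safe : ⟦ combRuleᶠ v0 ⟧ (v ∷ []) → Solution V
    comb-safe (y , Vy , z , Vz , w , Vw , is-comb , v⊑y , z⊑w , w⊑v , many-s , many-u , many-t) =
      let (s , (Vs , tooth-s , v≁s) , ¬ts , s≢v , _) = pick-untouched v s? many-s
          (u , (Vu , w⊑u , u⊑v) , ¬tu , u≢v , _) = pick-untouched v u? many-u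
          (t , (Vt , tooth-t , w~t) , ¬tt , t≢v , _) = pick-untouched v t? many-t
      in CombRule.Choice.safe y z w Vy Vz Vw is-comb v⊑y z⊑w w⊑v s u t Vs Vu Vt tooth-s tooth-t v≁s w~t w⊑u u⊑v s≢v u≢v t≢v ¬ts ¬tu ¬tt
      where
      s? = λ x → V? x ×-dec dec (toothᶠ v3 v2 v0 ∧ᶠ ¬ᶠ adjᶠ (suc v3) v0) (x ∷ w ∷ z ∷ y ∷ v ∷ [])
      u? = λ x → V? x ×-dec dec (subᶠ v1 v0 ∧ᶠ subᶠ v0 (suc v3)) (x ∷ w ∷ z ∷ y ∷ v ∷ [])
      t? = λ x → V? x ×-dec dec (toothᶠ v3 v2 v0 ∧ᶠ adjᶠ v1 v0) (x ∷ w ∷ z ∷ y ∷ v ∷ [])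

    reducible-safe : ⟦ reducibleᶠ v0 ⟧ (v ∷ []) → Solution V
    reducible-safe (inj₁ twins) = twin-safe twins
    reducible-safe (inj₂ (inj₁ (tirr , a , Va , b , Vb , inM , big))) = ModuleRule.safe tirr a b Va Vb inM big
    reducible-safe (inj₂ (inj₂ comb)) = comb-safe comb

-- Size of irreducible instances

module Bound (N k : ℕ) (E : Rel₂) (E-refl : ∀ x → Is (E x x)) (E-sym : ∀ x y → Is (E x y) → Is (E y x))
  (V : ℕ → Bool) (V< : ∀ x → Is (V x) → x < N) where

  open Editing N k E E-refl E-sym
  open Semantics N k V V< E

  module _ (S : Solution V) (irreducible : ∀ v → Is (V v) → ¬ ⟦ reducibleᶠ v0 ⟧ (v ∷ [])) where

    open Solution S
    open Touching V V< S
    open Order N H H-refl H-sym V? V< H-tp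

    θ m : ℕ
    θ = suc k ^ 1 * 3
    m = suc k ^ 3 * 27

    Twin? : ∀ w x → Dec (Is (V x) × ⟦ twinᶠ v1 v0 ⟧ (x ∷ w ∷ []))
    Twin? w x = V? x ×-dec dec (twinᶠ v1 v0) (x ∷ w ∷ [])

    few-twins : ∀ w → Is (V w) → card N (Twin? w) ≤ θ
    few-twins w vw = ≮⇒≥ (irreducible w vw ∘ inj₁)

    ⊑⇒sub : ∀ {x y} → Is (V x) → Is (V y) → ¬ Touched x → ¬ Touched y → x ⊑ y → ⟦ subᶠ v0 v1 ⟧ (x ∷ y ∷ [])
    ⊑⇒sub {x} {y} vx vy ¬tx ¬ty s z vz xz = H⇒E y z vy vz ¬ty (s z vz (E⇒H x z vx vz ¬tx xz))

    -- Untouched vertices have the same rows in `E` and `H`, so twins in `H` among them are twins in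
    -- `E`, and the twin rule bounds their number.
    card-twins : ∀ {Q : ℕ → Set} (Q? : Decidable Q) → (∀ x → Q x → Is (V x) × ¬ Touched x) →
      (∀ x y → Q x → Q y → x ⊑ y) → card N Q? ≤ θ
    card-twins Q? Q⊆ twins = go (any<? N Q?)
      where
      go : Dec (∃ λ x → x < N × _) → card N Q? ≤ θ
      go (no ∄) = ≤-trans (≤-reflexive (card-none N Q? λ x x<N q → ∄ (x , x<N , q))) z≤n
      go (yes (w , _ , qw)) = ≤-trans (card-mono N Q? (Twin? w) λ x _ qx →
          proj₁ (Q⊆ x qx) , ⊑⇒sub (proj₁ (Q⊆ w qw)) (proj₁ (Q⊆ x qx)) (proj₂ (Q⊆ w qw)) (proj₂ (Q⊆ x qx)) (twins w x qw qx)
                          , ⊑⇒sub (proj₁ (Q⊆ x qx)) (proj₁ (Q⊆ w qw)) (proj₂ (Q⊆ x qx)) (proj₂ (Q⊆ w qw)) (twins x w qx qw))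
        (few-twins w (proj₁ (Q⊆ w qw)))

    Desc : ℕ → ℕ → Set
    Desc v x = Touched x × x ⊑ v

    desc? : ∀ v → Decidable (Desc v)
    desc? v x = touched? x ×-dec (x ⊑? v)

    -- Busy vertices lie above touched ones, touched vertices being above themselves; the subtree of
    -- `H` below a free vertex contains no touched vertex.
    Busy Free : ℕ → Set
    Busy v = ∃ λ x → x < N × Desc v x
    Free v = Is (V v) × ¬ Busy v

    busy? : Decidable Busy
    busy? v = any<? N (desc? v)

    free? : Decidable Free
    free? v = V? v ×-dec ¬? (busy? v)

    ⊑⇒~ : ∀ {x y} → Is (V x) → x ⊑ y → Is (H y x)
    ⊑⇒~ {x} vx s = s x vx (H-refl x)

    free-untouched : ∀ {v} → Free v → ¬ Touched v
    free-untouched {v} (vv , ¬b) t = ¬b (v , V< v vv , t , λ _ _ e → e)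

    free⊑busy : ∀ {w q} → Free w → Is (V q) → Busy q → Is (H w q) → w ⊑ q
    free⊑busy (vw , ¬bw) vq (x , x<N , t , x⊑q) wq =
      [ id , (λ q⊑w → ⊥-elim (¬bw (x , x<N , t , ⊑-trans x⊑q q⊑w))) ]′ (comparable vw vq wq)

    -- The free vertices with a prescribed set σ of busy neighbours form a
    -- trivially perfect module.
    module FreeModule {σ : ℕ → Set} (σ? : Decidable σ) where

      F : ℕ → Set
      F w = Free w × (∀ q → Is (V q) → Busy q → (Is (H w q) → σ q) × (σ q → Is (H w q)))

      F? : Decidable F
      F? w = free? w ×-dec ∀P? (λ q → busy? q →-dec ((is? (H w q) →-dec σ? q) ×-dec (σ? q →-dec is? (H w q))))

      F⇒V : ∀ x → F x → Is (V x)
      F⇒V x Fx = proj₁ (proj₁ Fx)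

      untouchedF : ∀ {x} → F x → ¬ Touched x
      untouchedF Fx = free-untouched (proj₁ Fx)

      -- A busy neighbour of a free vertex lies above it and inherits all its neighbours. Adjacent
      -- free vertices therefore have the same busy neighbours.
      F-closed : ∀ w y → F w → Free y → Is (H w y) → F y
      F-closed w y (fw , h) fy wy = fy , λ q vq bq → up q vq bq , down q vq bq
        where
        vw = proj₁ fw
        vy = proj₁ fy
        y⊒ : ∀ q → Is (V q) → Busy q → Is (H y q) → Is (H w q)
        y⊒ q vq bq yq = H-sym _ _ (free⊑busy fy vq bq yq w vw (H-sym _ _ wy))
        up : ∀ q → Is (V q) → Busy q → Is (H y q) → σ q
        up q vq bq yq = proj₁ (h q vq bq) (y⊒ q vq bq yq)
        down : ∀ q → Is (V q) → Busy q → σ q → Is (H y q)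
        down q vq bq sq = H-sym _ _ (free⊑busy fw vq bq wq y vy wy)
          where wq = proj₂ (h q vq bq) sq

      F-row : ∀ {w w′ y} → F w → F w′ → Is (V y) → (F y → Is (H w y) → Is (H w′ y)) → Is (H w y) → Is (H w′ y)
      F-row {w} {w′} {y} Fw Fw′ vy inside wy = go (busy? y)
        where
        go : Dec (Busy y) → Is (H w′ y)
        go (yes by) = proj₂ (proj₂ Fw′ y vy by) (proj₁ (proj₂ Fw y vy by) wy)
        go (no ¬by) = inside (F-closed w y Fw (vy , ¬by) wy) wy

      common? : ∀ a b → Decidable (λ z → Is (V z) × Is (H a z) × Is (H b z))
      common? a b z = V? z ×-dec is? (H a z) ×-dec is? (H b z)

      common : ℕ → ℕ → ℕ
      common a b = card N (common? a b)

      Independent : ℕ → ℕ → Set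
      Independent a b = F a × F b × ¬ Is (H a b)

      clique-small : ¬ (∃ λ a → a < N × (∃ λ b → b < N × Independent a b)) → card N F? ≤ θ
      clique-small ∄ = card-twins F? (λ x Fx → F⇒V x Fx , untouchedF Fx)
        λ x y Fx Fy z vz xz → F-row Fx Fy vz (λ Fz _ → decidable-stable (is? (H y z)) λ ¬yz →
          ∄ (y , V< y (F⇒V y Fy) , z , V< z vz , Fy , Fz , ¬yz)) xz

      -- The rule can name the part of `F` off N[a] ∩ N[b] by `a` and `b`, provided that this part
      -- is adjacent to all of N[a] ∩ N[b]. A nonadjacent pair with the fewest common neighbours
      -- guarantees it.
      module Minimal (a b : ℕ) (Fa : F a) (Fb : F b) (¬ab : ¬ Is (H a b))
        (least : ∀ c d → Independent c d → common a b ≤ common c d) where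

        Va = F⇒V a Fa
        Vb = F⇒V b Fb

        -- Suppose `z` misses the common neighbour `y` of `c` and `d`. For a common neighbour `q` of
        -- `z` and `c`, the path `z q c y` forces the chord `q y`, and then `z q y d` forces `q d`.
        -- So N[z] ∩ N[c] lies in N[c] ∩ N[d]; by minimality the two are equal, and `y` belongs to
        -- the first.
        complete′ : ∀ c d → (∀ x → ∀ y → Independent x y → common c d ≤ common x y) → F c → F d → ∀ z → F z → ¬ Is (H z c) →
          ∀ y → Is (V y) → Is (H c y) → Is (H d y) → Is (H z y)
        complete′ c d least Fc Fd z Fz ¬zc y vy cy dy = decidable-stable (is? (H z y)) λ ¬zy →
          ¬zy (proj₁ (proj₂ (card-⊇ N (common? z c) (common? c d)
            (λ { q _ (vq , zq , cq) → vq , cq , dq ¬zy q vq zq cq }) (least z c (Fz , Fc , ¬zc)) y (V< y vy) (vy , cy , dy))))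
          where
          vz = F⇒V z Fz
          vc = F⇒V c Fc
          vd = F⇒V d Fd
          dq : ¬ Is (H z y) → ∀ q → Is (V q) → Is (H z q) → Is (H c q) → Is (H d q)
          dq ¬zy q vq zq cq =
            [ (λ zc → ⊥-elim (¬zc zc))
            , (λ qy → [ (λ zy → ⊥-elim (¬zy zy)) , H-sym _ _ ]′ (H-tp z q y d vz vq vy vd zq qy (H-sym _ _ dy))) ]′
            (H-tp z q c y vz vq vc vy zq (H-sym _ _ cq) cy)

        P : ℕ → Set
        P z = F z × ¬ (Is (H a z) × Is (H b z))

        P? : Decidable P
        P? z = F? z ×-dec ¬? (is? (H a z) ×-dec is? (H b z))

        complete : ∀ z → P z → ∀ y → Is (V y) → Is (H a y) → Is (H b y) → Is (H z y)
        complete z (Fz , off) y vy ay by = go (is? (H a z)) (is? (H b z))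
          where
          go : Dec (Is (H a z)) → Dec (Is (H b z)) → Is (H z y)
          go (yes az) (yes bz) = ⊥-elim (off (az , bz))
          go (no ¬az) _ = complete′ a b least Fa Fb z Fz (¬az ∘ H-sym _ _) y vy ay by
          go (yes _) (no ¬bz) = complete′ b a
            (λ c d ind → ≤-trans (card-mono N (common? b a) (common? a b) (λ { _ _ (p , q , r) → p , r , q })) (least c d ind))
            Fb Fa z Fz (¬bz ∘ H-sym _ _) y vy by ay

        Off : ℕ → Set
        Off z = ¬ (Is (E a z) × Is (E b z))

        off⇒ : ∀ {z} → Is (V z) → Off z → ¬ (Is (H a z) × Is (H b z))
        off⇒ {z} vz off (az , bz) = off (H⇒E a z Va vz (untouchedF Fa) az , H⇒E b z Vb vz (untouchedF Fb) bz)

        off⇐ : ∀ {z} → Is (V z) → ¬ (Is (H a z) × Is (H b z)) → Off z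
        off⇐ {z} vz off (az , bz) = off (E⇒H a z Va vz (untouchedF Fa) az , E⇒H b z Vb vz (untouchedF Fb) bz)

        PV : ∀ {z} → P z → Is (V z)
        PV {z} Pz = F⇒V z (proj₁ Pz)

        Pedge : ∀ {z} y → P z → Is (V y) → Is (E z y) → Is (H z y)
        Pedge {z} y Pz vy zy = E⇒H z y (PV Pz) vy (untouchedF (proj₁ Pz)) zy

        Pedge⁻ : ∀ {z} y → P z → Is (V y) → Is (H z y) → Is (E z y)
        Pedge⁻ {z} y Pz vy zy = H⇒E z y (PV Pz) vy (untouchedF (proj₁ Pz)) zy

        P-closed : ∀ z y → P z → Is (V y) → Off y → Is (E z y) → P y
        P-closed z y Pz@(Fz , _) vy off zy = go (busy? y) , off⇒ vy off
          where
          Hzy = Pedge y Pz vy zy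
          go : Dec (Busy y) → F y
          go (no ¬by) = F-closed z y Fz (vy , ¬by) Hzy
          go (yes by) = ⊥-elim (off⇒ vy off
            (proj₂ (proj₂ Fa y vy by) (proj₁ (proj₂ Fz y vy by) Hzy) , proj₂ (proj₂ Fb y vy by) (proj₁ (proj₂ Fz y vy by) Hzy)))

        no-obstruction : ∀ p u w q → P p → P u → P w → P q → Is (E p u) → Is (E u w) → Is (E w q) →
          ¬ Is (E p w) → ¬ Is (E u q) → ⊥
        no-obstruction p u w q Pp Pu Pw Pq pu uw wq ¬pw ¬uq =
          [ ¬pw ∘ Pedge⁻ w Pp (PV Pw) , ¬uq ∘ Pedge⁻ q Pu (PV Pq) ]′
            (H-tp p u w q (PV Pp) (PV Pu) (PV Pw) (PV Pq) (Pedge u Pp (PV Pu) pu) (Pedge w Pu (PV Pw) uw) (Pedge q Pw (PV Pq) wq))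

        not-bad : ∀ x → P x → ¬ ⟦ badᶠ v1 v2 v0 ⟧ (x ∷ a ∷ b ∷ [])
        not-bad x Px (inj₁ (y , vy , ay , by , ¬xy)) = ¬xy (Pedge⁻ y Px vy
          (complete x Px y vy (E⇒H a y Va vy (untouchedF Fa) ay) (E⇒H b y Vb vy (untouchedF Fb) by)))
        not-bad x Px (inj₂ (u , vu , w , vw , q , vq , oq , ow , ou , inj₁ (xu , uw , wq , ¬xw , ¬uq))) =
          no-obstruction x u w q Px Pu Pw (P-closed w q Pw vq oq wq) xu uw wq ¬xw ¬uq
          where
          Pu = P-closed x u Px vu ou xu
          Pw = P-closed u w Pu vw ow uw
        not-bad x Px (inj₂ (u , vu , w , vw , q , vq , oq , ow , ou , inj₂ (ux , xw , wq , ¬uw , ¬xq))) =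
          no-obstruction u x w q Pu Px Pw (P-closed w q Pw vq oq wq) ux xw wq ¬uw ¬xq
          where
          Pu = P-closed x u Px vu ou (E-sym _ _ ux)
          Pw = P-closed x w Px vw ow xw

        P⇒inModule : ∀ z → P z → ⟦ inModuleᶠ v1 v2 v0 ⟧ (z ∷ a ∷ b ∷ [])
        P⇒inModule z Pz = off⇐ (PV Pz) (proj₂ Pz) , λ y vy x vx oy zy ox yx →
          not-bad x (P-closed y x (P-closed z y Pz vy oy zy) vx ox yx)

        P-small : card N P? ≤ m
        P-small = ≤-trans (card-mono N P? (λ z → V? z ×-dec dec (inModuleᶠ v2 v1 v0) (z ∷ b ∷ a ∷ a ∷ []))
                             (λ z _ Pz → PV Pz , P⇒inModule z Pz))
          -- The rule would delete `a` itself: it belongs to the module because it is not adjacent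
          -- to `b`.
          (≮⇒≥ λ big → irreducible a Va (inj₂ (inj₁
            ((λ x vx → irreducible x vx ∘ inj₁) , a , Va , b , Vb , P⇒inModule a (Fa , λ { (_ , ba) → ¬ab (H-sym _ _ ba) }) , big))))

        C? : Decidable (λ z → F z × Is (H a z) × Is (H b z))
        C? z = F? z ×-dec is? (H a z) ×-dec is? (H b z)

        -- Two common neighbours `y` and `z` of `a` and `b` are adjacent, since the path `y a z b`
        -- lacks the chord `a b`; to the vertices of `P` they are adjacent by `complete`. Those in
        -- `F` are therefore twins.
        C-small : card N C? ≤ θ
        C-small = card-twins C? (λ x Cx → F⇒V x (proj₁ Cx) , untouchedF (proj₁ Cx)) row
          where
          row : ∀ x y → F x × Is (H a x) × Is (H b x) → F y × Is (H a y) × Is (H b y) → x ⊑ y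
          row x y (Fx , _) (Fy , ay , by) z vz xz = F-row Fx Fy vz (λ Fz _ → go Fz (is? (H a z) ×-dec is? (H b z))) xz
            where
            vy = F⇒V y Fy
            go : F z → Dec (Is (H a z) × Is (H b z)) → Is (H y z)
            go Fz (no off) = H-sym _ _ (complete z (Fz , off) y vy ay by)
            go Fz (yes (az , bz)) = [ id , ⊥-elim ∘ ¬ab ]′ (H-tp y a z b vy Va vz Vb (H-sym _ _ ay) az (H-sym _ _ bz))

        F-small : card N F? ≤ θ + m
        F-small = ≤-trans (card-∪ N F? C? P? λ x _ Fx → split x Fx (is? (H a x) ×-dec is? (H b x))) (+-mono-≤ C-small P-small)
          where
          split : ∀ x → F x → Dec (Is (H a x) × Is (H b x)) → (F x × Is (H a x) × Is (H b x)) ⊎ P x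
          split x Fx (yes c) = inj₁ (Fx , c)
          split x Fx (no ¬c) = inj₂ (Fx , ¬c)

      independent? : ∀ a b → Dec (Independent a b)
      independent? a b = F? a ×-dec F? b ×-dec ¬? (is? (H a b))

      F-small : card N F? ≤ θ + m
      F-small = go (any<? N (λ a → any<? N (independent? a)))
        where
        Pair : Set
        Pair = ∃ λ a → ∃ λ b → Independent a b
        below? : ∀ j → Dec (∃ λ ((a , b , _) : Pair) → common a b < j)
        below? j = map′ (λ { (a , _ , b , _ , i , lt) → (a , b , i) , lt })
          (λ { ((a , b , i@(Fa , Fb , _)) , lt) → a , V< a (F⇒V a Fa) , b , V< b (F⇒V b Fb) , i , lt })
          (any<? N (λ a → any<? N (λ b → independent? a b ×-dec (common a b <? j))))
        go : Dec (∃ λ a → a < N × (∃ λ b → b < N × Independent a b)) → card N F? ≤ θ + m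
        go (no ∄) = ≤-trans (clique-small ∄) (m≤m+n θ m)
        go (yes (a₀ , _ , b₀ , _ , i₀)) =
          let ((a , b , Fa , Fb , ¬ab) , least) = minimise (λ { (a , b , _) → common a b }) below? (a₀ , b₀ , i₀)
          in Minimal.F-small a b Fa Fb ¬ab (λ c d i → least (c , d , i))

    busyV? : Decidable (λ v → Is (V v) × Busy v)
    busyV? v = V? v ×-dec busy? v

    -- The busy neighbours of a free vertex are linearly ordered, so they are exactly the busy
    -- vertices above the lowest of them, `p`, which determines σ; `None` collects the free vertices
    -- that have none.
    free-count : card N free? ≤ (θ + m) + card N busyV? * (θ + m)
    free-count = ≤-trans (card-∪ N free? None.F? some? split) (+-mono-≤ None.F-small
      (card-fibres N N some? busyV? (λ p → FreeModule.F? (p ⊑?_)) (θ + m)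
        (λ _ _ (p , p<N , q , r) → p , p<N , q , r) (λ p _ _ → FreeModule.F-small (p ⊑?_))))
      where
      module None = FreeModule {λ _ → ⊥} (λ _ → no id)
      Above : ℕ → ℕ → Set
      Above p = FreeModule.F (p ⊑?_)
      Some : ℕ → Set
      Some w = ∃ λ p → p < N × (Is (V p) × Busy p) × Above p w
      some? : Decidable Some
      some? w = any<? N (λ p → busyV? p ×-dec FreeModule.F? (p ⊑?_) w)
      split : ∀ w → w < N → Free w → None.F w ⊎ Some w
      split w w<N fw = go (∃P? (λ q → busy? q ×-dec is? (H w q)))
        where
        go : Dec (∃ λ q → Is (V q) × Busy q × Is (H w q)) → None.F w ⊎ Some w
        go (no ∄) = inj₁ (fw , λ q vq bq → (λ wq → ∄ (q , vq , bq , wq)) , ⊥-elim)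
        go (yes s) =
          let (p , (vp , bp , wp) , least) = argmin N (λ q → V? q ×-dec busy? q ×-dec is? (H w q)) (λ q r → V< q (proj₁ r)) deg s
          in inj₂ (p , V< p vp , (vp , bp) , fw , λ q vq bq →
               (λ wq → [ id , (λ q⊑p → ⊑-antisym q⊑p (least q (vq , bq , wq))) ]′
                         (comparable vp vq (free⊑busy fw vp bp wp q vq wq))) ,
               (λ p⊑q → H-sym _ _ (p⊑q w (proj₁ fw) (H-sym _ _ wp))))

    -- Chains above touched vertices

    chain-bound : ℕ
    chain-bound = suc θ * θ + (θ + suc θ * θ)

    module Chain (x j : ℕ) where

      -- The vertices above `x` form a chain. Fixing the number `j` of touched descendants cuts it
      -- where further touched vertices join; between two members of one piece only free vertices
      -- hang off, which is what makes the piece a comb.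
      F : ℕ → Set
      F v = Is (V v) × ¬ Touched v × Desc v x × card N (desc? v) ≡ j

      F? : Decidable F
      F? v = V? v ×-dec ¬? (touched? v) ×-dec desc? v x ×-dec (card N (desc? v) ≟ j)

      FV : ∀ {v} → F v → Is (V v)
      FV = proj₁

      ¬tF : ∀ {v} → F v → ¬ Touched v
      ¬tF Fv = proj₁ (proj₂ Fv)

      Vx : ∀ {v} → F v → Is (V x)
      Vx (_ , _ , ((_ , _ , vx , _) , _) , _) = vx

      chain : ∀ {u v} → F u → F v → u ⊑ v ⊎ v ⊑ u
      chain {u} {v} Fu Fv = comparable (FV Fu) (FV Fv)
        (x⊑ Fu v (FV Fv) (H-sym _ _ (x⊑ Fv x (Vx Fv) (H-refl x))))
        where
        x⊑ : ∀ {v} → F v → x ⊑ v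
        x⊑ Fv = proj₂ (proj₁ (proj₂ (proj₂ Fv)))

      same-desc : ∀ {u v} → F u → F v → ∀ y → y < N → Desc v y → Desc u y
      same-desc {u} {v} Fu Fv y y<N d = [ down , (λ v⊑u → proj₁ d , ⊑-trans (proj₂ d) v⊑u) ]′ (chain Fu Fv)
        where
        down : u ⊑ v → Desc u y
        down u⊑v = card-⊇ N (desc? u) (desc? v) (λ { _ _ (t , s) → t , ⊑-trans s u⊑v })
          (≤-reflexive (trans (proj₂ (proj₂ (proj₂ Fv))) (symm (proj₂ (proj₂ (proj₂ Fu)))))) y y<N d

      ⊑-greatest : ∀ {u v} → F u → F v → deg u ≤ deg v → u ⊑ v
      ⊑-greatest Fu Fv le = [ id , (λ v⊑u → ⊑-antisym v⊑u le) ]′ (chain Fu Fv)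

      teeth? : ∀ y z → Decidable (λ t → Is (V t) × Is (H y t) × ¬ Is (H z t))
      teeth? y z t = V? t ×-dec is? (H y t) ×-dec ¬? (is? (H z t))

      teeth : ℕ → ℕ → ℕ
      teeth y z = card N (teeth? y z)

      near? : ∀ y → Decidable (λ z → F z × z ⊑ y × teeth y z ≤ θ)
      near? y z = F? z ×-dec (z ⊑? y) ×-dec (teeth y z ≤? θ)

      -- The number of teeth between `y` and `z` takes at most θ + 1 values, and chain members with
      -- equal numbers are twins.
      few-near : ∀ y → card N (near? y) ≤ suc θ * θ
      few-near y = card-fibres′ N (suc θ) (near? y) level? θ
        (λ { z _ (Fz , z⊑y , le) → teeth y z , s≤s le , Fz , z⊑y , refl })
        (λ i _ → card-twins (level? i) (λ { z (Fz , _) → FV Fz , ¬tF Fz }) (twins i))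
        where
        Level : ℕ → ℕ → Set
        Level i z = F z × z ⊑ y × teeth y z ≡ i
        level? : ∀ i z → Dec (Level i z)
        level? i z = F? z ×-dec (z ⊑? y) ×-dec (teeth y z ≟ i)
        twins : ∀ i u z → Level i u → Level i z → u ⊑ z
        twins i u z (Fu , u⊑y , eu) (Fz , z⊑y , ez) = [ id , up ]′ (chain Fu Fz)
          where
          up : z ⊑ u → u ⊑ z
          up z⊑u q vq uq = decidable-stable (is? (H z q)) λ ¬zq →
            proj₂ (proj₂ (card-⊇ N (teeth? y u) (teeth? y z)
              (λ { t _ (vt , yt , ¬ut) → vt , yt , λ zt → ¬ut (z⊑u t vt zt) })
              (≤-reflexive (trans ez (symm eu))) q (V< q vq) (vq , u⊑y q vq uq , ¬zq))) uq

      module _ (y z : ℕ) (Fy : F y) (Fz : F z) (z⊑y : z ⊑ y) where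

        private
          Vy = FV Fy
          Vz = FV Fz
          Tooth Shaft Body : ℕ → Set
          Tooth t = Is (E y t) × ¬ Is (E z t)
          Shaft s = ⟦ shaftᶠ v1 v2 v0 ⟧ (s ∷ y ∷ z ∷ [])
          Body s = Tooth s ⊎ Shaft s

          Hy : ∀ t → Is (V t) → Is (E y t) → Is (H y t)
          Hy t vt = E⇒H y t Vy vt (¬tF Fy)
          Ey : ∀ t → Is (V t) → Is (H y t) → Is (E y t)
          Ey t vt = H⇒E y t Vy vt (¬tF Fy)
          Hz : ∀ t → Is (V t) → Is (E z t) → Is (H z t)
          Hz t vt = E⇒H z t Vz vt (¬tF Fz)
          Ez : ∀ t → Is (V t) → Is (H z t) → Is (E z t)
          Ez t vt = H⇒E z t Vz vt (¬tF Fz)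

          tooth≁z : ∀ t → Is (V t) → Tooth t → ¬ Is (H z t)
          tooth≁z t vt (_ , ¬zt) = ¬zt ∘ Ez t vt

          tooth⊑y : ∀ t → Is (V t) → Tooth t → t ⊑ y
          tooth⊑y t vt (yt , ¬zt) =
            [ (λ y⊑t → ⊥-elim (¬zt (Ez t vt (H-sym _ _ (y⊑t z Vz (⊑⇒~ Vz z⊑y)))))) , id ]′
              (comparable Vy vt (Hy t vt yt))

          -- A touched vertex below the tooth would be a touched descendant of `y`, hence of `z`,
          -- which has the same ones; then the tooth would be adjacent to `z`.
          tooth-free : ∀ t → Is (V t) → Tooth t → Free t
          tooth-free t vt t-tooth = vt , λ { (r , r<N , tr@(_ , _ , vr , _) , r⊑t) →
            tooth≁z t vt t-tooth (proj₂ (same-desc Fz Fy r r<N (tr , ⊑-trans r⊑t (tooth⊑y t vt t-tooth))) t vt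
              (H-sym _ _ (⊑⇒~ vr r⊑t))) }

          Ht : ∀ {t} p → Is (V t) → Is (V p) → Tooth t → Is (E t p) → Is (H t p)
          Ht {t} p vt vp t-tooth = E⇒H t p vt vp (free-untouched (tooth-free t vt t-tooth))
          Et : ∀ {t} p → Is (V t) → Is (V p) → Tooth t → Is (H t p) → Is (E t p)
          Et {t} p vt vp t-tooth = H⇒E t p vt vp (free-untouched (tooth-free t vt t-tooth))

          -- If `p` were not above `y`, it would belong to the body: below `t` it is a tooth, and
          -- between `t` and `y` a tooth or, if untouched, a shaft vertex. A touched `p` adjacent to
          -- `z` would be a descendant of `y`, hence of `z`, and make `t` adjacent to `z`.
          above-y : ∀ t p → Is (V t) → Is (V p) → Tooth t → ¬ Body p → Is (E t p) → y ⊑ p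
          above-y t p vt vp t-tooth ¬bp tp = [ above , ⊥-elim ∘ below ]′ (comparable vt vp (Ht p vt vp t-tooth tp))
            where
            t≁z = tooth≁z t vt t-tooth
            not-under-z : t ⊑ p → ¬ (p ⊑ z)
            not-under-z t⊑p p⊑z = t≁z (p⊑z t vt (⊑⇒~ vt t⊑p))
            above : t ⊑ p → y ⊑ p
            above t⊑p = [ (λ p⊑y → ⊥-elim (under p⊑y)) , id ]′ (comparable vp Vy py)
              where
              py : Is (H p y)
              py = t⊑p y Vy (H-sym _ _ (Hy t vt (proj₁ t-tooth)))
              under : p ⊑ y → ⊥
              under p⊑y = go (is? (E z p)) (touched? p)
                where
                go : Dec (Is (E z p)) → Dec (Touched p) → ⊥
                go (no ¬zp) _ = ¬bp (inj₁ (Ey p vp (H-sym _ _ py) , ¬zp))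
                go (yes zp) (yes touched-p) = not-under-z t⊑p (proj₂ (same-desc Fz Fy p (V< p vp) (touched-p , p⊑y)))
                go (yes zp) (no ¬tp) = [ not-under-z t⊑p , (λ z⊑p →
                    ¬bp (inj₂ (⊑⇒sub Vz vp (¬tF Fz) ¬tp z⊑p , ⊑⇒sub vp Vy ¬tp (¬tF Fy) p⊑y))) ]′
                  (comparable vp Vz (H-sym _ _ (Hz p vp zp)))
            below : ¬ (p ⊑ t)
            below p⊑t = ¬bp (inj₁ (Ey p vp (⊑⇒~ vp (⊑-trans p⊑t (tooth⊑y t vt t-tooth))) ,
              λ zp → t≁z (H-sym _ _ (p⊑t z Vz (H-sym _ _ (Hz p vp zp))))))

          outer : ∀ t → Is (V t) → ∀ p → Is (V p) → Tooth t → ¬ Body p → Is (E t p) →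
            Is (E z p) × (∀ t′ → Is (V t′) → Tooth t′ → Is (E t′ p))
          outer t vt p vp t-tooth ¬bp tp = Ez p vp (H-sym _ _ (y⊑p z Vz (⊑⇒~ Vz z⊑y)))
            , λ t′ vt′ t′-tooth → Et p vt′ vp t′-tooth (H-sym _ _ (y⊑p t′ vt′ (Hy t′ vt′ (proj₁ t′-tooth))))
            where
            y⊑p = above-y t p vt vp t-tooth ¬bp tp

          shaft~z : ∀ s → Shaft s → Is (E z s)
          shaft~z s (z⊑s , _) = E-sym _ _ (z⊑s z Vz (E-refl z))

          shaft-clique : ∀ p q → Is (V q) → Shaft p → Shaft q → Is (E p q)
          shaft-clique p q vq (z⊑p , _) sq = z⊑p q vq (shaft~z q sq)

          -- A shaft vertex with a tooth lies above z in H as well.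
          shaft-edge : ∀ s t r → Is (V s) → Is (V t) → Is (V r) → Shaft s → Tooth t → Is (E s t) → Shaft r → Is (H s r)
          shaft-edge s t r vs vt vr ss t-tooth st sr =
            [ (λ z⊑s → z⊑s r vr (Hz r vr (shaft~z r sr)))
            , (λ s⊑z → ⊥-elim (tooth≁z t vt t-tooth (s⊑z t vt (H-sym _ _ (Ht s vt vs t-tooth (E-sym _ _ st)))))) ]′
            (comparable Vz vs (Hz s vs (shaft~z s ss)))

          -- Shaft vertices may be touched, so an edge between two of them can be absent from `H`.
          -- Edges at teeth cannot, as teeth are free; a shaft edge with a tooth next on the path is
          -- recovered by `shaft-edge`.
          path-edge : ∀ p u w → Is (V p) → Is (V u) → Is (V w) → Body p → Body u → Is (E p u) → Is (E u w) →
            Tooth p ⊎ Tooth w → Is (H p u)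
          path-edge p u w vp vu vw (inj₁ tp) _ pu uw _ = Ht u vp vu tp pu
          path-edge p u w vp vu vw _ (inj₁ tu) pu uw _ = H-sym _ _ (Ht p vu vp tu (E-sym _ _ pu))
          path-edge p u w vp vu vw _ _ pu uw (inj₁ tp) = Ht u vp vu tp pu
          path-edge p u w vp vu vw (inj₂ sp) (inj₂ su) pu uw (inj₂ tw) = H-sym _ _ (shaft-edge u w p vu vw vp su tw uw sp)

          H⇒E-tooth : ∀ p w → Is (V p) → Is (V w) → Tooth p ⊎ Tooth w → Is (H p w) → Is (E p w)
          H⇒E-tooth p w vp vw (inj₁ tp) pw = Et w vp vw tp pw
          H⇒E-tooth p w vp vw (inj₂ tw) pw = E-sym _ _ (Et p vw vp tw (H-sym _ _ pw))

          -- Shaft vertices are pairwise adjacent, so both pairs that lack a chord contain a tooth.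
          -- Then the path survives in `H`, and the chord found there, having a tooth as an end, is
          -- one of `E`.
          tp-teeth : ∀ p u w q → Is (V p) → Is (V u) → Is (V w) → Is (V q) → Body p → Body u → Body w → Body q →
            Tooth p ⊎ Tooth w → Tooth u ⊎ Tooth q → Is (E p u) → Is (E u w) → Is (E w q) → Is (E p w) ⊎ Is (E u q)
          tp-teeth p u w q vp vu vw vq bp bu bw bq pw uq p~u u~w w~q =
            [ inj₁ ∘ H⇒E-tooth p w vp vw pw , inj₂ ∘ H⇒E-tooth u q vu vq uq ]′
              (H-tp p u w q vp vu vw vq
                (path-edge p u w vp vu vw bp bu p~u u~w pw)
                (H-sym _ _ (path-edge w u p vw vu vp bw bu (E-sym _ _ u~w) (E-sym _ _ p~u) (swap pw)))
                (H-sym _ _ (path-edge q w u vq vw vu bq bw (E-sym _ _ w~q) (E-sym _ _ u~w) (swap uq))))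

          tp-body : ∀ p → Is (V p) → ∀ u → Is (V u) → ∀ w → Is (V w) → ∀ q → Is (V q) → Body p → Body u → Body w → Body q →
            Is (E p u) → Is (E u w) → Is (E w q) → Is (E p w) ⊎ Is (E u q)
          tp-body p vp u vu w vw q vq bp bu bw bq = go (teeth⊎ p w vw bp bw) (teeth⊎ u q vq bu bq)
            where
            teeth⊎ : ∀ a b → Is (V b) → Body a → Body b → (Tooth a ⊎ Tooth b) ⊎ Is (E a b)
            teeth⊎ a b vb (inj₁ ta) _ = inj₁ (inj₁ ta)
            teeth⊎ a b vb _ (inj₁ tb) = inj₁ (inj₂ tb)
            teeth⊎ a b vb (inj₂ sa) (inj₂ sb) = inj₂ (shaft-clique a b vb sa sb)
            go : (Tooth p ⊎ Tooth w) ⊎ Is (E p w) → (Tooth u ⊎ Tooth q) ⊎ Is (E u q) →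
              Is (E p u) → Is (E u w) → Is (E w q) → Is (E p w) ⊎ Is (E u q)
            go (inj₂ pw) _ _ _ _ = inj₁ pw
            go _ (inj₂ uq) _ _ _ = inj₂ uq
            go (inj₁ pw) (inj₁ uq) = tp-teeth p u w q vp vu vw vq bp bu bw bq pw uq

        is-comb : ⟦ combᶠ v0 v1 ⟧ (y ∷ z ∷ [])
        is-comb = ⊑⇒sub Vz Vy (¬tF Fz) (¬tF Fy) z⊑y , outer , tp-body

      F₁? : ∀ y → Decidable (λ z → F z × θ < teeth y z)
      F₁? y z = F? z ×-dec (θ <? teeth y z)

      -- The members with many teeth below `y` from `z` upwards; with `z` the lower shaft vertex `w`
      -- of a comb, they supply its middle count.
      run? : ∀ y z → Decidable (λ u → (F u × θ < teeth y u) × z ⊑ u)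
      run? y z u = F₁? y u ×-dec (z ⊑? u)

      F₂? : ∀ y → Decidable (λ z → (F z × θ < teeth y z) × θ < card N (run? y z))
      F₂? y z = F₁? y z ×-dec (θ <? card N (run? y z))

      -- Going down the chain F: first the vertices with few teeth below y,
      -- then the next few vertices, then those with few teeth below w.
      no-comb : ∀ y v w z → F y → (∀ u → F u → deg u ≤ deg y) →
        F v × θ < teeth y v → (∀ u → F u × θ < teeth y u → deg u ≤ deg v) →
        (F w × θ < teeth y w) × θ < card N (run? y w) →
        F z → z ⊑ w → ¬ (θ < teeth w z)
      no-comb y v w z Fy y-top (Fv , θ<yv) v-top (Fw₁@(Fw , _) , θ<run) Fz z⊑w θ<wz =
        irreducible v (FV Fv) (inj₂ (inj₂ (y , FV Fy , z , FV Fz , w , FV Fw ,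
          is-comb y z Fy Fz z⊑y , sub Fv Fy v⊑y , sub Fz Fw z⊑w , sub Fw Fv w⊑v ,
          <-≤-trans θ<yv (card-mono N (teeth? y v) s? λ { t _ (vt , yt , ¬vt) →
            vt , (E⇐ Fy vt yt , λ zt → ¬vt (z⊑v t vt (E⇒ Fz vt zt))) , ¬vt ∘ E⇒ Fv vt }) ,
          <-≤-trans θ<run (card-mono N (run? y w) u? λ { u _ (Fu₁@(Fu , _) , w⊑u) →
            FV Fu , sub Fw Fu w⊑u , sub Fu Fv (⊑-greatest Fu Fv (v-top u Fu₁)) }) ,
          <-≤-trans θ<wz (card-mono N (teeth? w z) t? λ { t _ (vt , wt , ¬zt) →
            vt , (E⇐ Fy vt (⊑-trans w⊑v v⊑y t vt wt) , ¬zt ∘ E⇒ Fz vt) , E⇐ Fw vt wt }))))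
        where
        s? = λ x → V? x ×-dec dec (toothᶠ v3 v2 v0 ∧ᶠ ¬ᶠ adjᶠ (suc v3) v0) (x ∷ w ∷ z ∷ y ∷ v ∷ [])
        u? = λ x → V? x ×-dec dec (subᶠ v1 v0 ∧ᶠ subᶠ v0 (suc v3)) (x ∷ w ∷ z ∷ y ∷ v ∷ [])
        t? = λ x → V? x ×-dec dec (toothᶠ v3 v2 v0 ∧ᶠ adjᶠ v1 v0) (x ∷ w ∷ z ∷ y ∷ v ∷ [])
        v⊑y = ⊑-greatest Fv Fy (y-top v Fv)
        w⊑v = ⊑-greatest Fw Fv (v-top w Fw₁)
        z⊑v = ⊑-trans z⊑w w⊑v
        z⊑y = ⊑-trans z⊑v v⊑y
        sub : ∀ {a b} → F a → F b → a ⊑ b → ⟦ subᶠ v0 v1 ⟧ (a ∷ b ∷ [])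
        sub Fa Fb = ⊑⇒sub (FV Fa) (FV Fb) (¬tF Fa) (¬tF Fb)
        E⇒ : ∀ {a t} → F a → Is (V t) → Is (E a t) → Is (H a t)
        E⇒ {a} {t} Fa vt = E⇒H a t (FV Fa) vt (¬tF Fa)
        E⇐ : ∀ {a t} → F a → Is (V t) → Is (H a t) → Is (E a t)
        E⇐ {a} {t} Fa vt = H⇒E a t (FV Fa) vt (¬tF Fa)

      -- All these vertices lie above the lowest of them, hence in its run, which has at most θ
      -- members.
      few-run : ∀ y → card N (λ z → F₁? y z ×-dec ¬? (θ <? card N (run? y z))) ≤ θ
      few-run y = go (any<? N L?)
        where
        L : ℕ → Set
        L z = (F z × θ < teeth y z) × ¬ (θ < card N (run? y z))
        L? : Decidable L
        L? z = F₁? y z ×-dec ¬? (θ <? card N (run? y z))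
        go : Dec (∃ λ z → z < N × L z) → card N L? ≤ θ
        go (no ∄) = ≤-trans (≤-reflexive (card-none N L? λ z z<N l → ∄ (z , z<N , l))) z≤n
        go (yes (z₀ , _ , l₀)) =
          let (z , (Fz , ¬big) , least) = argmin N L? (λ z l → V< z (FV (proj₁ (proj₁ l)))) deg (z₀ , l₀)
          in ≤-trans (card-mono N L? (run? y z) λ u _ lu →
                       proj₁ lu , ⊑-greatest (proj₁ Fz) (proj₁ (proj₁ lu)) (least u lu))
                     (≮⇒≥ ¬big)

      card-chain : card N F? ≤ chain-bound
      card-chain = go₀ (any<? N F?)
        where
        F< : ∀ x → F x → x < N
        F< x Fx = V< x (FV Fx)
        go₃ : ∀ y v → F y → (∀ u → F u → deg u ≤ deg y) → F v × θ < teeth y v →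
          (∀ u → F u × θ < teeth y u → deg u ≤ deg v) → Dec (∃ λ w → w < N × ((F w × θ < teeth y w) × θ < card N (run? y w))) →
          card N (F₂? y) ≤ suc θ * θ
        go₃ y v Fy y-top Fv v-top (no ∄) = ≤-trans (≤-reflexive (card-none N (F₂? y) λ z z<N l → ∄ (z , z<N , l))) z≤n
        go₃ y v Fy y-top Fv v-top (yes (w₀ , _ , Fw₀)) =
          let (w , Fw , w-top) = argmax N (F₂? y) (λ x p → F< x (proj₁ (proj₁ p))) deg (w₀ , Fw₀)
          in ≤-trans (card-mono N (F₂? y) (near? w) λ z _ Fz →
               let z⊑w = ⊑-greatest (proj₁ (proj₁ Fz)) (proj₁ (proj₁ Fw)) (w-top z Fz)
               in proj₁ (proj₁ Fz) , z⊑w , ≮⇒≥ (no-comb y v w z Fy y-top Fv v-top Fw (proj₁ (proj₁ Fz)) z⊑w))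
             (few-near w)
        go₂ : ∀ y → F y → (∀ u → F u → deg u ≤ deg y) → Dec (∃ λ v → v < N × (F v × θ < teeth y v)) →
          card N (F₁? y) ≤ θ + suc θ * θ
        go₂ y Fy y-top (no ∄) = ≤-trans (≤-reflexive (card-none N (F₁? y) λ z z<N l → ∄ (z , z<N , l))) z≤n
        go₂ y Fy y-top (yes (v₀′ , _ , Fv₀)) =
          let (v , Fv , v-top) = argmax N (F₁? y) (λ x p → F< x (proj₁ p)) deg (v₀′ , Fv₀)
          in ≤-trans (card-∪ N (F₁? y) (λ z → F₁? y z ×-dec ¬? (θ <? card N (run? y z))) (F₂? y)
                       (λ z _ Fz → split z Fz (θ <? card N (run? y z))))
               (+-mono-≤ (few-run y) (go₃ y v Fy y-top Fv v-top (any<? N (F₂? y))))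
          where
          split : ∀ z → F z × θ < teeth y z → Dec (θ < card N (run? y z)) →
            ((F z × θ < teeth y z) × ¬ (θ < card N (run? y z))) ⊎ ((F z × θ < teeth y z) × θ < card N (run? y z))
          split z Fz (yes p) = inj₂ (Fz , p)
          split z Fz (no ¬p) = inj₁ (Fz , ¬p)
        go₀ : Dec (∃ λ y → y < N × F y) → card N F? ≤ chain-bound
        go₀ (no ∄) = ≤-trans (≤-reflexive (card-none N F? λ z z<N l → ∄ (z , z<N , l))) z≤n
        go₀ (yes (y₀ , _ , Fy₀)) =
          let (y , Fy , y-top) = argmax N F? F< deg (y₀ , Fy₀)
          in ≤-trans (card-∪ N F? (near? y) (F₁? y) (λ z _ Fz → split y z Fz (⊑-greatest Fz Fy (y-top z Fz)) (θ <? teeth y z)))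
               (+-mono-≤ (few-near y) (go₂ y Fy y-top (any<? N (F₁? y))))
          where
          split : ∀ y z → F z → z ⊑ y → Dec (θ < teeth y z) → (F z × z ⊑ y × teeth y z ≤ θ) ⊎ (F z × θ < teeth y z)
          split y z Fz z⊑y (yes p) = inj₂ (Fz , p)
          split y z Fz z⊑y (no ¬p) = inj₁ (Fz , z⊑y , ≮⇒≥ ¬p)

    -- Touched vertices are counted on their own. Any other busy vertex lies above one of at most 2k
    -- touched `x`, and its number of touched descendants takes one of 2k + 1 values.
    busy-count : card N busyV? ≤ 2 * k + 2 * k * (suc (2 * k) * chain-bound)
    busy-count = ≤-trans (card-∪ N busyV? touched? quiet? split)
      (+-mono-≤ few-touched (≤-trans (card-fibres N N quiet? touched? above? _
        (λ { v _ (vv , ¬tv , x , x<N , d) → x , x<N , proj₁ d , vv , ¬tv , d })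
        (λ x _ _ → card-fibres′ N (suc (2 * k)) (above? x) (λ j → Chain.F? x j) chain-bound
          (λ { v _ (vv , ¬tv , d) → card N (desc? v) , s≤s (≤-trans (card-mono N (desc? v) touched? (λ _ _ → proj₁)) few-touched) ,
                                     vv , ¬tv , d , refl })
          (λ j _ → Chain.card-chain x j)))
        (*-monoˡ-≤ (suc (2 * k) * chain-bound) few-touched)))
      where
      quiet? : Decidable (λ v → Is (V v) × ¬ Touched v × Busy v)
      quiet? v = V? v ×-dec ¬? (touched? v) ×-dec busy? v
      above? : ∀ x → Decidable (λ v → Is (V v) × ¬ Touched v × Desc v x)
      above? x v = V? v ×-dec ¬? (touched? v) ×-dec desc? v x
      split : ∀ v → v < N → Is (V v) × Busy v → Touched v ⊎ (Is (V v) × ¬ Touched v × Busy v)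
      split v _ (vv , bv) = go (touched? v)
        where
        go : Dec (Touched v) → Touched v ⊎ (Is (V v) × ¬ Touched v × Busy v)
        go (yes t) = inj₁ t
        go (no ¬t) = inj₂ (vv , ¬t , bv)

    vertex-count : card N V? ≤ card N busyV? + ((θ + m) + card N busyV? * (θ + m))
    vertex-count = ≤-trans (card-∪ N V? busyV? free? split) (+-monoʳ-≤ _ free-count)
      where
      split : ∀ v → v < N → Is (V v) → (Is (V v) × Busy v) ⊎ Free v
      split v _ vv = go (busy? v)
        where
        go : Dec (Busy v) → (Is (V v) × Busy v) ⊎ Free v
        go (yes b) = inj₁ (vv , b)
        go (no ¬b) = inj₂ (vv , ¬b)

    -- With q = k + 1 and θ + 1 ≤ 4q, a chain has at most 12q² + 3q + 12q² ≤ 27q² vertices; at most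
    -- 2q + 4 · 27q⁴ ≤ 110q⁴ vertices are busy; a free module has at most 3q + 27q³ ≤ 30q³.
    vertex-bound : card N V? ≤ suc k ^ 7 * 3440
    vertex-bound = begin
      card N V?
        ≤⟨ vertex-count ⟩
      card N busyV? + ((θ + m) + card N busyV? * (θ + m))
        ≤⟨ +-mono-≤ busy≤ (+-mono-≤ θ+m≤ (*-mono-≤ busy≤ θ+m≤)) ⟩
      q ^ 4 * 110 + (q ^ 3 * 30 + q ^ 4 * 110 * (q ^ 3 * 30))
        ≤⟨ +-mono-≤ (*-monoˡ-≤ 110 (q^ 4 7 4≤7)) (+-monoˡ-≤ _ (*-monoˡ-≤ 30 (q^ 3 7 3≤7))) ⟩
      q ^ 7 * 110 + (q ^ 7 * 30 + q ^ 4 * 110 * (q ^ 3 * 30))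
        ≡⟨ total q ⟩
      q ^ 7 * 3440 ∎
      where
      open ≤-Reasoning
      q : ℕ
      q = suc k
      q^ : ∀ a b → a ≤ b → q ^ a ≤ q ^ b
      q^ a b = ^-monoʳ-≤ q
      1≤2 : 1 ≤ 2
      1≤2 = s≤s z≤n
      1≤3 : 1 ≤ 3
      1≤3 = s≤s z≤n
      1≤4 : 1 ≤ 4
      1≤4 = s≤s z≤n
      3≤7 : 3 ≤ 7
      3≤7 = s≤s (s≤s (s≤s z≤n))
      4≤7 : 4 ≤ 7
      4≤7 = s≤s (s≤s (s≤s (s≤s z≤n)))
      total : ∀ q → q * (q * (q * (q * (q * (q * (q * 1)))))) * 110
        + (q * (q * (q * (q * (q * (q * (q * 1)))))) * 30 + q * (q * (q * (q * 1))) * 110 * (q * (q * (q * 1)) * 30))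
        ≡ q * (q * (q * (q * (q * (q * (q * 1)))))) * 3440
      total = solve-∀
      suc-2k : ∀ k → suc k * 2 ≡ suc (suc (2 * k))
      suc-2k = solve-∀
      2k≤ : 2 * k ≤ q * 2
      2k≤ = ≤-trans (m≤n+m (2 * k) 2) (≤-reflexive (symm (suc-2k k)))
      1+2k≤ : suc (2 * k) ≤ q * 2
      1+2k≤ = ≤-trans (n≤1+n _) (≤-reflexive (symm (suc-2k k)))
      sucθ≤ : suc θ ≤ q ^ 1 * 4
      sucθ≤ = ≤-trans (+-monoˡ-≤ θ (q^ 0 1 z≤n)) (≤-reflexive (collapse q))
        where
        collapse : ∀ q → q * 1 + q * 1 * 3 ≡ q * 1 * 4
        collapse = solve-∀
      chain≤ : chain-bound ≤ q ^ 2 * 27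
      chain≤ = ≤-trans (+-mono-≤ (*-monoˡ-≤ θ sucθ≤) (+-mono-≤ (*-monoˡ-≤ 3 (q^ 1 2 1≤2)) (*-monoˡ-≤ θ sucθ≤)))
        (≤-reflexive (collapse q))
        where
        collapse : ∀ q → q * 1 * 4 * (q * 1 * 3) + (q * (q * 1) * 3 + q * 1 * 4 * (q * 1 * 3)) ≡ q * (q * 1) * 27
        collapse = solve-∀
      busy≤ : card N busyV? ≤ q ^ 4 * 110
      busy≤ = begin
        card N busyV?                                     ≤⟨ busy-count ⟩
        2 * k + 2 * k * (suc (2 * k) * chain-bound)       ≤⟨ +-mono-≤ 2k≤ (*-mono-≤ 2k≤ (*-mono-≤ 1+2k≤ chain≤)) ⟩
        q * 2 + q * 2 * (q * 2 * (q ^ 2 * 27))            ≡⟨ split q ⟩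
        q ^ 1 * 2 + q ^ 4 * 108                           ≤⟨ +-monoˡ-≤ _ (*-monoˡ-≤ 2 (q^ 1 4 1≤4)) ⟩
        q ^ 4 * 2 + q ^ 4 * 108                           ≡⟨ symm (*-distribˡ-+ (q ^ 4) 2 108) ⟩
        q ^ 4 * 110                                       ∎
        where
        split : ∀ q → q * 2 + q * 2 * (q * 2 * (q * (q * 1) * 27)) ≡ q * 1 * 2 + q * (q * (q * (q * 1))) * 108
        split = solve-∀
      θ+m≤ : θ + m ≤ q ^ 3 * 30
      θ+m≤ = ≤-trans (+-monoˡ-≤ m (*-monoˡ-≤ 3 (q^ 1 3 1≤3))) (≤-reflexive (symm (*-distribˡ-+ (q ^ 3) 3 27)))

-- Turing machines

record Finite (A : Set) : Set where
  field
    size    : ℕ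
    to      : A → Fin size
    from    : Fin size → A
    from-to : ∀ a → from (to a) ≡ a

module _ where

  open Finite

  finite-⊤ : Finite ⊤
  finite-⊤ = record { size = 1 ; to = λ _ → zero ; from = λ _ → tt ; from-to = λ _ → refl }

  finite-Bool : Finite Bool
  finite-Bool = record
    { size = 2 ; to = λ { false → zero ; true → suc zero } ; from = λ { zero → false ; (suc _) → true }
    ; from-to = λ { false → refl ; true → refl } }

  finite-Fin : ∀ n → Finite (Fin n)
  finite-Fin n = record { size = n ; to = id ; from = id ; from-to = λ _ → refl }

  finite-⊎ : ∀ {A B} → Finite A → Finite B → Finite (A ⊎ B)
  finite-⊎ F G = record
    { size = size F + size G
    ; to = join (size F) (size G) ∘ Sum.map (to F) (to G)
    ; from = Sum.map (from F) (from G) ∘ splitAt (size F)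
    ; from-to = λ x → trans (cong (Sum.map (from F) (from G)) (splitAt-join (size F) (size G) (Sum.map (to F) (to G) x))) (go x) }
    where
    go : ∀ x → Sum.map (from F) (from G) (Sum.map (to F) (to G) x) ≡ x
    go (inj₁ a) = cong inj₁ (from-to F a)
    go (inj₂ b) = cong inj₂ (from-to G b)

  finite-× : ∀ {A B} → Finite A → Finite B → Finite (A × B)
  finite-× F G = record
    { size = size F * size G
    ; to = λ (a , b) → combine (to F a) (to G b)
    ; from = λ i → map (from F) (from G) (remQuot (size G) i)
    ; from-to = λ (a , b) → trans (cong (map (from F) (from G)) (remQuot-combine (to F a) (to G b)))
                                  (cong₂ _,_ (from-to F a) (from-to G b)) }

  finite-Vec : ∀ {A} n → Finite A → Finite (Vec A n)
  finite-Vec zero    F = record { size = 1 ; to = λ _ → zero ; from = λ _ → [] ; from-to = λ { [] → refl } }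
  finite-Vec {A} (suc n) F = record
    { size = size G ; to = λ { (x ∷ xs) → to G (x , xs) } ; from = cons ∘ from G
    ; from-to = λ { (x ∷ xs) → cong cons (from-to G (x , xs)) } }
    where
    G = finite-× F (finite-Vec n F)
    cons : A × Vec A n → Vec A (suc n)
    cons (x , xs) = x ∷ xs

module Machines (Γ : ℕ) where

  open Finite

  Sy : Set
  Sy = Fin (4 + Γ)

  blankˢ : Sy
  blankˢ = zero

  record Tape : Set where
    constructor tape
    field
      lefts  : List Sy
      head   : Sy
      rights : List Sy

  place placeˡ : List Sy → List Sy → Tape
  place l []      = tape l blankˢ []
  place l (x ∷ r) = tape l x r
  placeˡ []      r = tape [] blankˢ r
  placeˡ (x ∷ l) r = tape l x r

  move : Move → List Sy → Sy → List Sy → Tape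
  move left  l w r = placeˡ l (w ∷ r)
  move right l w r = place (w ∷ l) r
  move stay  l w r = tape l w r

  -- A machine leaves its states with a Boolean answer; polynomial running
  -- times are tracked by their degree only.
  record Mach : Set₁ where
    field
      State  : Set
      finite : Finite State
      start  : State
      δ      : State → Sy → (State ⊎ Bool) × Sy × Move
      degree : ℕ

  open Mach

  data Run (M : Mach) : State M → Tape → ℕ → Bool → Tape → Set where
    exit : ∀ {s l h r b w mv} → δ M s h ≡ (inj₂ b , w , mv) → Run M s (tape l h r) 1 b (move mv l w r)
    more : ∀ {s l h r s′ w mv t b τ} → δ M s h ≡ (inj₁ s′ , w , mv) → Run M s′ (move mv l w r) t b τ →
           Run M s (tape l h r) (suc t) b τ

  ret : Bool → Mach
  ret b = record { State = ⊤ ; finite = finite-⊤ ; start = tt ; δ = λ _ a → inj₂ b , a , stay ; degree = 0 }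

  module _ (M M₁ M₂ : Mach) where

    choose : State M ⊎ Bool → (State M ⊎ (State M₁ ⊎ State M₂)) ⊎ Bool
    choose (inj₁ s)     = inj₁ (inj₁ s)
    choose (inj₂ true)  = inj₁ (inj₂ (inj₁ (start M₁)))
    choose (inj₂ false) = inj₁ (inj₂ (inj₂ (start M₂)))

  cond : Mach → Mach → Mach → Mach
  cond M M₁ M₂ = record
    { State = State M ⊎ (State M₁ ⊎ State M₂)
    ; finite = finite-⊎ (finite M) (finite-⊎ (finite M₁) (finite M₂))
    ; start = inj₁ (start M)
    ; δ = λ { (inj₁ s) a → map₁ (choose M M₁ M₂) (δ M s a)
            ; (inj₂ (inj₁ s)) a → map₁ (Sum.map (inj₂ ∘ inj₁) id) (δ M₁ s a)
            ; (inj₂ (inj₂ s)) a → map₁ (Sum.map (inj₂ ∘ inj₂) id) (δ M₂ s a) }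
    -- Times are bounded by `base ^ suc degree`. The sum of two such bounds is at most their
    -- product, and the exponent of the product is the successor of this number.
    ; degree = suc (degree M + (degree M₁ + degree M₂)) }

  branch : Bool → Mach → Mach → Mach
  branch true  M₁ M₂ = M₁
  branch false M₁ M₂ = M₂

  module _ {M M₁ M₂ : Mach} where

    private
      C = cond M M₁ M₂

      run₁ : ∀ {s τ t b τ′} → Run M₁ s τ t b τ′ → Run C (inj₂ (inj₁ s)) τ t b τ′
      run₁ (exit eq)   = exit (cong (map₁ (Sum.map (inj₂ ∘ inj₁) id)) eq)
      run₁ (more eq r) = more (cong (map₁ (Sum.map (inj₂ ∘ inj₁) id)) eq) (run₁ r)

      run₂ : ∀ {s τ t b τ′} → Run M₂ s τ t b τ′ → Run C (inj₂ (inj₂ s)) τ t b τ′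
      run₂ (exit eq)   = exit (cong (map₁ (Sum.map (inj₂ ∘ inj₂) id)) eq)
      run₂ (more eq r) = more (cong (map₁ (Sum.map (inj₂ ∘ inj₂) id)) eq) (run₂ r)

      run₀ : ∀ {s τ t b τ′ t′ b′ τ″} → Run M s τ t b τ′ → Run (branch b M₁ M₂) (start (branch b M₁ M₂)) τ′ t′ b′ τ″ →
        Run C (inj₁ s) τ (t + t′) b′ τ″
      run₀ {b = true}  (exit eq) r   = more (cong (map₁ (choose M M₁ M₂)) eq) (run₁ r)
      run₀ {b = false} (exit eq) r   = more (cong (map₁ (choose M M₁ M₂)) eq) (run₂ r)
      run₀ (more eq r₀) r = more (cong (map₁ (choose M M₁ M₂)) eq) (run₀ r₀ r)

    cond-run : ∀ {τ t b τ′ t′ b′ τ″} → Run M (start M) τ t b τ′ → Run (branch b M₁ M₂) (start (branch b M₁ M₂)) τ′ t′ b′ τ″ →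
      Run C (start C) τ (t + t′) b′ τ″
    cond-run = run₀

  again : (M : Mach) → State M ⊎ Bool → State M ⊎ Bool
  again M (inj₁ s)     = inj₁ s
  again M (inj₂ true)  = inj₁ (start M)
  again M (inj₂ false) = inj₂ true

  loop : Mach → Mach
  loop M = record
    { State = State M ; finite = finite M ; start = start M ; δ = λ s a → map₁ (again M) (δ M s a) ; degree = suc (degree M) }

  module _ {M : Mach} where

    private
      again-run : ∀ {s τ t τ′ t′ b τ″} → Run M s τ t true τ′ → Run (loop M) (start M) τ′ t′ b τ″ →
        Run (loop M) s τ (t + t′) b τ″
      again-run (exit eq) r    = more (cong (map₁ (again M)) eq) r
      again-run (more eq r₀) r = more (cong (map₁ (again M)) eq) (again-run r₀ r)

      stop-run : ∀ {s τ t τ′} → Run M s τ t false τ′ → Run (loop M) s τ t true τ′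
      stop-run (exit eq)   = exit (cong (map₁ (again M)) eq)
      stop-run (more eq r) = more (cong (map₁ (again M)) eq) (stop-run r)

    loop-again : ∀ {τ t τ′ t′ b τ″} → Run M (start M) τ t true τ′ → Run (loop M) (start M) τ′ t′ b τ″ →
      Run (loop M) (start M) τ (t + t′) b τ″
    loop-again = again-run

    loop-stop : ∀ {τ t τ′} → Run M (start M) τ t false τ′ → Run (loop M) (start M) τ t true τ′
    loop-stop = stop-run

  next : (M : Mach) → State M ⊎ Bool → Fin (suc (size (finite M)))
  next M (inj₁ s) = suc (to (finite M) s)
  next M (inj₂ _) = zero

  toTM : Mach → TM
  toTM M = record
    { Q = suc (size (finite M)) ; Γ = Γ ; start = suc (to (finite M) (start M)) ; halt = zero ; δ = tm }
    where
    tm : Fin (suc (size (finite M))) → Sy → Fin (suc (size (finite M))) × Sy × Move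
    tm zero    a = zero , a , stay
    tm (suc i) a = map₁ (next M) (δ M (from (finite M) i) a)

  module _ (M : Mach) where

    private
      T = toTM M

    config : Fin (TM.Q T) → Tape → Config T
    config q (tape l h r) = cfg q l h r

    private
      step-move : ∀ i l h r q w mv → TM.δ T (suc i) h ≡ (q , w , mv) → step T (cfg (suc i) l h r) ≡ config q (move mv l w r)
      step-move i []      h r       q w left  eq rewrite eq = refl
      step-move i (_ ∷ _) h r       q w left  eq rewrite eq = refl
      step-move i l       h []      q w right eq rewrite eq = refl
      step-move i l       h (_ ∷ _) q w right eq rewrite eq = refl
      step-move i l       h r       q w stay  eq rewrite eq = refl

      δ-to : ∀ s h {x w mv} → δ M s h ≡ (x , w , mv) → TM.δ T (suc (to (finite M) s)) h ≡ (next M x , w , mv)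
      δ-to s h eq = trans (cong (λ s → map₁ (next M) (δ M s h)) (from-to (finite M) s)) (cong (map₁ (next M)) eq)

    run-TM : ∀ {s τ t b τ′} → Run M s τ t b τ′ →
      run T t (config (suc (to (finite M) s)) τ) ≡ config zero τ′
    run-TM {s} (exit {l = l} {h} {r} {b} {w} {mv} eq) = step-move _ l h r _ w mv (δ-to s h eq)
    run-TM {s} (more {l = l} {h} {r} {s′} {w} {mv} {t} eq rest) =
      trans (cong (run T t) (step-move _ l h r _ w mv (δ-to s h eq))) (run-TM rest)

  -- Whether the blank beyond an end of the word is already an explicit cell: not on the initial
  -- tape, always after the first pass.
  bl : Bool → List Sy
  bl false = []
  bl true  = blankˢ ∷ []

  -- A left-to-right pass of a transducer followed by a pass back that may
  -- rewrite each symbol once more; both turn at the first symbol they refuse.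
  module _ {Z : Set} (Z-finite : Finite Z) (z₀ : Z)
    (fwd : Z → Sy → Maybe (Z × Sy)) (back : Sy → Maybe Sy) (answer : Z → Bool) where

    private
      δ-fwd : Z → Sy → Maybe (Z × Sy) → ((Z ⊎ Bool) ⊎ Bool) × Sy × Move
      δ-fwd z a (just (z′ , w)) = inj₁ (inj₁ z′) , w , right
      δ-fwd z a nothing         = inj₁ (inj₂ (answer z)) , a , left

      δ-back : Bool → Sy → Maybe Sy → ((Z ⊎ Bool) ⊎ Bool) × Sy × Move
      δ-back b a (just w) = inj₁ (inj₂ b) , w , left
      δ-back b a nothing  = inj₂ b , a , right

    sweep : Mach
    sweep = record
      { State = Z ⊎ Bool ; finite = finite-⊎ Z-finite finite-Bool ; start = inj₁ z₀
      ; δ = λ { (inj₁ z) a → δ-fwd z a (fwd z a) ; (inj₂ b) a → δ-back b a (back a) }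
      ; degree = 1 }

    data Fwd : Z → List Sy → Z → List Sy → Set where
      []  : ∀ {z} → Fwd z [] z []
      _∷_ : ∀ {z x y z′ z″ xs ys} → fwd z x ≡ just (z′ , y) → Fwd z′ xs z″ ys → Fwd z (x ∷ xs) z″ (y ∷ ys)

    Back : List Sy → List Sy → Set
    Back = Pointwise (λ y w → back y ≡ just w)

    module _ (fwd-blank : ∀ z → fwd z blankˢ ≡ nothing) (back-blank : back blankˢ ≡ nothing) where

      private
        back-run : ∀ b c {zs ws} r → Back zs ws →
          Run sweep (inj₂ b) (placeˡ (zs ++ bl c) r) (length zs + 1) b (place (bl true) (ws ʳ++ r))
        back-run b false r []       = exit (cong (δ-back b blankˢ) back-blank)
        back-run b true  r []       = exit (cong (δ-back b blankˢ) back-blank)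
        back-run b c r (_∷_ {x = x} {y = w} eq eqs) = more (cong (δ-back b x) eq) (back-run b c (w ∷ r) eqs)

        turn-run : ∀ z c d {zs ws} → Back zs ws →
          Run sweep (inj₁ z) (place (zs ++ bl c) (bl d)) (suc (length zs + 1)) (answer z) (place (bl true) (ws ʳ++ bl true))
        turn-run z c false bk = more (cong (δ-fwd z blankˢ) (fwd-blank z)) (back-run (answer z) c (bl true) bk)
        turn-run z c true  bk = more (cong (δ-fwd z blankˢ) (fwd-blank z)) (back-run (answer z) c (bl true) bk)

        fwd-run : ∀ d {z xs z′ ys t b τ} l → Fwd z xs z′ ys →
          Run sweep (inj₁ z′) (place (ys ʳ++ l) (bl d)) t b τ →
          Run sweep (inj₁ z) (place l (xs ++ bl d)) (length xs + t) b τ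
        fwd-run d l [] r = r
        fwd-run d {z = z} l (_∷_ {x = x} {y = y} eq fs) r = more (cong (δ-fwd z x) eq) (fwd-run d (y ∷ l) fs r)

        length-Fwd : ∀ {z xs z′ ys} → Fwd z xs z′ ys → length ys ≡ length xs
        length-Fwd []       = refl
        length-Fwd (_ ∷ fs) = cong suc (length-Fwd fs)

      sweep-run : ∀ c d {xs z ys ws} → Fwd z₀ xs z ys → Back ys ws →
        Run sweep (inj₁ z₀) (place (bl c) (xs ++ bl d)) (length xs + suc (length xs + 1)) (answer z)
          (place (bl true) (ws ++ bl true))
      sweep-run c d {xs} {z} {ys} {ws} fs bk = fwd-run d (bl c) fs
        (subst (λ u → Run sweep (inj₁ z) (place u (bl d)) (suc (length xs + 1)) (answer z) (place (bl true) (ws ++ bl true)))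
          (symm (List.ʳ++-defn ys))
          (subst₂ (λ t v → Run sweep (inj₁ z) (place (reverse ys ++ bl c) (bl d)) (suc (t + 1)) (answer z) (place (bl true) v))
            (trans (List.length-reverse ys) (length-Fwd fs))
            (trans (List.ʳ++-defn (reverse ws)) (cong (_++ bl true) (List.reverse-involutive ws)))
            (turn-run z c d (Pointwise.reverse⁺ bk))))

-- Symbol p of a list, 0F (the blank) beyond its end.
nth : List (Fin 4) → ℕ → Fin 4
nth []       p       = zero
nth (x ∷ xs) zero    = x
nth (x ∷ xs) (suc p) = nth xs p

nth-∷ʳ : ∀ xs a p → nth (xs ∷ʳ a) p ≡ (if length xs ≡ᵇ p then a else nth xs p)
nth-∷ʳ []       a zero    = refl
nth-∷ʳ []       a (suc p) = refl
nth-∷ʳ (x ∷ xs) a zero    = refl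
nth-∷ʳ (x ∷ xs) a (suc p) = nth-∷ʳ xs a p

-- The invariant of a pass that evaluates π at the marked cell `v`: the value is known once that
-- cell has been passed.
scan-≡ : ∀ (π : ℕ → Bool) v p → ((v <ᵇ p) ∧ π v) ∨ ((v ≡ᵇ p) ∧ π p) ≡ (v <ᵇ suc p) ∧ π v
scan-≡ π zero    zero    = refl
scan-≡ π zero    (suc p) = Bool.∨-identityʳ (π 0)
scan-≡ π (suc v) zero    = refl
scan-≡ π (suc v) (suc p) = scan-≡ (π ∘ suc) v p

scan-< : ∀ v p → (v <ᵇ p) ∨ (v ≡ᵇ p) ≡ (v <ᵇ suc p)
scan-< zero    zero    = refl
scan-< zero    (suc p) = refl
scan-< (suc v) zero    = refl
scan-< (suc v) (suc p) = scan-< v p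

<ᵇ-not : ∀ u v → (u <ᵇ v) ≡ not (v <ᵇ suc u)
<ᵇ-not zero    zero    = refl
<ᵇ-not zero    (suc v) = refl
<ᵇ-not (suc u) zero    = refl
<ᵇ-not (suc u) (suc v) = <ᵇ-not u v

-- A tape cell carries the input symbol, the deletion mark of a vertex, the
-- output symbol, the output pointer and one mark for each register.
module Cells (R : ℕ) where

  open Finite

  Cell : Set
  Cell = Fin 4 × Bool × Fin 4 × Bool × Vec Bool R

  cell-finite : Finite Cell
  cell-finite = finite-× (finite-Fin 4) (finite-× finite-Bool (finite-× (finite-Fin 4) (finite-× finite-Bool (finite-Vec R finite-Bool))))

  open Machines (size cell-finite) public
  open Mach public

  cell : Cell → Sy
  cell c = 4 ↑ʳ to cell-finite c

  raw : Fin 4 → Sy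
  raw x = x ↑ˡ size cell-finite

  view : Sy → Fin 4 ⊎ Cell
  view a = Sum.map₂ (from cell-finite) (splitAt 4 a)

  view-cell : ∀ c → view (cell c) ≡ inj₂ c
  view-cell c = trans (cong (Sum.map₂ (from cell-finite)) (splitAt-↑ʳ 4 (size cell-finite) (to cell-finite c)))
                      (cong inj₂ (from-to cell-finite c))

  view-raw : ∀ x → view (raw x) ≡ inj₁ x
  view-raw x = cong (Sum.map₂ (from cell-finite)) (splitAt-↑ˡ 4 x (size cell-finite))

  word : ℕ → (ℕ → Cell) → List Sy
  word zero    f = []
  word (suc n) f = cell (f 0) ∷ word n (f ∘ suc)

  length-word : ∀ n f → length (word n f) ≡ n
  length-word zero    f = refl
  length-word (suc n) f = cong suc (length-word n (f ∘ suc))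

  module Pass {Z : Set} (Z-finite : Finite Z) (z₀ : Z) (act : Z → Cell → Z × Cell) (answer : Z → Bool) where

    fwd : Z → Sy → Maybe (Z × Sy)
    fwd z a = [ (λ _ → nothing) , (λ c → just (map₂ cell (act z c))) ]′ (view a)

    back : Sy → Maybe Sy
    back a = [ (λ _ → nothing) , (λ _ → just a) ]′ (view a)

    pass : Mach
    pass = sweep Z-finite z₀ fwd back answer

    fwd-word : ∀ n {f g : ℕ → Cell} (σ : ℕ → Z) → (∀ p → act (σ p) (f p) ≡ (σ (suc p) , g p)) →
      Fwd Z-finite z₀ fwd back answer (σ 0) (word n f) (σ n) (word n g)
    fwd-word zero    σ h = []
    fwd-word (suc n) {f} σ h =
      trans (cong [ (λ _ → nothing) , (λ c → just (map₂ cell (act (σ 0) c))) ]′ (view-cell (f 0))) (cong (just ∘ map₂ cell) (h 0))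
      ∷ fwd-word n (σ ∘ suc) (h ∘ suc)

    back-word : ∀ n g → Back Z-finite z₀ fwd back answer (word n g) (word n g)
    back-word zero    g = []
    back-word (suc n) g = cong [ (λ _ → nothing) , (λ _ → just (cell (g 0))) ]′ (view-cell (g 0)) ∷ back-word n (g ∘ suc)

  record St : Set where
    constructor st
    field
      regs : Vec ℕ R
      dead : ℕ → Bool
      outs : List (Fin 4)

  open St public

  module Simulation (N : ℕ) (inp : ℕ → Fin 4) where

    cellAt : St → ℕ → Cell
    cellAt s p = inp p , dead s p , nth (outs s) p , (length (outs s) ≡ᵇ p) , Vec.map (_≡ᵇ p) (regs s)

    tapeOf : St → Tape
    tapeOf s = place (bl true) (word N (cellAt s) ++ bl true)

    -- Large enough for the N + 1 rounds of a loop, and its square for the 2N + 2 steps of a pass.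
    base : ℕ
    base = 3 + N

    Within : Mach → ℕ → Set
    Within M t = t ≤ base ^ suc (degree M)

    -- A total-correctness triple with a time bound, from and to tapes that represent abstract
    -- states.
    record Ends (M : Mach) (s : St) (Post : Bool → St → Set) : Set where
      constructor ends
      field
        {time}   : ℕ
        {answer} : Bool
        {final}  : St
        fast     : Within M time
        runs     : Run M (start M) (tapeOf s) time answer (tapeOf final)
        post     : Post answer final

    ends-map : ∀ {M s} {P Q : Bool → St → Set} → (∀ b s′ → P b s′ → Q b s′) → Ends M s P → Ends M s Q
    ends-map f (ends fast runs post) = ends fast runs (f _ _ post)

    private
      sum≤product : ∀ a b → 2 ≤ a → 2 ≤ b → a + b ≤ a * b
      sum≤product (suc (suc a)) (suc (suc b)) _ _ = ≤-trans (m≤m+n _ (a * b + (a + b))) (≤-reflexive (eq a b))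
        where
        eq : ∀ a b → suc (suc a) + suc (suc b) + (a * b + (a + b)) ≡ suc (suc a) * suc (suc b)
        eq = solve-∀
      sum≤product (suc zero) _ (s≤s ()) _
      sum≤product (suc (suc _)) (suc zero) _ (s≤s ())

      2≤base^ : ∀ d → 2 ≤ base ^ suc d
      2≤base^ d = ≤-trans (s≤s (s≤s z≤n)) (≤-trans (≤-reflexive (symm (*-identityʳ base))) (^-monoʳ-≤ base {1} {suc d} (s≤s z≤n)))

      within-cond : ∀ d e f {t t′} → t ≤ base ^ suc d → t′ ≤ base ^ suc e → e ≤ f → t + t′ ≤ base ^ suc (suc (d + f))
      within-cond d e f h h′ e≤f = ≤-trans (+-mono-≤ h (≤-trans h′ (^-monoʳ-≤ base (s≤s e≤f))))
        (≤-trans (sum≤product _ _ (2≤base^ d) (2≤base^ f))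
          (≤-reflexive (trans (symm (^-distribˡ-+-* base (suc d) (suc f))) (cong (base ^_) (cong suc (+-suc d f))))))

    ret-ends : ∀ b s → Ends (ret b) s (λ b′ s′ → b′ ≡ b × s′ ≡ s)
    ret-ends b s = ends (≤-trans (s≤s z≤n) (2≤base^ 0)) (stay-run (word N (cellAt s) ++ bl true)) (refl , refl)
      where
      stay-run : ∀ r → Run (ret b) tt (place (bl true) r) 1 b (place (bl true) r)
      stay-run []      = exit refl
      stay-run (_ ∷ _) = exit refl

    cond-ends : ∀ {M s P Q} M₁ M₂ → Ends M s P → (∀ b s′ → P b s′ → Ends (branch b M₁ M₂) s′ Q) → Ends (cond M M₁ M₂) s Q
    cond-ends {M} M₁ M₂ (ends {answer = true} fast runs post) h with h true _ post
    ... | ends fast′ runs′ post′ = ends (within-cond (degree M) (degree M₁) _ fast fast′ (m≤m+n _ _)) (cond-run runs runs′) post′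
    cond-ends {M} M₁ M₂ (ends {answer = false} fast runs post) h with h false _ post
    ... | ends fast′ runs′ post′ = ends (within-cond (degree M) (degree M₂) _ fast fast′ (m≤n+m _ _)) (cond-run runs runs′) post′

    loop-ends : ∀ {M} (Inv : ℕ → St → Set) (Done : St → Set) →
      (∀ i s → i < N → Inv i s → Ends M s (λ b s′ → b ≡ true × Inv (suc i) s′)) →
      (∀ s → Inv N s → Ends M s (λ b s′ → b ≡ false × Done s′)) →
      ∀ s → Inv 0 s → Ends (loop M) s (λ b s′ → Done s′)
    loop-ends {M} Inv Done body last s inv = finish (go N 0 s (+-identityʳ N) inv)
      where
      c : ℕ
      c = base ^ suc (degree M)
      Result : ℕ → St → Set
      Result j s = ∃ λ t → ∃ λ s′ → t ≤ suc j * c × Run (loop M) (start M) (tapeOf s) t true (tapeOf s′) × Done s′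
      go : ∀ j i s → j + i ≡ N → Inv i s → Result j s
      go zero i s refl inv with last s inv
      ... | ends fast runs (refl , done) = _ , _ , ≤-trans fast (≤-reflexive (symm (+-identityʳ c))) , loop-stop runs , done
      go (suc j) i s eq inv with body i s (≤-trans (s≤s (m≤n+m i j)) (≤-reflexive eq)) inv
      ... | ends fast runs (refl , inv′) =
        let (t , s′ , le , run′ , done) = go j (suc i) _ (trans (+-suc j i) eq) inv′
        in _ , s′ , +-mono-≤ fast le , loop-again runs run′ , done
      finish : Result N s → Ends (loop M) s (λ b s′ → Done s′)
      finish (t , s′ , le , r , done) = ends (≤-trans le (*-monoˡ-≤ c (s≤s (m≤n+m N 2)))) r done

    module _ {Z : Set} (Z-finite : Finite Z) (act : Z → Cell → Z × Cell) (answer : Z → Bool) (σ : ℕ → Z) where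

      open Pass Z-finite (σ 0) act answer

      pass-ends : ∀ s s′ → (∀ p → act (σ p) (cellAt s p) ≡ (σ (suc p) , cellAt s′ p)) →
        Ends pass s (λ b s″ → b ≡ answer (σ N) × s″ ≡ s′)
      pass-ends s s′ h = ends fast
        (sweep-run Z-finite (σ 0) fwd back answer (λ _ → refl) refl true true (fwd-word N σ h) (back-word N (cellAt s′))) (refl , refl)
        where
        eq : ∀ n → n + suc (n + 1) + (n * n + (4 * n + 7)) ≡ (3 + n) * ((3 + n) * 1)
        eq = solve-∀
        fast : length (word N (cellAt s)) + suc (length (word N (cellAt s)) + 1) ≤ base ^ 2
        fast rewrite length-word N (cellAt s) = ≤-trans (m≤m+n _ _) (≤-reflexive (eq N))

  -- The pass state carries a mark to the next cell. `incA` thus shifts the mark right, over the end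
  -- of the tape if need be; `zeroA` starts with a mark in hand and leaves it in the first cell.
  zeroA incA : Fin R → Bool → Cell → Bool × Cell
  zeroA r first (i , d , o , q , m) = false , i , d , o , q , m [ r ]≔ first
  incA r carry (i , d , o , q , m) = lookup m r , i , d , o , q , m [ r ]≔ carry

  killA : Fin R → ⊤ → Cell → ⊤ × Cell
  killA r _ (i , d , o , q , m) = tt , i , d ∨ lookup m r , o , q , m

  -- The state records whether the mark of `s` has appeared, and the verdict. The current cell
  -- counts as seen before `r` is examined, which makes the comparison strict.
  ltA : Fin R → Fin R → Bool × Bool → Cell → (Bool × Bool) × Cell
  ltA r s (a , b) (i , d , o , q , m) = (a ∨ lookup m s , b ∨ (lookup m r ∧ not (a ∨ lookup m s))) , i , d , o , q , m

  readA : (Fin 4 → Bool → Bool) → Fin R → Bool → Cell → Bool × Cell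
  readA π r b (i , d , o , q , m) = b ∨ (lookup m r ∧ π i d) , i , d , o , q , m

  emitA : Fin 4 → Bool → Cell → Bool × Cell
  emitA a carry (i , d , o , q , m) = q , i , d , (if q then a else o) , carry , m

  zeroM incM killM : Fin R → Mach
  zeroM r = Pass.pass finite-Bool true (zeroA r) (λ _ → true)
  incM r = Pass.pass finite-Bool false (incA r) (λ _ → true)
  killM r = Pass.pass finite-⊤ tt (killA r) (λ _ → true)

  ltM : Fin R → Fin R → Mach
  ltM r s = Pass.pass (finite-× finite-Bool finite-Bool) (false , false) (ltA r s) proj₂

  readM : (Fin 4 → Bool → Bool) → Fin R → Mach
  readM π r = Pass.pass finite-Bool false (readA π r) id

  emitM : Fin 4 → Mach
  emitM a = Pass.pass finite-Bool false (emitA a) (λ _ → true)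

  module Primitives (N : ℕ) (inp : ℕ → Fin 4) where

    open Simulation N inp

    setReg : Fin R → ℕ → St → St
    setReg r v s = st (regs s [ r ]≔ v) (dead s) (outs s)

    get : St → Fin R → ℕ
    get s r = lookup (regs s) r

    zero-ends : ∀ r s → Ends (zeroM r) s (λ b s′ → b ≡ true × s′ ≡ setReg r 0 s)
    zero-ends r s = pass-ends finite-Bool (zeroA r) (λ _ → true) (0 ≡ᵇ_) s (setReg r 0 s) λ p →
      cong (λ m → false , inp p , dead s p , nth (outs s) p , (length (outs s) ≡ᵇ p) , m) (symm (Vec.map-[]≔ (_≡ᵇ p) (regs s) r))

    inc-ends : ∀ r s → Ends (incM r) s (λ b s′ → b ≡ true × s′ ≡ setReg r (suc (get s r)) s)
    inc-ends r s = pass-ends finite-Bool (incA r) (λ _ → true) (suc (get s r) ≡ᵇ_) s (setReg r (suc (get s r)) s) λ p →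
      cong₂ (λ c m → c , inp p , dead s p , nth (outs s) p , (length (outs s) ≡ᵇ p) , m)
        (Vec.lookup-map r (_≡ᵇ p) (regs s)) (symm (Vec.map-[]≔ (_≡ᵇ p) (regs s) r))

    kill-ends : ∀ r s → Ends (killM r) s (λ b s′ → b ≡ true × s′ ≡ st (regs s) (λ p → dead s p ∨ (get s r ≡ᵇ p)) (outs s))
    kill-ends r s = pass-ends finite-⊤ (killA r) (λ _ → true) (λ _ → tt) s (st (regs s) (λ p → dead s p ∨ (get s r ≡ᵇ p)) (outs s)) λ p →
      cong (λ c → tt , inp p , dead s p ∨ c , nth (outs s) p , (length (outs s) ≡ᵇ p) , Vec.map (_≡ᵇ p) (regs s))
        (Vec.lookup-map r (_≡ᵇ p) (regs s))

    lt-ends : ∀ r q s → Ends (ltM r q) s (λ b s′ → b ≡ (get s r <ᵇ N) ∧ (get s r <ᵇ get s q) × s′ ≡ s)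
    lt-ends r q s = pass-ends (finite-× finite-Bool finite-Bool) (ltA r q) proj₂ (λ p → (get s q <ᵇ p) , (get s r <ᵇ p) ∧ (get s r <ᵇ get s q)) s s λ p →
      cong (λ z → z , cellAt s p) (cong₂ _,_ (seen p)
        (trans (cong₂ (λ x y → ((get s r <ᵇ p) ∧ (get s r <ᵇ get s q)) ∨ (x ∧ not y)) (Vec.lookup-map r (_≡ᵇ p) (regs s)) (seen p))
        (trans (cong (λ x → ((get s r <ᵇ p) ∧ x) ∨ ((get s r ≡ᵇ p) ∧ not (get s q <ᵇ suc p))) (<ᵇ-not (get s r) (get s q)))
        (trans (scan-≡ (λ u → not (get s q <ᵇ suc u)) (get s r) p)
               (cong ((get s r <ᵇ suc p) ∧_) (symm (<ᵇ-not (get s r) (get s q))))))))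
      where
      seen : ∀ p → (get s q <ᵇ p) ∨ lookup (Vec.map (_≡ᵇ p) (regs s)) q ≡ (get s q <ᵇ suc p)
      seen p = trans (cong ((get s q <ᵇ p) ∨_) (Vec.lookup-map q (_≡ᵇ p) (regs s))) (scan-< (get s q) p)

    read-ends : ∀ π r s → Ends (readM π r) s (λ b s′ → b ≡ (get s r <ᵇ N) ∧ π (inp (get s r)) (dead s (get s r)) × s′ ≡ s)
    read-ends π r s = pass-ends finite-Bool (readA π r) id (λ p → (get s r <ᵇ p) ∧ ρ (get s r)) s s λ p →
      cong (λ z → z , cellAt s p)
        (trans (cong (λ x → ((get s r <ᵇ p) ∧ ρ (get s r)) ∨ (x ∧ ρ p)) (Vec.lookup-map r (_≡ᵇ p) (regs s))) (scan-≡ ρ (get s r) p))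
      where
      ρ : ℕ → Bool
      ρ p = π (inp p) (dead s p)

    emit-ends : ∀ a s → Ends (emitM a) s (λ b s′ → b ≡ true × s′ ≡ st (regs s) (dead s) (outs s ∷ʳ a))
    emit-ends a s = pass-ends finite-Bool (emitA a) (λ _ → true) (suc (length (outs s)) ≡ᵇ_) s (st (regs s) (dead s) (outs s ∷ʳ a)) λ p →
      cong₂ (λ o c → (length (outs s) ≡ᵇ p) , inp p , dead s p , o , c , Vec.map (_≡ᵇ p) (regs s))
        (symm (nth-∷ʳ (outs s) a p))
        (cong (_≡ᵇ p) (symm (trans (List.length-++ (outs s)) (+-comm (length (outs s)) 1))))

-- A programming language for Turing machines

infixl 6 _+ᵗ_
infix  5 _<ᵗ_ _<ᵛ_
infixr 4 _andᵇ_
infix  3 _?ᵗ_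
infixr 2 _⍮_

-- Variables range over tape positions; sumᵗ adds over all positions.
mutual
  data Tm (n : ℕ) : Set where
    zeroᵗ oneᵗ : Tm n
    _+ᵗ_       : Tm n → Tm n → Tm n
    sumᵗ       : Tm (suc n) → Tm n
    _?ᵗ_       : Fm n → Tm n → Tm n

  data Fm (n : ℕ) : Set where
    _<ᵗ_  : Tm n → Tm n → Fm n
    _<ᵛ_  : Fin n → Fin n → Fm n
    symᵇ  : Fin n → Fin 4 → Fm n
    deadᵇ : Fin n → Fm n
    notᵇ  : Fm n → Fm n
    _andᵇ_ : Fm n → Fm n → Fm n

data Cmd (n : ℕ) : Set where
  skipᶜ : Cmd n
  _⍮_   : Cmd n → Cmd n → Cmd n
  forᶜ  : Cmd (suc n) → Cmd n
  repeatᶜ : Cmd n → Cmd n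
  ifᶜ   : Fm n → Cmd n → Cmd n → Cmd n
  killᶜ : Fin n → Cmd n
  emitᶜ : Fin 4 → Cmd n

iterate : {D : Set} → ℕ → (ℕ → D → D) → D → D
iterate zero    f x = x
iterate (suc n) f x = f n (iterate n f x)

Store : Set
Store = (ℕ → Bool) × List (Fin 4)

-- Comparisons hold only below N: values from N on leave no mark on the tape.
module Meaning (N : ℕ) (inp : ℕ → Fin 4) where

  mutual
    tm : ∀ {n} → Tm n → (ℕ → Bool) → Vec ℕ n → ℕ
    tm zeroᵗ    D ρ = 0
    tm oneᵗ     D ρ = 1
    tm (t +ᵗ u) D ρ = tm t D ρ + tm u D ρ
    tm (sumᵗ t) D ρ = sum N (λ x → tm t D (x ∷ ρ))
    tm (φ ?ᵗ t) D ρ = if fm φ D ρ then tm t D ρ else 0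

    fm : ∀ {n} → Fm n → (ℕ → Bool) → Vec ℕ n → Bool
    fm (t <ᵗ u)   D ρ = (tm t D ρ <ᵇ N) ∧ (tm t D ρ <ᵇ tm u D ρ)
    fm (i <ᵛ j)   D ρ = (lookup ρ i <ᵇ N) ∧ (lookup ρ i <ᵇ lookup ρ j)
    fm (symᵇ i a) D ρ = (lookup ρ i <ᵇ N) ∧ does (inp (lookup ρ i) Fin.≟ a)
    fm (deadᵇ i)  D ρ = (lookup ρ i <ᵇ N) ∧ D (lookup ρ i)
    fm (notᵇ φ)   D ρ = not (fm φ D ρ)
    fm (φ andᵇ ψ) D ρ = fm φ D ρ ∧ fm ψ D ρ

  exec : ∀ {n} → Cmd n → Vec ℕ n → Store → Store
  exec skipᶜ       ρ σ = σ
  exec (c ⍮ c′)    ρ σ = exec c′ ρ (exec c ρ σ)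
  exec (forᶜ c)    ρ σ = iterate N (λ x → exec c (x ∷ ρ)) σ
  exec (repeatᶜ c) ρ σ = iterate N (λ _ → exec c ρ) σ
  exec (ifᶜ φ c d) ρ σ = if fm φ (proj₁ σ) ρ then exec c ρ σ else exec d ρ σ
  exec (killᶜ i)   ρ (D , o) = (λ p → D p ∨ (lookup ρ i ≡ᵇ p)) , o
  exec (emitᶜ a)   ρ (D , o) = D , o ∷ʳ a

mutual
  needᵗ : ∀ {n} → Tm n → ℕ
  needᵗ zeroᵗ    = 0
  needᵗ oneᵗ     = 0
  needᵗ (t +ᵗ u) = needᵗ t ⊔ needᵗ u
  needᵗ (sumᵗ t) = suc (needᵗ t)
  needᵗ (φ ?ᵗ t) = needᶠ φ ⊔ needᵗ t

  needᶠ : ∀ {n} → Fm n → ℕ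
  needᶠ (t <ᵗ u)   = 2 + (needᵗ t ⊔ needᵗ u)
  needᶠ (i <ᵛ j)   = 0
  needᶠ (symᵇ i a) = 0
  needᶠ (deadᵇ i)  = 0
  needᶠ (notᵇ φ)   = needᶠ φ
  needᶠ (φ andᵇ ψ) = needᶠ φ ⊔ needᶠ ψ

needᶜ : ∀ {n} → Cmd n → ℕ
needᶜ skipᶜ       = 0
needᶜ (c ⍮ d)     = needᶜ c ⊔ needᶜ d
needᶜ (forᶜ c)    = suc (needᶜ c)
needᶜ (repeatᶜ c) = suc (needᶜ c)
needᶜ (ifᶜ φ c d) = needᶠ φ ⊔ (needᶜ c ⊔ needᶜ d)
needᶜ (killᶜ i)   = 0
needᶜ (emitᶜ a)   = 0

-- Compilation of programs into machines

module Compile (R : ℕ) where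

  open Cells R

  seqM : Mach → Mach → Mach
  seqM A B = cond A B B

  -- The loop counter is a register, and the loop ends when its mark has left the tape, that is,
  -- after N rounds.
  forM : Fin R → Mach → Mach
  forM r B = seqM (zeroM r) (loop (cond (readM (λ _ _ → true) r) (seqM B (incM r)) (ret false)))

  -- Registers below d are free; fewer free registers than needᵗ, needᶠ or
  -- needᶜ ask for give a meaningless machine.
  mutual
    compileᵗ : ∀ {n} → Tm n → Vec (Fin R) n → Fin R → (d : ℕ) → d ≤ R → Mach
    compileᵗ zeroᵗ    η a d le = ret true
    compileᵗ oneᵗ     η a d le = incM a
    compileᵗ (t +ᵗ u) η a d le = seqM (compileᵗ t η a d le) (compileᵗ u η a d le)
    compileᵗ (sumᵗ t) η a zero le = ret true
    compileᵗ (sumᵗ t) η a (suc d) le = forM (fromℕ< le) (compileᵗ t (fromℕ< le ∷ η) a d (<⇒≤ le))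
    compileᵗ (φ ?ᵗ t) η a d le = cond (compileᶠ φ η d le) (compileᵗ t η a d le) (ret true)

    compileᶠ : ∀ {n} → Fm n → Vec (Fin R) n → (d : ℕ) → d ≤ R → Mach
    compileᶠ (t <ᵗ u) η (suc (suc d)) le =
      seqM (zeroM r) (seqM (zeroM q) (seqM (compileᵗ t η r d le′) (seqM (compileᵗ u η q d le′) (ltM r q))))
      where
      le′ = <⇒≤ (<⇒≤ le)
      r = fromℕ< le
      q = fromℕ< (<⇒≤ le)
    compileᶠ (t <ᵗ u) η _ le = ret true
    compileᶠ (i <ᵛ j)   η d le = ltM (lookup η i) (lookup η j)
    compileᶠ (symᵇ i a) η d le = readM (λ x _ → does (x Fin.≟ a)) (lookup η i)
    compileᶠ (deadᵇ i)  η d le = readM (λ _ b → b) (lookup η i)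
    compileᶠ (notᵇ φ)   η d le = cond (compileᶠ φ η d le) (ret false) (ret true)
    compileᶠ (φ andᵇ ψ) η d le = cond (compileᶠ φ η d le) (compileᶠ ψ η d le) (ret false)

  compileᶜ : ∀ {n} → Cmd n → Vec (Fin R) n → (d : ℕ) → d ≤ R → Mach
  compileᶜ skipᶜ       η d le = ret true
  compileᶜ (c ⍮ c′)    η d le = seqM (compileᶜ c η d le) (compileᶜ c′ η d le)
  compileᶜ (forᶜ c)    η zero le = ret true
  compileᶜ (forᶜ c)    η (suc d) le = forM (fromℕ< le) (compileᶜ c (fromℕ< le ∷ η) d (<⇒≤ le))
  compileᶜ (repeatᶜ c) η zero le = ret true
  compileᶜ (repeatᶜ c) η (suc d) le = forM (fromℕ< le) (compileᶜ c η d (<⇒≤ le))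
  compileᶜ (ifᶜ φ c e) η d le = cond (compileᶠ φ η d le) (compileᶜ c η d le) (compileᶜ e η d le)
  compileᶜ (killᶜ i)   η d le = killM (lookup η i)
  compileᶜ (emitᶜ a)   η d le = emitM a

  module Correct (N : ℕ) (inp : ℕ → Fin 4) where

    open Simulation N inp
    open Primitives N inp
    open Meaning N inp

    seq-ends : ∀ {A B s P Q} → Ends A s P → (∀ b s′ → P b s′ → Ends B s′ Q) → Ends (seqM A B) s Q
    seq-ends {B = B} {Q = Q} e h = cond-ends B B e go
      where
      go : ∀ b s′ → _ → Ends (branch b B B) s′ Q
      go true  = h true
      go false = h false

    for-ends : ∀ {r B} (Inv : ℕ → St → Set) → (∀ i s → Inv i s → get s r ≡ i) →
      (∀ i s → i < N → Inv i s → Ends B s (λ _ s′ → Inv (suc i) (setReg r (suc (get s′ r)) s′))) →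
      ∀ s → Inv 0 (setReg r 0 s) → Ends (forM r B) s (λ _ s′ → Inv N s′)
    for-ends {r} {B} Inv reg body s inv = seq-ends (zero-ends r s) λ { _ _ (_ , refl) →
        loop-ends Inv (Inv N) iteration last (setReg r 0 s) inv }
      where
      iteration : ∀ i s → i < N → Inv i s →
        Ends (cond (readM (λ _ _ → true) r) (seqM B (incM r)) (ret false)) s (λ b s′ → b ≡ true × Inv (suc i) s′)
      iteration i s i<N inv = cond-ends (seqM B (incM r)) (ret false) (read-ends (λ _ _ → true) r s) go
        where
        inside : (get s r <ᵇ N) ∧ true ≡ true
        inside rewrite reg i s inv with i <ᵇ N | <⇒<ᵇ i<N
        ... | true | _ = refl
        go : ∀ b s′ → b ≡ (get s r <ᵇ N) ∧ true × s′ ≡ s →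
          Ends (branch b (seqM B (incM r)) (ret false)) s′ (λ b s′ → b ≡ true × Inv (suc i) s′)
        go true  _ (_ , refl) = seq-ends (body i s i<N inv) λ _ s′ inv′ →
          ends-map (λ { _ _ (eq , refl) → eq , inv′ }) (inc-ends r s′)
        go false _ (eq , _) with () ← trans eq inside
      last : ∀ s → Inv N s → Ends (cond (readM (λ _ _ → true) r) (seqM B (incM r)) (ret false)) s (λ b s′ → b ≡ false × Inv N s′)
      last s inv = cond-ends (seqM B (incM r)) (ret false) (read-ends (λ _ _ → true) r s) go
        where
        outside : (get s r <ᵇ N) ∧ true ≡ false
        outside rewrite reg N s inv = trans (Bool.∧-identityʳ _) (n≮ᵇn N)
          where
          n≮ᵇn : ∀ m → (m <ᵇ m) ≡ false
          n≮ᵇn zero    = refl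
          n≮ᵇn (suc m) = n≮ᵇn m
        go : ∀ b s′ → b ≡ (get s r <ᵇ N) ∧ true × s′ ≡ s →
          Ends (branch b (seqM B (incM r)) (ret false)) s′ (λ b s′ → b ≡ false × Inv N s′)
        go false _ (_ , refl) = ends-map (λ { _ _ (eq , refl) → eq , inv }) (ret-ends false s)
        go true _ (eq , _) with () ← trans (symm outside) (symm eq)

    record Keep (P : Fin R → Set) (s s′ : St) : Set where
      constructor keep
      field
        dead≡ : dead s′ ≡ dead s
        outs≡ : outs s′ ≡ outs s
        regs≡ : ∀ r → P r → get s′ r ≡ get s r

    open Keep

    keep-refl : ∀ {P s} → Keep P s s
    keep-refl = keep refl refl (λ _ _ → refl)

    keep-trans : ∀ {P Q O s s′ s″} → (∀ r → O r → P r × Q r) → Keep P s s′ → Keep Q s′ s″ → Keep O s s″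
    keep-trans sub (keep d o r) (keep d′ o′ r′) = keep (trans d′ d) (trans o′ o)
      λ q oq → trans (r′ q (proj₂ (sub q oq))) (r q (proj₁ (sub q oq)))

    get-same : ∀ r v s → get (setReg r v s) r ≡ v
    get-same r v s = Vec.lookup∘update r (regs s) v

    get-other : ∀ {r q} v s → q ≢ r → get (setReg r v s) q ≡ get s q
    get-other v s ne = Vec.lookup∘update′ ne (regs s) v

    set-keep : ∀ r v s → Keep (_≢ r) s (setReg r v s)
    set-keep r v s = keep refl refl (λ q ne → get-other v s ne)

    Env : ∀ {n} → St → Vec (Fin R) n → Vec ℕ n → Set
    Env s η ρ = ∀ i → get s (lookup η i) ≡ lookup ρ i

    Above : ∀ {n} → ℕ → Vec (Fin R) n → Set
    Above d η = ∀ i → d ≤ toℕ (lookup η i)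

    above≢ : ∀ {d} (le : d < R) r → d < toℕ r → r ≢ fromℕ< le
    above≢ le r lt refl = <-irrefl refl (≤-trans lt (≤-reflexive (toℕ-fromℕ< le)))

    mutual
      -- A term adds its value to the register `a`, so addition is sequencing and a sum is a loop
      -- over one accumulator. Registers below `d` may be overwritten, those from `d` on are kept,
      -- except `a`.
      compileᵗ-ends : ∀ {n} (t : Tm n) η a d le ρ s → needᵗ t ≤ d → Env s η ρ → Above d η → (∀ i → lookup η i ≢ a) → d ≤ toℕ a →
        Ends (compileᵗ t η a d le) s (λ _ s′ → Keep (λ r → d ≤ toℕ r × r ≢ a) s s′ × get s′ a ≡ get s a + tm t (dead s) ρ)
      compileᵗ-ends zeroᵗ η a d le ρ s _ env ab ηa da =
        ends-map (λ { _ _ (_ , refl) → keep-refl , symm (+-identityʳ _) }) (ret-ends true s)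
      compileᵗ-ends oneᵗ η a d le ρ s _ env ab ηa da =
        ends-map (λ { _ _ (_ , refl) → keep refl refl (λ r (_ , ne) → get-other _ s ne)
                                       , trans (get-same a _ s) (+-comm 1 (get s a)) }) (inc-ends a s)
      compileᵗ-ends (t +ᵗ u) η a d le ρ s nd env ab ηa da =
        seq-ends (compileᵗ-ends t η a d le ρ s (m⊔n≤o⇒m≤o _ _ nd) env ab ηa da) λ _ s′ (k , e) →
        ends-map (λ _ s″ (k′ , e′) → keep-trans (λ _ p → p , p) k k′ ,
            trans e′ (trans (cong₂ _+_ e (cong (λ D → tm u D ρ) (dead≡ k))) (+-assoc (get s a) _ _)))
          (compileᵗ-ends u η a d le ρ s′ (m⊔n≤o⇒n≤o _ _ nd)
            (λ i → trans (regs≡ k _ (ab i , ηa i)) (env i)) ab ηa da)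
      compileᵗ-ends (sumᵗ t) η a (suc d) le ρ s (s≤s nd) env ab ηa da =
        ends-map (λ _ s′ (k , _ , e) → k , e) (for-ends Inv (λ _ _ → proj₁ ∘ proj₂) body s
          (keep refl refl (λ q (lt , _) → get-other 0 s (above≢ le q lt)) , get-same r 0 s ,
           trans (get-other 0 s (above≢ le a da)) (symm (+-identityʳ _))))
        where
        r : Fin R
        r = fromℕ< le
        f : ℕ → ℕ
        f x = tm t (dead s) (x ∷ ρ)
        Inv : ℕ → St → Set
        Inv i s′ = Keep (λ q → suc d ≤ toℕ q × q ≢ a) s s′ × get s′ r ≡ i × get s′ a ≡ get s a + sum i f
        r≢a : r ≢ a
        r≢a e = above≢ le a da (symm e)
        d≤r : d ≤ toℕ r
        d≤r = ≤-reflexive (symm (toℕ-fromℕ< le))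
        body : ∀ i s′ → i < N → Inv i s′ → Ends _ s′ (λ _ s″ → Inv (suc i) (setReg r (suc (get s″ r)) s″))
        body i s′ _ (k , ei , ea) = ends-map next′
          (compileᵗ-ends t (r ∷ η) a d (<⇒≤ le) (i ∷ ρ) s′ nd
            (λ { zero → ei ; (suc j) → trans (regs≡ k _ (ab j , ηa j)) (env j) })
            (λ { zero → d≤r ; (suc j) → <⇒≤ (ab j) })
            (λ { zero → r≢a ; (suc j) → ηa j }) (<⇒≤ da))
          where
          next′ : ∀ b s″ → Keep (λ q → d ≤ toℕ q × q ≢ a) s′ s″ × get s″ a ≡ get s′ a + tm t (dead s′) (i ∷ ρ) →
            Inv (suc i) (setReg r (suc (get s″ r)) s″)
          next′ _ s″ (k′ , e′) =
            keep-trans (λ q (lt , ne) → (lt , ne) , above≢ le q lt)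
              (keep-trans (λ q (lt , ne) → (lt , ne) , (<⇒≤ lt , ne)) k k′) (set-keep r (suc (get s″ r)) s″)
            , trans (get-same r _ s″) (cong suc (trans (regs≡ k′ r (d≤r , r≢a)) ei))
            , trans (get-other _ s″ (above≢ le a da))
                (trans e′ (trans (cong₂ _+_ ea (cong (λ D → tm t D (i ∷ ρ)) (dead≡ k)))
                  (trans (+-assoc (get s a) _ _) (cong (get s a +_) (+-comm (sum i f) (f i))))))
      compileᵗ-ends (φ ?ᵗ t) η a d le ρ s nd env ab ηa da =
        cond-ends (compileᵗ t η a d le) (ret true) (compileᶠ-ends φ η d le ρ s (m⊔n≤o⇒m≤o _ _ nd) env ab) go
        where
        go : ∀ b s′ → Keep (λ r → d ≤ toℕ r) s s′ × b ≡ fm φ (dead s) ρ →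
          Ends (branch b (compileᵗ t η a d le) (ret true)) s′
            (λ _ s″ → Keep (λ r → d ≤ toℕ r × r ≢ a) s s″ × get s″ a ≡ get s a + tm (φ ?ᵗ t) (dead s) ρ)
        go true s′ (k , eq) rewrite symm eq = ends-map
          (λ _ s″ (k′ , e) → keep-trans (λ r p → proj₁ p , p) k k′ ,
             trans e (cong₂ _+_ (regs≡ k a da) (cong (λ D → tm t D ρ) (dead≡ k))))
          (compileᵗ-ends t η a d le ρ s′ (m⊔n≤o⇒n≤o _ _ nd) (λ i → trans (regs≡ k _ (ab i)) (env i)) ab ηa da)
        go false s′ (k , eq) rewrite symm eq = ends-map
          (λ { _ _ (_ , refl) → keep-trans (λ r p → proj₁ p , p) k (keep-refl {P = λ r → d ≤ toℕ r × r ≢ a}) ,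
             trans (regs≡ k a da) (symm (+-identityʳ _)) }) (ret-ends true s′)

      compileᶠ-ends : ∀ {n} (φ : Fm n) η d le ρ s → needᶠ φ ≤ d → Env s η ρ → Above d η →
        Ends (compileᶠ φ η d le) s (λ b s′ → Keep (λ r → d ≤ toℕ r) s s′ × b ≡ fm φ (dead s) ρ)
      compileᶠ-ends (t <ᵗ u) η (suc (suc d)) le ρ s (s≤s (s≤s nd)) env ab =
        seq-ends (zero-ends r s) λ { _ _ (_ , refl) →
        seq-ends (zero-ends q s₁) λ { _ _ (_ , refl) →
        seq-ends (compileᵗ-ends t η r d _ ρ s₂ (m⊔n≤o⇒m≤o _ _ nd) (env₂ k₂) ab′ ηr d≤r) λ { _ s₃ (k₃ , e₃) →
        let k = keep-trans {O = λ x → 2 + d ≤ toℕ x} (λ x lt → lt , (≤-trans (m≤n+m d 2) lt , above≢ le x lt)) k₂ k₃ in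
        seq-ends (compileᵗ-ends u η q d _ ρ s₃ (m⊔n≤o⇒n≤o _ _ nd) (env₂ k) ab′ ηq d≤q) λ { _ s₄ (k₄ , e₄) →
        ends-map (λ { b _ (eq , refl) →
            keep-trans (λ x lt → lt , (≤-trans (m≤n+m d 2) lt , above≢ (<⇒≤ le) x (<⇒≤ lt))) k k₄
            , trans eq (cong₂ (λ x y → (x <ᵇ N) ∧ (x <ᵇ y))
                (trans (regs≡ k₄ r (d≤r , q≢r ∘ symm)) (trans e₃ (cong₂ _+_ zero-r refl)))
                (trans e₄ (cong₂ _+_ (trans (regs≡ k₃ q (d≤q , q≢r)) (get-same q 0 s₁)) (cong (λ D → tm u D ρ) (dead≡ k))))) })
          (lt-ends r q s₄) }}}}
        where
        r = fromℕ< le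
        q = fromℕ< (<⇒≤ le)
        s₁ = setReg r 0 s
        s₂ = setReg q 0 s₁
        toℕ-r : toℕ r ≡ suc d
        toℕ-r = toℕ-fromℕ< le
        toℕ-q : toℕ q ≡ d
        toℕ-q = toℕ-fromℕ< (<⇒≤ le)
        d≤r = ≤-trans (n≤1+n d) (≤-reflexive (symm toℕ-r))
        d≤q = ≤-reflexive (symm toℕ-q)
        q≢r : q ≢ r
        q≢r e = <-irrefl (trans (symm toℕ-q) (trans (cong toℕ e) toℕ-r)) ≤-refl
        zero-r : get s₂ r ≡ 0
        zero-r = trans (get-other 0 s₁ (q≢r ∘ symm)) (get-same r 0 s)
        k₂ : Keep (λ x → 2 + d ≤ toℕ x) s s₂
        k₂ = keep-trans (λ x lt → above≢ le x lt , above≢ (<⇒≤ le) x (<⇒≤ lt)) (set-keep r 0 s) (set-keep q 0 s₁)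
        env₂ : ∀ {s′} → Keep (λ x → 2 + d ≤ toℕ x) s s′ → Env s′ η ρ
        env₂ k i = trans (regs≡ k _ (ab i)) (env i)
        ab′ : Above d η
        ab′ i = ≤-trans (m≤n+m d 2) (ab i)
        ηr : ∀ i → lookup η i ≢ r
        ηr i = above≢ le _ (ab i)
        ηq : ∀ i → lookup η i ≢ q
        ηq i = above≢ (<⇒≤ le) _ (<⇒≤ (ab i))
      compileᶠ-ends (i <ᵛ j) η d le ρ s _ env ab =
        ends-map (λ { b _ (eq , refl) → keep-refl , trans eq (cong₂ (λ x y → (x <ᵇ N) ∧ (x <ᵇ y)) (env i) (env j)) })
          (lt-ends (lookup η i) (lookup η j) s)
      compileᶠ-ends (symᵇ i a) η d le ρ s _ env ab =
        ends-map (λ { b _ (eq , refl) → keep-refl , trans eq (cong (λ x → (x <ᵇ N) ∧ does (inp x Fin.≟ a)) (env i)) })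
          (read-ends (λ x _ → does (x Fin.≟ a)) (lookup η i) s)
      compileᶠ-ends (deadᵇ i) η d le ρ s _ env ab =
        ends-map (λ { b _ (eq , refl) → keep-refl , trans eq (cong (λ x → (x <ᵇ N) ∧ dead s x) (env i)) })
          (read-ends (λ _ b → b) (lookup η i) s)
      compileᶠ-ends (notᵇ φ) η d le ρ s nd env ab = cond-ends (ret false) (ret true) (compileᶠ-ends φ η d le ρ s nd env ab) go
        where
        go : ∀ b s′ → Keep (λ r → d ≤ toℕ r) s s′ × b ≡ fm φ (dead s) ρ →
          Ends (branch b (ret false) (ret true)) s′ (λ b s″ → Keep (λ r → d ≤ toℕ r) s s″ × b ≡ not (fm φ (dead s) ρ))
        go true  s′ (k , eq) = ends-map (λ { _ _ (e , refl) → k , trans e (cong not eq) }) (ret-ends false s′)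
        go false s′ (k , eq) = ends-map (λ { _ _ (e , refl) → k , trans e (cong not eq) }) (ret-ends true s′)
      compileᶠ-ends (φ andᵇ ψ) η d le ρ s nd env ab = cond-ends (compileᶠ ψ η d le) (ret false) (compileᶠ-ends φ η d le ρ s (m⊔n≤o⇒m≤o _ _ nd) env ab) go
        where
        go : ∀ b s′ → Keep (λ r → d ≤ toℕ r) s s′ × b ≡ fm φ (dead s) ρ →
          Ends (branch b (compileᶠ ψ η d le) (ret false)) s′
            (λ b s″ → Keep (λ r → d ≤ toℕ r) s s″ × b ≡ fm φ (dead s) ρ ∧ fm ψ (dead s) ρ)
        go true  s′ (k , eq) = ends-map
          (λ _ _ (k′ , e) → keep-trans (λ _ p → p , p) k k′ , trans e (cong₂ _∧_ eq (cong (λ D → fm ψ D ρ) (dead≡ k))))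
          (compileᶠ-ends ψ η d le ρ s′ (m⊔n≤o⇒n≤o _ _ nd) (λ i → trans (regs≡ k _ (ab i)) (env i)) ab)
        go false s′ (k , eq) = ends-map (λ { _ _ (e , refl) → k , trans e (cong (_∧ fm ψ (dead s) ρ) eq) }) (ret-ends false s′)

    stored : St → Store
    stored s = dead s , outs s

    compileᶜ-ends : ∀ {n} (c : Cmd n) η d le ρ s → needᶜ c ≤ d → Env s η ρ → Above d η →
      Ends (compileᶜ c η d le) s (λ _ s′ → stored s′ ≡ exec c ρ (stored s) × (∀ r → d ≤ toℕ r → get s′ r ≡ get s r))
    compileᶜ-ends skipᶜ η d le ρ s _ env ab = ends-map (λ { _ _ (_ , refl) → refl , λ _ _ → refl }) (ret-ends true s)
    compileᶜ-ends (c ⍮ c′) η d le ρ s nd env ab =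
      seq-ends (compileᶜ-ends c η d le ρ s (m⊔n≤o⇒m≤o _ _ nd) env ab) λ _ s′ (e , k) →
      ends-map (λ _ s″ (e′ , k′) → trans e′ (cong (exec c′ ρ) e) , λ r p → trans (k′ r p) (k r p))
        (compileᶜ-ends c′ η d le ρ s′ (m⊔n≤o⇒n≤o _ _ nd) (λ i → trans (k _ (ab i)) (env i)) ab)
    compileᶜ-ends (forᶜ c) η (suc d) le ρ s (s≤s nd) env ab =
      ends-map (λ _ _ (e , k , _) → e , k) (for-ends Inv (λ _ _ → proj₂ ∘ proj₂) body s
        (refl , (λ q lt → get-other 0 s (above≢ le q lt)) , get-same r 0 s))
      where
      r = fromℕ< le
      Inv : ℕ → St → Set
      Inv i s′ = stored s′ ≡ iterate i (λ x → exec c (x ∷ ρ)) (stored s) × (∀ q → suc d ≤ toℕ q → get s′ q ≡ get s q) × get s′ r ≡ i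
      body : ∀ i s′ → i < N → Inv i s′ → Ends (compileᶜ c (r ∷ η) d (<⇒≤ le)) s′ (λ _ s″ → Inv (suc i) (setReg r (suc (get s″ r)) s″))
      body i s′ _ (e , k , ei) = ends-map
        (λ _ s″ (e′ , k′) → trans e′ (cong (exec c (i ∷ ρ)) e)
          , (λ q lt → trans (get-other _ s″ (above≢ le q lt)) (trans (k′ q (<⇒≤ lt)) (k q lt)))
          , trans (get-same r _ s″) (cong suc (trans (k′ r (≤-reflexive (symm (toℕ-fromℕ< le)))) ei)))
        (compileᶜ-ends c (r ∷ η) d (<⇒≤ le) (i ∷ ρ) s′ nd
          (λ { zero → ei ; (suc j) → trans (k _ (ab j)) (env j) })
          (λ { zero → ≤-reflexive (symm (toℕ-fromℕ< le)) ; (suc j) → <⇒≤ (ab j) }))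
    compileᶜ-ends (repeatᶜ c) η (suc d) le ρ s (s≤s nd) env ab =
      ends-map (λ _ _ (e , k , _) → e , k) (for-ends Inv (λ _ _ → proj₂ ∘ proj₂) body s
        (refl , (λ q lt → get-other 0 s (above≢ le q lt)) , get-same r 0 s))
      where
      r = fromℕ< le
      Inv : ℕ → St → Set
      Inv i s′ = stored s′ ≡ iterate i (λ _ → exec c ρ) (stored s) × (∀ q → suc d ≤ toℕ q → get s′ q ≡ get s q) × get s′ r ≡ i
      body : ∀ i s′ → i < N → Inv i s′ → Ends (compileᶜ c η d (<⇒≤ le)) s′ (λ _ s″ → Inv (suc i) (setReg r (suc (get s″ r)) s″))
      body i s′ _ (e , k , ei) = ends-map
        (λ _ s″ (e′ , k′) → trans e′ (cong (exec c ρ) e)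
          , (λ q lt → trans (get-other _ s″ (above≢ le q lt)) (trans (k′ q (<⇒≤ lt)) (k q lt)))
          , trans (get-same r _ s″) (cong suc (trans (k′ r (≤-reflexive (symm (toℕ-fromℕ< le)))) ei)))
        (compileᶜ-ends c η d (<⇒≤ le) ρ s′ nd
          (λ j → trans (k _ (ab j)) (env j)) (λ j → <⇒≤ (ab j)))
    compileᶜ-ends (ifᶜ φ c c′) η d le ρ s nd env ab = cond-ends (compileᶜ c η d le) (compileᶜ c′ η d le) (compileᶠ-ends φ η d le ρ s (m⊔n≤o⇒m≤o _ _ nd) env ab) go
      where
      nd′ = m⊔n≤o⇒n≤o (needᶠ φ) _ nd
      go : ∀ b s′ → Keep (λ r → d ≤ toℕ r) s s′ × b ≡ fm φ (dead s) ρ →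
        Ends (branch b (compileᶜ c η d le) (compileᶜ c′ η d le)) s′
          (λ _ s″ → stored s″ ≡ exec (ifᶜ φ c c′) ρ (stored s) × (∀ r → d ≤ toℕ r → get s″ r ≡ get s r))
      go true s′ (k , eq) rewrite symm eq = ends-map
        (λ _ s″ (e , k′) → trans e (cong (exec c ρ) (cong₂ _,_ (dead≡ k) (outs≡ k))) , λ r p → trans (k′ r p) (regs≡ k r p))
        (compileᶜ-ends c η d le ρ s′ (m⊔n≤o⇒m≤o _ _ nd′) (λ i → trans (regs≡ k _ (ab i)) (env i)) ab)
      go false s′ (k , eq) rewrite symm eq = ends-map
        (λ _ s″ (e , k′) → trans e (cong (exec c′ ρ) (cong₂ _,_ (dead≡ k) (outs≡ k))) , λ r p → trans (k′ r p) (regs≡ k r p))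
        (compileᶜ-ends c′ η d le ρ s′ (m⊔n≤o⇒n≤o (needᶜ c) _ nd′) (λ i → trans (regs≡ k _ (ab i)) (env i)) ab)
    compileᶜ-ends (killᶜ i) η d le ρ s _ env ab =
      ends-map (λ { _ _ (_ , refl) → cong (λ v → (λ p → dead s p ∨ (v ≡ᵇ p)) , outs s) (env i) , λ _ _ → refl })
        (kill-ends (lookup η i) s)
    compileᶜ-ends (emitᶜ a) η d le ρ s _ env ab =
      ends-map (λ { _ _ (_ , refl) → refl , λ _ _ → refl }) (emit-ends a s)

-- Loading the input and unloading the output

^-distribʳ-* : ∀ d m n → (m * n) ^ d ≡ m ^ d * n ^ d
^-distribʳ-* zero    m n = refl
^-distribʳ-* (suc d) m n = trans (cong (m * n *_) (^-distribʳ-* d m n)) (interchange m n (m ^ d) (n ^ d))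
  where
  interchange : ∀ a b c d → a * b * (c * d) ≡ a * c * (b * d)
  interchange = solve-∀

-- The outer summands are the loading and unloading passes. Three summands cost one more factor of
-- the base, and 3 + N ≤ 3(N + 1) trades the base for the input length plus one, with a constant
-- factor.
total-time : ∀ N g t → t ≤ (3 + N) ^ suc g →
  (N + suc (N + 1)) + (t + (N + suc (N + 1))) ≤ 3 ^ (4 + g) * (N + 1) ^ (4 + g)
total-time N g t h = begin
  (N + suc (N + 1)) + (t + (N + suc (N + 1)))  ≤⟨ +-mono-≤ pass≤ (+-mono-≤ (≤-trans h (up (suc g) (m≤n+m (suc g) 2))) pass≤) ⟩
  c + (c + c)                                  ≡⟨ cong (λ x → c + (c + x)) (symm (+-identityʳ c)) ⟩
  3 * c                                        ≤⟨ *-monoˡ-≤ c (m≤m+n 3 N) ⟩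
  (3 + N) ^ (4 + g)                            ≤⟨ ^-monoˡ-≤ (4 + g) base≤ ⟩
  (3 * (N + 1)) ^ (4 + g)                      ≡⟨ ^-distribʳ-* (4 + g) 3 (N + 1) ⟩
  3 ^ (4 + g) * (N + 1) ^ (4 + g)              ∎
  where
  open ≤-Reasoning
  c : ℕ
  c = (3 + N) ^ (3 + g)
  up : ∀ d → d ≤ 3 + g → (3 + N) ^ d ≤ c
  up d = ^-monoʳ-≤ (3 + N) {d} {3 + g}
  base≤ : 3 + N ≤ 3 * (N + 1)
  base≤ = ≤-trans (m≤m+n (3 + N) (N + N)) (≤-reflexive (expand N))
    where
    expand : ∀ n → 3 + n + (n + n) ≡ 3 * (n + 1)
    expand = solve-∀
  pass≤ : N + suc (N + 1) ≤ c
  pass≤ = ≤-trans (m≤m+n _ (N * N + (4 * N + 7))) (≤-trans (≤-reflexive (expand N)) (up 2 (s≤s (s≤s z≤n))))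
    where
    expand : ∀ n → n + suc (n + 1) + (n * n + (4 * n + 7)) ≡ (3 + n) * ((3 + n) * 1)
    expand = solve-∀

module Whole (R : ℕ) where

  open Cells R
  open Compile R

  module Load where

    -- All registers start at 0 and nothing is written yet, so all register marks and the output
    -- pointer sit in the first cell.
    fresh : Fin 4 → Bool → Cell
    fresh x first = x , false , zero , first , Vec.replicate R first

    fwd′ : Bool → Fin 4 ⊎ Cell → Maybe (Bool × Sy)
    fwd′ first (inj₁ zero)    = nothing
    fwd′ first (inj₁ (suc x)) = just (false , cell (fresh (suc x) first))
    fwd′ first (inj₂ _)       = nothing

    fwd : Bool → Sy → Maybe (Bool × Sy)
    fwd first a = fwd′ first (view a)

    back : Sy → Maybe Sy
    back a = [ (λ _ → nothing) , (λ _ → just a) ]′ (view a)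

    loadM : Mach
    loadM = sweep finite-Bool true fwd back (λ _ → true)

    fwd-load : ∀ w (σ : ℕ → Bool) → (∀ p → σ (suc p) ≡ false) → All (_≢ zero) w →
      Fwd finite-Bool true fwd back (λ _ → true) (σ 0) (List.map raw w) (σ (length w)) (word (length w) (λ p → fresh (nth w p) (σ p)))
    fwd-load []          σ h []        = []
    fwd-load (zero ∷ w)  σ h (ne ∷ _)  = ⊥-elim (ne refl)
    fwd-load (suc x ∷ w) σ h (ne ∷ ns) =
      trans (cong (fwd′ (σ 0)) (view-raw (suc x))) (cong (λ b → just (b , cell (fresh (suc x) (σ 0)))) (symm (h 0))) ∷ fwd-load w (σ ∘ suc) (h ∘ suc) ns

    back-load : ∀ n g → Back finite-Bool true fwd back (λ _ → true) (word n g) (word n g)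
    back-load zero    g = []
    back-load (suc n) g = cong [ (λ _ → nothing) , (λ _ → just (cell (g 0))) ]′ (view-cell (g 0)) ∷ back-load n (g ∘ suc)

  module Unload where

    output-of : Cell → Fin 4
    output-of (_ , _ , o , _) = o

    fwd : ⊤ → Sy → Maybe (⊤ × Sy)
    fwd _ a = [ (λ _ → nothing) , (λ _ → just (tt , a)) ]′ (view a)

    back : Sy → Maybe Sy
    back a = [ (λ _ → nothing) , (λ c → just (raw (output-of c))) ]′ (view a)

    unloadM : Mach
    unloadM = sweep finite-⊤ tt fwd back (λ _ → true)

    rawWord : ℕ → (ℕ → Fin 4) → List Sy
    rawWord zero    f = []
    rawWord (suc n) f = raw (f 0) ∷ rawWord n (f ∘ suc)

    fwd-unload : ∀ n g → Fwd finite-⊤ tt fwd back (λ _ → true) tt (word n g) tt (word n g)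
    fwd-unload zero    g = []
    fwd-unload (suc n) g = cong [ (λ _ → nothing) , (λ _ → just (tt , cell (g 0))) ]′ (view-cell (g 0)) ∷ fwd-unload n (g ∘ suc)

    back-unload : ∀ n g → Back finite-⊤ tt fwd back (λ _ → true) (word n g) (rawWord n (output-of ∘ g))
    back-unload zero    g = []
    back-unload (suc n) g =
      cong [ (λ _ → nothing) , (λ c → just (raw (output-of c))) ]′ (view-cell (g 0)) ∷ back-unload n (g ∘ suc)

  open Load using (loadM)
  open Unload using (unloadM; rawWord)

  programM : Mach → Mach
  programM M = seqM loadM (seqM M unloadM)

  module _ (M : Mach) where

    T = toTM (programM M)

    initial-config : ∀ w → initial T w ≡ config (programM M) (TM.start T) (place [] (List.map raw w))
    initial-config []      = refl
    initial-config (x ∷ w) = refl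

    -- The output track is blank beyond the end of `outs`, and reading stops at the first blank; so
    -- the symbols must be nonblank and fit on the track.
    output-place : ∀ n outs → length outs ≤ n → All (_≢ zero) outs →
      output T (config (programM M) zero (place (bl true) (rawWord n (nth outs) ++ bl true))) ≡ List.map raw outs
    output-place zero [] _ _ = refl
    output-place (suc n) [] _ _ = refl
    output-place (suc n) (zero ∷ outs) _ (ne ∷ _) = ⊥-elim (ne refl)
    output-place (suc n) (suc x ∷ outs) (s≤s le) (_ ∷ ns) = cong (raw (suc x) ∷_) (rest n outs le ns)
      where
      rest : ∀ n outs → length outs ≤ n → All (_≢ zero) outs →
        takeWhile (λ s → Relation.Nullary.¬? (s Fin.≟ blank T)) (rawWord n (nth outs) ++ bl true) ≡ List.map raw outs
      rest zero    [] _ _ = refl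
      rest (suc n) [] _ _ = refl
      rest (suc n) (zero ∷ outs) _ (ne ∷ _) = ⊥-elim (ne refl)
      rest (suc n) (suc x ∷ outs) (s≤s le) (_ ∷ ns) = cong (raw (suc x) ∷_) (rest n outs le ns)

    module _ (w : List (Fin 4)) (w-ok : All (_≢ zero) w) where

      open Simulation (length w) (nth w)

      s₀ : St
      s₀ = st (Vec.replicate R 0) (λ _ → false) []

      load-run : Run loadM (start loadM) (place [] (List.map raw w)) (length w + suc (length w + 1)) true (tapeOf s₀)
      load-run = subst₂ (λ n τ → Run loadM (start loadM) (place [] (List.map raw w)) n true τ)
        (cong (λ n → n + suc (n + 1)) (List.length-map raw w))
        (cong (λ u → place (bl true) (u ++ bl true)) (same (length w) (λ p →
          cong (λ m → nth w p , false , zero , (0 ≡ᵇ p) , m) (symm (Vec.map-replicate (_≡ᵇ p) 0 R)))))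
        (subst (λ u → Run loadM (start loadM) (place [] u) (length (List.map raw w) + suc (length (List.map raw w) + 1)) true
                  (place (bl true) (word (length w) (λ p → Load.fresh (nth w p) (0 ≡ᵇ p)) ++ bl true))) (List.++-identityʳ (List.map raw w))
          (sweep-run finite-Bool true Load.fwd Load.back (λ _ → true) fwd-blank refl false false
            (Load.fwd-load w (0 ≡ᵇ_) (λ _ → refl) w-ok) (Load.back-load (length w) (λ p → Load.fresh (nth w p) (0 ≡ᵇ p)))))
        where
        fwd-blank : ∀ z → Load.fwd z blankˢ ≡ nothing
        fwd-blank _ = refl
        same : ∀ n {f g : ℕ → Cell} → (∀ p → f p ≡ g p) → word n f ≡ word n g
        same zero    h = refl
        same (suc n) h = cong₂ _∷_ (cong cell (h 0)) (same n (h ∘ suc))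

      unload-run : ∀ s → Run unloadM (start unloadM) (tapeOf s) (length w + suc (length w + 1)) true
        (place (bl true) (rawWord (length w) (nth (outs s)) ++ bl true))
      unload-run s = subst (λ n → Run unloadM (start unloadM) (tapeOf s) (n + suc (n + 1)) true
          (place (bl true) (rawWord (length w) (nth (outs s)) ++ bl true)))
        (length-word (length w) (cellAt s))
        (sweep-run finite-⊤ tt Unload.fwd Unload.back (λ _ → true) (λ _ → refl) refl true true
          (Unload.fwd-unload (length w) (cellAt s)) (Unload.back-unload (length w) (cellAt s)))

      halts : ∀ s t b → Run M (start M) (tapeOf s₀) t b (tapeOf s) → length (outs s) ≤ length w → All (_≢ zero) (outs s) →
        HaltsWithin T w ((length w + suc (length w + 1)) + (t + (length w + suc (length w + 1)))) (outs s)
      halts s t b r le ok = cong Config.state eq , trans (cong (output T) eq) (output-place (length w) (outs s) le ok)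
        where
        total = (length w + suc (length w + 1)) + (t + (length w + suc (length w + 1)))
        unload : ∀ b → Run (branch b unloadM unloadM) (start (branch b unloadM unloadM)) (tapeOf s) (length w + suc (length w + 1)) true
          (place (bl true) (rawWord (length w) (nth (outs s)) ++ bl true))
        unload true  = unload-run s
        unload false = unload-run s
        eq : run T total (initial T w) ≡ config (programM M) zero (place (bl true) (rawWord (length w) (nth (outs s)) ++ bl true))
        eq = trans (cong (run T total) (initial-config w))
          (run-TM (programM M) (cond-run {M = loadM} load-run (cond-run {M = M} r (unload b))))

module _ (c : Cmd 0) where

  private
    R = needᶜ c

  open Cells R
  open Compile R
  open Whole R

  private
    machine : Mach
    machine = compileᶜ c [] R ≤-refl

    D : ℕ
    D = 4 + degree machine

  program-TM : Σ TM λ M → Σ ℕ λ a → Σ ℕ λ d → ∀ w → All (_≢ zero) w →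
    let out = proj₂ (Meaning.exec (length w) (nth w) c [] ((λ _ → false) , [])) in
    length out ≤ length w → All (_≢ zero) out →
    Σ ℕ λ t → t ≤ a * (length w + 1) ^ d × HaltsWithin M w t out
  program-TM = toTM (programM machine) , 3 ^ D , D , λ w w-ok le ok → finish w w-ok le ok
    where
    finish : ∀ w → All (_≢ zero) w →
      let out = proj₂ (Meaning.exec (length w) (nth w) c [] ((λ _ → false) , [])) in
      length out ≤ length w → All (_≢ zero) out →
      Σ ℕ λ t → t ≤ 3 ^ D * (length w + 1) ^ D × HaltsWithin (toTM (programM machine)) w t out
    finish w w-ok = go out (ends-map (λ _ _ p → cong proj₂ (proj₁ p))
      (Correct.compileᶜ-ends (length w) (nth w) c [] R ≤-refl [] (s₀ machine w w-ok) ≤-refl (λ ()) (λ ())))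
      where
      N = length w
      open Simulation (length w) (nth w)
      out = proj₂ (Meaning.exec N (nth w) c [] ((λ _ → false) , []))
      go : ∀ o → Ends machine (s₀ machine w w-ok) (λ _ s′ → outs s′ ≡ o) → length o ≤ N → All (_≢ zero) o →
        Σ ℕ λ t → t ≤ 3 ^ D * (N + 1) ^ D × HaltsWithin (toTM (programM machine)) w t o
      go o (ends {time} {b} {s} fast runs refl) le ok =
        (N + suc (N + 1)) + (time + (N + suc (N + 1))) , total-time N (degree machine) time fast , halts machine w w-ok s time b runs le ok

-- The encoded graph as seen by programs

infix 0 _⇔ᵇ_

_⇔ᵇ_ : Bool → Set → Set
b ⇔ᵇ P = (Is b → P) × (P → Is b)

⇔ᵇ-map : ∀ {b P Q} → (P → Q) → (Q → P) → b ⇔ᵇ P → b ⇔ᵇ Q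
⇔ᵇ-map f g (s , t) = f ∘ s , t ∘ g

∧-⇔ᵇ : ∀ {b c P Q} → b ⇔ᵇ P → (P → c ⇔ᵇ Q) → b ∧ c ⇔ᵇ P × Q
∧-⇔ᵇ {true}  (f , g) h = (λ e → f refl , proj₁ (h (f refl)) e) , λ (p , q) → proj₂ (h p) q
∧-⇔ᵇ {false} (f , g) h = (λ ()) , λ (p , _) → g p

¬-⇔ᵇ : ∀ {b P} → b ⇔ᵇ P → not b ⇔ᵇ ¬ P
¬-⇔ᵇ {true}  (f , g) = (λ ()) , λ ¬p → ⊥-elim (¬p (f refl))
¬-⇔ᵇ {false} (f , g) = (λ _ p → case-false (g p)) , λ _ → refl
  where
  case-false : false ≡ true → ⊥
  case-false ()

<-⇔ᵇ : ∀ x y → (x <ᵇ y) ⇔ᵇ x < y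
<-⇔ᵇ x       zero    = (λ ()) , λ ()
<-⇔ᵇ zero    (suc y) = (λ _ → s≤s z≤n) , λ _ → refl
<-⇔ᵇ (suc x) (suc y) = ⇔ᵇ-map s≤s s≤s⁻¹ (<-⇔ᵇ x y)

≡-⇔ᵇ : ∀ x y → (x ≡ᵇ y) ⇔ᵇ x ≡ y
≡-⇔ᵇ zero    zero    = (λ _ → refl) , λ _ → refl
≡-⇔ᵇ zero    (suc y) = (λ ()) , λ ()
≡-⇔ᵇ (suc x) zero    = (λ ()) , λ ()
≡-⇔ᵇ (suc x) (suc y) = ⇔ᵇ-map (cong suc) suc-injective (≡-⇔ᵇ x y)

does-⇔ᵇ : {P : Set} (P? : Dec P) → does P? ⇔ᵇ P
does-⇔ᵇ (yes p) = (λ _ → p) , λ _ → refl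
does-⇔ᵇ (no ¬p) = (λ ()) , λ p → ⊥-elim (¬p p)

card-< : ∀ N m → m ≤ N → card N (_<? m) ≡ m
card-< N m m≤N = ≤-antisym upper (lower N m m≤N)
  where
  upper : card N (_<? m) ≤ m
  upper = ≤-trans (card-fibres′ N m (_<? m) (λ y x → x ≟ y) 1 (λ x _ x<m → x , x<m , refl) (λ y _ → card-≟ N y))
                  (≤-reflexive (*-identityʳ m))
  everything? : Decidable (λ _ → ⊤)
  everything? _ = yes tt
  prefix : ∀ N m → m ≤ N → (f : ℕ → ℕ) → sum m f ≤ sum N f
  prefix zero    zero    _  f = z≤n
  prefix (suc N) m       le f with m≤n⇒m<n∨m≡n le
  ... | inj₁ lt   = ≤-trans (prefix N m (s≤s⁻¹ lt) f) (m≤n+m _ (f N))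
  ... | inj₂ refl = ≤-refl
  lower : ∀ N m → m ≤ N → m ≤ card N (_<? m)
  lower N m m≤N = ≤-trans (≤-reflexive (symm (trans (sum-const m 1) (*-identityʳ m))))
    (≤-trans (card-mono m everything? (_<? m) (λ x x<m _ → x<m)) (prefix N m m≤N (λ x → ind (x <? m))))

nth-++ : ∀ xs ys p → nth (xs ++ ys) (length xs + p) ≡ nth ys p
nth-++ []       ys p = refl
nth-++ (x ∷ xs) ys p = nth-++ xs ys p

nth-++ˡ : ∀ xs ys p → p < length xs → nth (xs ++ ys) p ≡ nth xs p
nth-++ˡ (x ∷ xs) ys zero    _ = refl
nth-++ˡ (x ∷ xs) ys (suc p) (s≤s lt) = nth-++ˡ xs ys p lt

nth-All : ∀ {P : Fin 4 → Set} xs p → All P xs → p < length xs → P (nth xs p)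
nth-All (x ∷ xs) zero    (px ∷ _)  _ = px
nth-All (x ∷ xs) (suc p) (_ ∷ pxs) (s≤s lt) = nth-All xs p pxs lt

module _ {A : Set} (n : ℕ) (f : A → List (Fin 4)) (len : ∀ a → length (f a) ≡ n) where

  length-rows : ∀ xs → length (concatMap f xs) ≡ length xs * n
  length-rows []       = refl
  length-rows (x ∷ xs) = trans (List.length-++ (f x)) (cong₂ _+_ (len x) (length-rows xs))

  nth-rows : ∀ {m} (g : Fin m → A) i q → q < n → nth (concatMap f (tabulate g)) (toℕ i * n + q) ≡ nth (f (g i)) q
  nth-rows g zero    q lt = nth-++ˡ (f (g zero)) _ q (≤-trans lt (≤-reflexive (symm (len (g zero)))))
  nth-rows g (suc i) q lt = trans (cong (nth (concatMap f (tabulate g))) eq) (trans (nth-++ (f (g zero)) _ _) (nth-rows (g ∘ suc) i q lt))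
    where
    eq : n + toℕ i * n + q ≡ length (f (g zero)) + (toℕ i * n + q)
    eq = trans (+-assoc n (toℕ i * n) q) (cong (_+ (toℕ i * n + q)) (symm (len (g zero))))

nth-tabulate : ∀ {m} {A : Set} (h : A → Fin 4) (g : Fin m → A) i → nth (List.map h (tabulate g)) (toℕ i) ≡ h (g i)
nth-tabulate h g zero    = refl
nth-tabulate h g (suc i) = nth-tabulate h (g ∘ suc) i

module Encoding (G : Graph) (k : ℕ) where

  private
    m : ℕ
    m = n G

    row : Fin m → List (Fin 4)
    row i = List.map (λ j → bit (adj G i j)) (allFin m)

    body : List (Fin 4)
    body = concatMap row (allFin m)

    row-length : ∀ i → length (row i) ≡ m
    row-length i = trans (List.length-map (λ j → bit (adj G i j)) (allFin m)) (List.length-tabulate id)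

    body-length : length body ≡ m * m
    body-length = trans (length-rows m row row-length (allFin m)) (cong (_* m) (List.length-tabulate {n = m} id))

    Bit : Fin 4 → Set
    Bit a = a ≢ 0F × a ≢ 3F

    bit-ok : ∀ b → Bit (bit b)
    bit-ok true  = (λ ()) , (λ ())
    bit-ok false = (λ ()) , (λ ())

    body-ok : All Bit body
    body-ok = All.concat⁺ (All.map⁺ (All.tabulate⁺ {f = id} λ i →
                All.map⁺ (All.tabulate⁺ {f = id} λ j → bit-ok (adj G i j))))

  w : List (Fin 4)
  w = encode G k

  N : ℕ
  N = length w

  N≡ : N ≡ k + suc (m * m)
  N≡ = trans (List.length-++ (replicate k 2F)) (cong₂ _+_ (List.length-replicate k) (cong suc body-length))

  private
    prefix : ∀ p → nth w (k + p) ≡ nth (3F ∷ body) p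
    prefix p = trans (cong (λ l → nth w (l + p)) (symm (List.length-replicate k {2F}))) (nth-++ (replicate k 2F) (3F ∷ body) p)

  encode-ok : All (_≢ 0F) w
  encode-ok = All.++⁺ (All.replicate⁺ k λ ()) ((λ ()) ∷ go body-ok)
    where
    go : ∀ {xs} → All Bit xs → All (_≢ 0F) xs
    go []             = []
    go ((p , _) ∷ ps) = p ∷ go ps

  k<N : k < N
  k<N = ≤-trans (≤-reflexive (+-comm 1 k)) (≤-trans (+-monoʳ-≤ k (s≤s z≤n)) (≤-reflexive (symm N≡)))

  m≤N : m ≤ N
  m≤N = ≤-trans (square m) (≤-trans (n≤1+n (m * m)) (≤-trans (m≤n+m (suc (m * m)) k) (≤-reflexive (symm N≡))))
    where
    square : ∀ m → m ≤ m * m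
    square zero    = z≤n
    square (suc m) = m≤m+n (suc m) (m * suc m)

  hash-at : nth w k ≡ 3F
  hash-at = trans (cong (nth w) (symm (+-identityʳ k))) (prefix 0)

  hash-only : ∀ p → p < N → nth w p ≡ 3F → p ≡ k
  hash-only p p<N e with <-cmp p k
  ... | tri≈ _ eq _ = eq
  ... | tri< p<k _ _ with () ← trans (symm e) (trans
          (nth-++ˡ (replicate k 2F) (3F ∷ body) p (≤-trans p<k (≤-reflexive (symm (List.length-replicate k)))))
          (nth-All {_≡ 2F} (replicate k 2F) p (All.replicate⁺ k refl) (≤-trans p<k (≤-reflexive (symm (List.length-replicate k))))))
  ... | tri> _ _ k<p = ⊥-elim (proj₂ (nth-All body (p ∸ suc k) body-ok lt) (trans (symm (trans at (prefix (suc (p ∸ suc k))))) e))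
    where
    split : k + suc (p ∸ suc k) ≡ p
    split = trans (+-suc k (p ∸ suc k)) (m+[n∸m]≡n k<p)
    at : nth w p ≡ nth w (k + suc (p ∸ suc k))
    at = cong (nth w) (symm split)
    lt : p ∸ suc k < length body
    lt = s≤s⁻¹ (+-cancelˡ-< k (suc (p ∸ suc k)) (suc (length body))
           (≤-trans (≤-reflexive (cong suc split)) (≤-trans p<N (≤-reflexive (trans N≡ (cong (λ l → k + suc l) (symm body-length)))))))

  edge-at : ∀ i j → nth w (k + suc (toℕ i * m + toℕ j)) ≡ bit (adj G i j)
  edge-at i j = trans (prefix (suc (toℕ i * m + toℕ j)))
    (trans (nth-rows m row row-length id i (toℕ j) (toℕ<n j)) (nth-tabulate (λ j → bit (adj G i j)) id j))

exᵇ : ∀ {m} → Fm (suc m) → Fm m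
exᵇ φ = zeroᵗ <ᵗ sumᵗ (φ ?ᵗ oneᵗ)

-- The separator 3F stands at position k, which is how k and thresholds in k
-- are expressed.
opaque

  belowKᵇ atMostKᵇ : ∀ {m} → Fin m → Fm m
  belowKᵇ i = exᵇ (suc i <ᵛ v0 andᵇ symᵇ v0 3F)
  atMostKᵇ i = exᵇ (notᵇ (v0 <ᵛ suc i) andᵇ symᵇ v0 3F)

numᵗ : ∀ {m} → ℕ → Tm m
numᵗ zero    = zeroᵗ
numᵗ (suc c) = oneᵗ +ᵗ numᵗ c

-- The language has no product; summing over the positions 0, ..., k multiplies by k + 1.
thresholdᵗ : ∀ {m} → ℕ → ℕ → Tm m
thresholdᵗ c zero    = numᵗ c
thresholdᵗ c (suc e) = sumᵗ (atMostKᵇ v0 ?ᵗ thresholdᵗ c e)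

-- Turns a position into a number, by counting the positions before it.
varᵗ : ∀ {m} → Fin m → Tm m
varᵗ i = sumᵗ (v0 <ᵛ suc i ?ᵗ oneᵗ)

kᵗ sizeᵗ : ∀ {m} → Tm m
kᵗ = sumᵗ (belowKᵇ v0 ?ᵗ oneᵗ)
sizeᵗ = sumᵗ oneᵗ

opaque

  squareᵗ : ∀ {m} → Fin m → Tm m
  squareᵗ i = sumᵗ (notᵇ (suc i <ᵛ v0) ?ᵗ sumᵗ (notᵇ (suc (suc i) <ᵛ v0) ?ᵗ oneᵗ))

opaque

  -- The number n of vertices is not written on the tape. As the input has length k + 1 + n², it is
  -- the number of x with (x+1)² + k below the length.
  orderᵗ : ∀ {m} → Tm m
  orderᵗ = sumᵗ (squareᵗ v0 +ᵗ kᵗ <ᵗ sizeᵗ ?ᵗ oneᵗ)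

opaque

  -- Matrix entry (i, j) stands at position k + 1 + i · n + j; the product arises by adding the
  -- order once for every position before i.
  entryᵗ : ∀ {m} → Fin m → Fin m → Tm m
  entryᵗ i j = kᵗ +ᵗ (oneᵗ +ᵗ (sumᵗ (v0 <ᵛ suc i ?ᵗ orderᵗ) +ᵗ varᵗ j))

opaque

  edgeᵇ : ∀ {m} → Fin m → Fin m → Fm m
  edgeᵇ i j = exᵇ ((notᵇ (varᵗ v0 <ᵗ entryᵗ (suc i) (suc j)) andᵇ notᵇ (entryᵗ (suc i) (suc j) <ᵗ varᵗ v0)) andᵇ symᵇ v0 2F)

opaque

  closedᵇ : ∀ {m} → Fin m → Fin m → Fm m
  closedᵇ i j = notᵇ (notᵇ (notᵇ (i <ᵛ j) andᵇ notᵇ (j <ᵛ i)) andᵇ notᵇ (edgeᵇ i j))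

opaque

  liveᵇ : ∀ {m} → Fin m → Fm m
  liveᵇ i = varᵗ i <ᵗ orderᵗ andᵇ notᵇ (deadᵇ i)

translate : ∀ {m} → GF m → Fm m
translate (adjᶠ i j)   = closedᵇ i j
translate (φ ∧ᶠ ψ)     = translate φ andᵇ translate ψ
translate (φ ∨ᶠ ψ)     = notᵇ (notᵇ (translate φ) andᵇ notᵇ (translate ψ))
translate (φ ⇒ᶠ ψ)     = notᵇ (translate φ andᵇ notᵇ (translate ψ))
translate (¬ᶠ φ)       = notᵇ (translate φ)
translate (∀ᶠ φ)       = notᵇ (exᵇ (liveᵇ v0 andᵇ notᵇ (translate φ)))
translate (∃ᶠ φ)       = exᵇ (liveᵇ v0 andᵇ translate φ)
translate (many c e φ) = thresholdᵗ c e <ᵗ sumᵗ (liveᵇ v0 andᵇ translate φ ?ᵗ oneᵗ)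

card-cong : ∀ N {P Q : ℕ → Set} (P? : Decidable P) (Q? : Decidable Q) →
  (∀ x → x < N → (P x → Q x) × (Q x → P x)) → card N P? ≡ card N Q?
card-cong N P? Q? h = ≤-antisym (card-mono N P? Q? λ x p → proj₁ (h x p)) (card-mono N Q? P? λ x p → proj₂ (h x p))

module Translation (G : Graph) (k : ℕ) where

  open Encoding G k

  m : ℕ
  m = n G

  open Meaning N (nth w)

  private
    edge? : ∀ {x y} → Dec (x < m) → Dec (y < m) → Bool
    edge? (yes p) (yes q) = adj G (fromℕ< p) (fromℕ< q)
    edge? _       _       = false

  edge : ℕ → ℕ → Bool
  edge x y = edge? (x <? m) (y <? m)

  Ê : ℕ → ℕ → Bool
  Ê x y = (x ≡ᵇ y) ∨ edge x y

  alive : (ℕ → Bool) → ℕ → Bool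
  alive D x = (x <ᵇ m) ∧ not (D x)

  edge-toℕ : ∀ i j → edge (toℕ i) (toℕ j) ≡ adj G i j
  edge-toℕ i j with toℕ i <? m | toℕ j <? m
  ... | yes p | yes q = cong₂ (adj G) (fromℕ<-toℕ i p) (fromℕ<-toℕ j q)
  ... | no ¬p | _     = ⊥-elim (¬p (toℕ<n i))
  ... | yes _ | no ¬q = ⊥-elim (¬q (toℕ<n j))

  edge-sym : ∀ x y → edge x y ≡ edge y x
  edge-sym x y with x <? m | y <? m
  ... | yes p | yes q = Graph.sym G _ _
  ... | yes _ | no _  = refl
  ... | no _  | yes _ = refl
  ... | no _  | no _  = refl

  edge-irr : ∀ x → edge x x ≡ false
  edge-irr x with x <? m
  ... | yes p = Graph.irr G _
  ... | no _  = refl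

  ∨-⇔ᵇ : ∀ {b c P Q} → b ⇔ᵇ P → c ⇔ᵇ Q → b ∨ c ⇔ᵇ P ⊎ Q
  ∨-⇔ᵇ {true}  (f , g) _ = (λ _ → inj₁ (f refl)) , λ _ → refl
  ∨-⇔ᵇ {false} {true}  _ (f , g) = (λ _ → inj₂ (f refl)) , λ _ → refl
  ∨-⇔ᵇ {false} {false} (_ , g) (_ , g′) = (λ ()) , [ g , g′ ]′

  is-⇔ᵇ : ∀ b → b ⇔ᵇ Is b
  is-⇔ᵇ b = id , id

  Ê-refl : ∀ x → Is (Ê x x)
  Ê-refl x = proj₂ (∨-⇔ᵇ (≡-⇔ᵇ x x) (is-⇔ᵇ (edge x x))) (inj₁ refl)

  Ê-sym : ∀ x y → Is (Ê x y) → Is (Ê y x)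
  Ê-sym x y e = proj₂ (∨-⇔ᵇ (≡-⇔ᵇ y x) (is-⇔ᵇ (edge y x)))
    ([ inj₁ ∘ symm , inj₂ ∘ trans (edge-sym y x) ]′ (proj₁ (∨-⇔ᵇ (≡-⇔ᵇ x y) (is-⇔ᵇ (edge x y))) e))

  alive-⇔ᵇ : ∀ D x → alive D x ⇔ᵇ x < m × ¬ Is (D x)
  alive-⇔ᵇ D x = ∧-⇔ᵇ (<-⇔ᵇ x m) (λ _ → ¬-⇔ᵇ (is-⇔ᵇ (D x)))

  alive<m : ∀ D x → Is (alive D x) → x < m
  alive<m D x = proj₁ ∘ proj₁ (alive-⇔ᵇ D x)

  alive< : ∀ D x → Is (alive D x) → x < N
  alive< D x v = ≤-trans (alive<m D x v) m≤N

  module _ (D : ℕ → Bool) where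

    Ok : ∀ {r} → Fm r → Vec ℕ r → Set → Set
    Ok φ ρ P = fm φ D ρ ⇔ᵇ P

    ltv-ok : ∀ {r} (i j : Fin r) ρ → lookup ρ i < N → Ok (i <ᵛ j) ρ (lookup ρ i < lookup ρ j)
    ltv-ok i j ρ lt = ⇔ᵇ-map proj₂ (λ p → lt , p) (∧-⇔ᵇ (<-⇔ᵇ (lookup ρ i) N) (λ _ → <-⇔ᵇ (lookup ρ i) (lookup ρ j)))

    lt-ok : ∀ {r} (t u : Tm r) ρ {a b} → tm t D ρ ≡ a → tm u D ρ ≡ b → b ≤ N → Ok (t <ᵗ u) ρ (a < b)
    lt-ok t u ρ refl refl b≤N = ⇔ᵇ-map proj₂ (λ p → ≤-trans p b≤N , p)
      (∧-⇔ᵇ (<-⇔ᵇ (tm t D ρ) N) (λ _ → <-⇔ᵇ (tm t D ρ) (tm u D ρ)))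

    sym-ok : ∀ {r} (i : Fin r) a ρ → lookup ρ i < N → Ok (symᵇ i a) ρ (nth w (lookup ρ i) ≡ a)
    sym-ok i a ρ lt = ⇔ᵇ-map proj₂ (λ p → lt , p) (∧-⇔ᵇ (<-⇔ᵇ (lookup ρ i) N) (λ _ → does-⇔ᵇ (nth w (lookup ρ i) Fin.≟ a)))

    count-ok : ∀ {r} (φ : Fm (suc r)) t ρ {P : ℕ → Set} (P? : Decidable P) X →
      (∀ x → x < N → Ok φ (x ∷ ρ) (P x)) → (∀ x → x < N → tm t D (x ∷ ρ) ≡ X) →
      tm (sumᵗ (φ ?ᵗ t)) D ρ ≡ card N P? * X
    count-ok φ t ρ {P} P? X h e = trans (sum-cong N λ x x<N → go (h x x<N) (P? x) (e x x<N)) (sum-*ʳ N (λ x → ind (P? x)) X)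
      where
      go : ∀ {b y Q} → b ⇔ᵇ Q → (Q? : Dec Q) → y ≡ X → (if b then y else 0) ≡ ind Q? * X
      go {true}  (f , g) (yes _) refl = symm (+-identityʳ X)
      go {true}  (f , g) (no ¬q) _ = ⊥-elim (¬q (f refl))
      go {false} (f , g) (yes q) _ with () ← g q
      go {false} (f , g) (no _)  _ = refl

    count1-ok : ∀ {r} (φ : Fm (suc r)) ρ {P : ℕ → Set} (P? : Decidable P) →
      (∀ x → x < N → Ok φ (x ∷ ρ) (P x)) → tm (sumᵗ (φ ?ᵗ oneᵗ)) D ρ ≡ card N P?
    count1-ok φ ρ P? h = trans (count-ok φ oneᵗ ρ P? 1 h (λ _ _ → refl)) (*-identityʳ _)

    ex-ok : ∀ {r} (φ : Fm (suc r)) ρ {P : ℕ → Set} → (∀ x → x < N → Ok φ (x ∷ ρ) (P x)) →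
      Ok (exᵇ φ) ρ (∃ λ x → x < N × P x)
    ex-ok φ ρ {P} h = ⇔ᵇ-map to from (lt-ok zeroᵗ (sumᵗ (φ ?ᵗ oneᵗ)) ρ refl
        (count1-ok φ ρ b? (λ x _ → is-⇔ᵇ (fm φ D (x ∷ ρ)))) (card-≤ N b?))
      where
      b? : Decidable (λ x → Is (fm φ D (x ∷ ρ)))
      b? x = is? (fm φ D (x ∷ ρ))
      none? : Decidable (λ _ → ⊥)
      none? _ = no id
      to : 0 < card N b? → ∃ λ x → x < N × P x
      to pos = let (x , x<N , b , _) = pick N b? none? (≤-trans (s≤s (≤-reflexive (card-none N none? (λ _ _ p → p)))) pos)
               in x , x<N , proj₁ (h x x<N) b
      from : (∃ λ x → x < N × P x) → 0 < card N b?
      from (x , x<N , p) = ≤-trans (≤-reflexive (symm (ind-yes (b? x) (proj₂ (h x x<N) p)))) (term≤sum N (λ x → ind (b? x)) x<N)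

    opaque
      unfolding belowKᵇ

      belowK-ok : ∀ {r} (i : Fin r) ρ → lookup ρ i < N → Ok (belowKᵇ i) ρ (lookup ρ i < k)
      belowK-ok i ρ lt = ⇔ᵇ-map
        (λ { (y , y<N , i<y , e) → subst (lookup ρ i <_) (hash-only y y<N e) i<y })
        (λ i<k → k , k<N , i<k , hash-at)
        (ex-ok (suc i <ᵛ v0 andᵇ symᵇ v0 3F) ρ λ x x<N → ∧-⇔ᵇ (ltv-ok (suc i) v0 (x ∷ ρ) lt) (λ _ → sym-ok v0 3F (x ∷ ρ) x<N))

    opaque
      unfolding atMostKᵇ

      atMostK-ok : ∀ {r} (i : Fin r) ρ → Ok (atMostKᵇ i) ρ (lookup ρ i < suc k)
      atMostK-ok i ρ = ⇔ᵇ-map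
        (λ { (y , y<N , y≮i , e) → s≤s (subst (lookup ρ i ≤_) (hash-only y y<N e) (≮⇒≥ y≮i)) })
        (λ i≤k → k , k<N , ≤⇒≯ (s≤s⁻¹ i≤k) , hash-at)
        (ex-ok (notᵇ (v0 <ᵛ suc i) andᵇ symᵇ v0 3F) ρ λ x x<N →
          ∧-⇔ᵇ (¬-⇔ᵇ (ltv-ok v0 (suc i) (x ∷ ρ) x<N)) (λ _ → sym-ok v0 3F (x ∷ ρ) x<N))

    num-ok : ∀ {r} c (ρ : Vec ℕ r) → tm (numᵗ c) D ρ ≡ c
    num-ok zero    ρ = refl
    num-ok (suc c) ρ = cong suc (num-ok c ρ)

    threshold-ok : ∀ {r} c e (ρ : Vec ℕ r) → tm (thresholdᵗ c e) D ρ ≡ suc k ^ e * c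
    threshold-ok c zero    ρ = trans (num-ok c ρ) (symm (+-identityʳ c))
    threshold-ok c (suc e) ρ = trans
      (count-ok (atMostKᵇ v0) (thresholdᵗ c e) ρ (_<? suc k) (suc k ^ e * c)
        (λ x _ → atMostK-ok v0 (x ∷ ρ)) (λ x _ → threshold-ok c e (x ∷ ρ)))
      (trans (cong (_* (suc k ^ e * c)) (card-< N (suc k) k<N)) (symm (*-assoc (suc k) (suc k ^ e) c)))

    var-ok : ∀ {r} (i : Fin r) ρ → lookup ρ i ≤ N → tm (varᵗ i) D ρ ≡ lookup ρ i
    var-ok i ρ le = trans (count1-ok (v0 <ᵛ suc i) ρ (_<? lookup ρ i) (λ x x<N → ltv-ok v0 (suc i) (x ∷ ρ) x<N))
      (card-< N (lookup ρ i) le)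

    k-ok : ∀ {r} (ρ : Vec ℕ r) → tm kᵗ D ρ ≡ k
    k-ok ρ = trans (count1-ok (belowKᵇ v0) ρ (_<? k) (λ x x<N → belowK-ok v0 (x ∷ ρ) x<N)) (card-< N k (<⇒≤ k<N))

    size-ok : ∀ {r} (ρ : Vec ℕ r) → tm sizeᵗ D ρ ≡ N
    size-ok ρ = trans (sum-const N 1) (*-identityʳ N)

    card-≯ : ∀ x → x < N → card N (λ y → ¬? (x <? y)) ≡ suc x
    card-≯ x x<N = trans (card-cong N (λ y → ¬? (x <? y)) (_<? suc x) (λ y _ → (λ p → s≤s (≮⇒≥ p)) , λ p → ≤⇒≯ (s≤s⁻¹ p)))
      (card-< N (suc x) x<N)

    opaque
      unfolding squareᵗ

      square-ok : ∀ {r} (i : Fin r) ρ → lookup ρ i < N → tm (squareᵗ i) D ρ ≡ suc (lookup ρ i) * suc (lookup ρ i)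
      square-ok i ρ lt = trans
        (count-ok (notᵇ (suc i <ᵛ v0)) (sumᵗ (notᵇ (suc (suc i) <ᵛ v0) ?ᵗ oneᵗ)) ρ (λ y → ¬? (lookup ρ i <? y)) (suc (lookup ρ i))
          (λ x _ → ¬-⇔ᵇ (ltv-ok (suc i) v0 (x ∷ ρ) lt))
          (λ x _ → trans (count1-ok (notᵇ (suc (suc i) <ᵛ v0)) (x ∷ ρ) (λ y → ¬? (lookup ρ i <? y))
                            (λ y _ → ¬-⇔ᵇ (ltv-ok (suc (suc i)) v0 (y ∷ x ∷ ρ) lt)))
                         (card-≯ (lookup ρ i) lt)))
        (cong (_* suc (lookup ρ i)) (card-≯ (lookup ρ i) lt))

    opaque
      unfolding orderᵗ

      order-ok : ∀ {r} (ρ : Vec ℕ r) → tm orderᵗ D ρ ≡ m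
      order-ok ρ = trans (count1-ok (squareᵗ v0 +ᵗ kᵗ <ᵗ sizeᵗ) ρ (_<? m) λ x x<N →
          ⇔ᵇ-map (to x) (from x) (lt-ok (squareᵗ v0 +ᵗ kᵗ) sizeᵗ (x ∷ ρ)
            (cong₂ _+_ (square-ok v0 (x ∷ ρ) x<N) (k-ok (x ∷ ρ))) (size-ok (x ∷ ρ)) ≤-refl))
        (card-< N m m≤N)
        where
        to : ∀ x → suc x * suc x + k < N → x < m
        to x lt = ≰⇒> λ m≤x → <⇒≱ lt (≤-trans (≤-reflexive (trans N≡ (+-comm k _)))
          (≤-trans (+-monoˡ-≤ k {suc (m * m)} (≤-trans (s≤s (*-mono-≤ m≤x m≤x)) (m≤m+n (suc (x * x)) (x + x))))
                   (≤-reflexive (cong (_+ k) (expand x)))))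
          where
          expand : ∀ x → suc (x * x) + (x + x) ≡ suc x * suc x
          expand = solve-∀
        from : ∀ x → x < m → suc x * suc x + k < N
        from x lt = ≤-trans (s≤s (+-monoˡ-≤ k (*-mono-≤ lt lt))) (≤-reflexive (trans (+-comm (suc (m * m)) k) (symm N≡)))

    rows-bound : ∀ x y → x < m → y < m → x * m + y < m * m
    rows-bound x y x<m y<m = ≤-trans (≤-trans (≤-reflexive (symm (+-suc (x * m) y))) (+-monoʳ-≤ (x * m) y<m))
      (≤-trans (≤-reflexive (+-comm (x * m) m)) (*-monoˡ-≤ m x<m))

    opaque
      unfolding entryᵗ

      entry-ok : ∀ {r} (i j : Fin r) ρ → lookup ρ i < m → lookup ρ j < m →
        tm (entryᵗ i j) D ρ ≡ k + suc (lookup ρ i * m + lookup ρ j)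
      entry-ok i j ρ i<m j<m = cong₂ _+_ (k-ok ρ) (cong suc (cong₂ _+_
        (trans (count-ok (v0 <ᵛ suc i) orderᵗ ρ (_<? lookup ρ i) m (λ x x<N → ltv-ok v0 (suc i) (x ∷ ρ) x<N) (λ x _ → order-ok (x ∷ ρ)))
               (cong (_* m) (card-< N (lookup ρ i) (≤-trans (<⇒≤ i<m) m≤N))))
        (var-ok j ρ (≤-trans (<⇒≤ j<m) m≤N))))

    edge-⇔ᵇ : ∀ x y → x < m → y < m → (edge x y ≡ true → nth w (k + suc (x * m + y)) ≡ 2F) × (nth w (k + suc (x * m + y)) ≡ 2F → edge x y ≡ true)
    edge-⇔ᵇ x y x<m y<m = (λ e → trans at (cong bit e)) , λ e → bit-injective (trans (symm at) e)
      where
      at : nth w (k + suc (x * m + y)) ≡ bit (edge x y)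
      at = subst₂ (λ a b → nth w (k + suc (a * m + b)) ≡ bit (edge a b)) (toℕ-fromℕ< x<m) (toℕ-fromℕ< y<m)
             (trans (edge-at (fromℕ< x<m) (fromℕ< y<m)) (cong bit (symm (edge-toℕ (fromℕ< x<m) (fromℕ< y<m)))))
      bit-injective : ∀ {b} → bit b ≡ 2F → b ≡ true
      bit-injective {true} _ = refl

    opaque
      unfolding edgeᵇ

      edge-ok : ∀ {r} (i j : Fin r) ρ → lookup ρ i < m → lookup ρ j < m → Ok (edgeᵇ i j) ρ (Is (edge (lookup ρ i) (lookup ρ j)))
      edge-ok i j ρ i<m j<m = ⇔ᵇ-map
        (λ { (p , _ , (≮ , ≯) , e) → proj₂ (edge-⇔ᵇ (lookup ρ i) (lookup ρ j) i<m j<m) (subst (λ q → nth w q ≡ 2F) (≤-antisym (≮⇒≥ ≯) (≮⇒≥ ≮)) e) })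
        (λ e → entry , entry<N , (<-irrefl refl , <-irrefl refl) , proj₁ (edge-⇔ᵇ (lookup ρ i) (lookup ρ j) i<m j<m) e)
        (ex-ok ((notᵇ (varᵗ v0 <ᵗ entryᵗ (suc i) (suc j)) andᵇ notᵇ (entryᵗ (suc i) (suc j) <ᵗ varᵗ v0)) andᵇ symᵇ v0 2F) ρ
          (λ x x<N → ∧-⇔ᵇ (∧-⇔ᵇ
              (¬-⇔ᵇ (lt-ok (varᵗ v0) (entryᵗ (suc i) (suc j)) (x ∷ ρ) (var-ok v0 (x ∷ ρ) (<⇒≤ x<N)) (entry-ok (suc i) (suc j) (x ∷ ρ) i<m j<m) (<⇒≤ entry<N)))
              (λ _ → ¬-⇔ᵇ (lt-ok (entryᵗ (suc i) (suc j)) (varᵗ v0) (x ∷ ρ) (entry-ok (suc i) (suc j) (x ∷ ρ) i<m j<m) (var-ok v0 (x ∷ ρ) (<⇒≤ x<N)) (<⇒≤ x<N))))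
            (λ _ → sym-ok v0 2F (x ∷ ρ) x<N)))
        where
        entry : ℕ
        entry = k + suc (lookup ρ i * m + lookup ρ j)
        entry<N : entry < N
        entry<N = ≤-trans (≤-reflexive (symm (+-suc k _))) (≤-trans (+-monoʳ-≤ k (s≤s (rows-bound _ _ i<m j<m))) (≤-reflexive (symm N≡)))

    opaque
      unfolding closedᵇ

      closed-ok : ∀ {r} (i j : Fin r) ρ → lookup ρ i < m → lookup ρ j < m → Ok (closedᵇ i j) ρ (Is (Ê (lookup ρ i) (lookup ρ j)))
      closed-ok i j ρ i<m j<m = ⇔ᵇ-map to from (¬-⇔ᵇ (∧-⇔ᵇ
          (¬-⇔ᵇ (∧-⇔ᵇ (¬-⇔ᵇ (ltv-ok i j ρ (≤-trans i<m m≤N))) (λ _ → ¬-⇔ᵇ (ltv-ok j i ρ (≤-trans j<m m≤N)))))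
          (λ _ → ¬-⇔ᵇ (edge-ok i j ρ i<m j<m))))
        where
        x y : ℕ
        x = lookup ρ i
        y = lookup ρ j
        or : Ê x y ⇔ᵇ x ≡ y ⊎ Is (edge x y)
        or = ∨-⇔ᵇ (≡-⇔ᵇ x y) (is-⇔ᵇ (edge x y))
        to : ¬ (¬ (¬ x < y × ¬ y < x) × ¬ Is (edge x y)) → Is (Ê x y)
        to ¬¬e = proj₂ or (decidable-stable ((x ≟ y) ⊎-dec is? (edge x y)) λ ¬e →
          ¬¬e ((λ (≮ , ≯) → ¬e (inj₁ (≤-antisym (≮⇒≥ ≯) (≮⇒≥ ≮)))) , ¬e ∘ inj₂))
        from : Is (Ê x y) → ¬ (¬ (¬ x < y × ¬ y < x) × ¬ Is (edge x y))
        from e (≢ , ¬e) = [ (λ eq → ≢ ((λ lt → <-irrefl eq lt) , (λ lt → <-irrefl (symm eq) lt))) , ¬e ]′ (proj₁ or e)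

    opaque
      unfolding liveᵇ

      live-ok : ∀ {r} (i : Fin r) ρ → lookup ρ i < N → Ok (liveᵇ i) ρ (Is (alive D (lookup ρ i)))
      live-ok i ρ lt = ⇔ᵇ-map (proj₂ (alive-⇔ᵇ D (lookup ρ i))) (proj₁ (alive-⇔ᵇ D (lookup ρ i)))
        (∧-⇔ᵇ (lt-ok (varᵗ i) orderᵗ ρ (var-ok i ρ (<⇒≤ lt)) (order-ok ρ) m≤N)
          (λ _ → ¬-⇔ᵇ (⇔ᵇ-map proj₂ (λ p → lt , p) (∧-⇔ᵇ (<-⇔ᵇ (lookup ρ i) N) (λ _ → is-⇔ᵇ (D (lookup ρ i)))))))

    open Semantics N k (alive D) (alive< D) Ê

    translate-ok : ∀ {r} (φ : GF r) ρ → (∀ i → Is (alive D (lookup ρ i))) → Ok (translate φ) ρ (⟦ φ ⟧ ρ)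
    private
      live-body : ∀ {r} (φ : GF (suc r)) ρ → (∀ i → Is (alive D (lookup ρ i))) → ∀ x → x < N →
        Ok (liveᵇ v0 andᵇ translate φ) (x ∷ ρ) (Is (alive D x) × ⟦ φ ⟧ (x ∷ ρ))
      live-body φ ρ live x x<N = ∧-⇔ᵇ (live-ok v0 (x ∷ ρ) x<N) (λ v → translate-ok φ (x ∷ ρ) (λ { zero → v ; (suc i) → live i }))

    translate-ok (adjᶠ i j) ρ live = closed-ok i j ρ (alive<m D _ (live i)) (alive<m D _ (live j))
    translate-ok (φ ∧ᶠ ψ) ρ live = ∧-⇔ᵇ (translate-ok φ ρ live) (λ _ → translate-ok ψ ρ live)
    translate-ok (φ ∨ᶠ ψ) ρ live = ⇔ᵇ-map
      (λ h → decidable-stable (dec φ ρ ⊎-dec dec ψ ρ) λ ¬e → h (¬e ∘ inj₁ , ¬e ∘ inj₂))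
      (λ e (¬p , ¬q) → [ ¬p , ¬q ]′ e)
      (¬-⇔ᵇ (∧-⇔ᵇ (¬-⇔ᵇ (translate-ok φ ρ live)) (λ _ → ¬-⇔ᵇ (translate-ok ψ ρ live))))
    translate-ok (φ ⇒ᶠ ψ) ρ live = ⇔ᵇ-map
      (λ h p → decidable-stable (dec ψ ρ) λ ¬q → h (p , ¬q))
      (λ f (p , ¬q) → ¬q (f p))
      (¬-⇔ᵇ (∧-⇔ᵇ (translate-ok φ ρ live) (λ _ → ¬-⇔ᵇ (translate-ok ψ ρ live))))
    translate-ok (¬ᶠ φ) ρ live = ¬-⇔ᵇ (translate-ok φ ρ live)
    translate-ok (∀ᶠ φ) ρ live = ⇔ᵇ-map to from
      (¬-⇔ᵇ (ex-ok (liveᵇ v0 andᵇ notᵇ (translate φ)) ρ λ x x<N →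
        ∧-⇔ᵇ (live-ok v0 (x ∷ ρ) x<N) (λ v → ¬-⇔ᵇ (translate-ok φ (x ∷ ρ) (λ { zero → v ; (suc i) → live i })))))
      where
      to : ¬ (∃ λ x → x < N × (Is (alive D x) × ¬ ⟦ φ ⟧ (x ∷ ρ))) → ∀ x → Is (alive D x) → ⟦ φ ⟧ (x ∷ ρ)
      to h x v = decidable-stable (dec φ (x ∷ ρ)) λ ¬p → h (x , alive< D x v , v , ¬p)
      from : (∀ x → Is (alive D x) → ⟦ φ ⟧ (x ∷ ρ)) → ¬ (∃ λ x → x < N × (Is (alive D x) × ¬ ⟦ φ ⟧ (x ∷ ρ)))
      from f (x , _ , v , ¬p) = ¬p (f x v)
    translate-ok (∃ᶠ φ) ρ live = ⇔ᵇ-map to from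
      (ex-ok (liveᵇ v0 andᵇ translate φ) ρ (live-body φ ρ live))
      where
      to : (∃ λ x → x < N × (Is (alive D x) × ⟦ φ ⟧ (x ∷ ρ))) → ∃ λ x → Is (alive D x) × ⟦ φ ⟧ (x ∷ ρ)
      to (x , _ , r) = x , r
      from : (∃ λ x → Is (alive D x) × ⟦ φ ⟧ (x ∷ ρ)) → ∃ λ x → x < N × (Is (alive D x) × ⟦ φ ⟧ (x ∷ ρ))
      from (x , v , p) = x , alive< D x v , v , p
    translate-ok (many c e φ) ρ live =
      lt-ok (thresholdᵗ c e) (sumᵗ (liveᵇ v0 andᵇ translate φ ?ᵗ oneᵗ)) ρ (threshold-ok c e ρ)
        (count1-ok (liveᵇ v0 andᵇ translate φ) ρ counted? (live-body φ ρ live)) (card-≤ N counted?)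
      where
      counted? : Decidable (λ x → Is (alive D x) × ⟦ φ ⟧ (x ∷ ρ))
      counted? x = V? x ×-dec dec φ (x ∷ ρ)

-- Edit distances

sumFin : ∀ n → (Fin n → ℕ) → ℕ
sumFin zero    f = 0
sumFin (suc n) f = f zero + sumFin n (f ∘ suc)

sumFin-cong : ∀ n {f g : Fin n → ℕ} → (∀ i → f i ≡ g i) → sumFin n f ≡ sumFin n g
sumFin-cong zero    h = refl
sumFin-cong (suc n) h = cong₂ _+_ (h zero) (sumFin-cong n (h ∘ suc))

sumFin-+ : ∀ n (f g : Fin n → ℕ) → sumFin n (λ i → f i + g i) ≡ sumFin n f + sumFin n g
sumFin-+ zero    f g = refl
sumFin-+ (suc n) f g = trans (cong (f zero + g zero +_) (sumFin-+ n (f ∘ suc) (g ∘ suc)))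
  (+-interchange (f zero) (g zero) (sumFin n (f ∘ suc)) (sumFin n (g ∘ suc)))

sumFin-0 : ∀ n → sumFin n (λ _ → 0) ≡ 0
sumFin-0 zero    = refl
sumFin-0 (suc n) = sumFin-0 n

sumFin-swap : ∀ m n (f : Fin m → Fin n → ℕ) → sumFin m (λ i → sumFin n (f i)) ≡ sumFin n (λ j → sumFin m (λ i → f i j))
sumFin-swap zero    n f = symm (sumFin-0 n)
sumFin-swap (suc m) n f = trans (cong (sumFin n (f zero) +_) (sumFin-swap m n (f ∘ suc))) (symm (sumFin-+ n (f zero) _))

term≤sumFin : ∀ n (f : Fin n → ℕ) i → f i ≤ sumFin n f
term≤sumFin (suc n) f zero    = m≤m+n _ _
term≤sumFin (suc n) f (suc i) = ≤-trans (term≤sumFin n (f ∘ suc) i) (m≤n+m _ _)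

two-terms≤sumFin : ∀ n (f : Fin n → ℕ) i j → i ≢ j → f i + f j ≤ sumFin n f
two-terms≤sumFin (suc n) f zero    zero    ne = ⊥-elim (ne refl)
two-terms≤sumFin (suc n) f zero    (suc j) ne = +-monoʳ-≤ (f zero) (term≤sumFin n (f ∘ suc) j)
two-terms≤sumFin (suc n) f (suc i) zero    ne =
  ≤-trans (≤-reflexive (+-comm (f (suc i)) (f zero))) (+-monoʳ-≤ (f zero) (term≤sumFin n (f ∘ suc) i))
two-terms≤sumFin (suc n) f (suc i) (suc j) ne = ≤-trans (two-terms≤sumFin n (f ∘ suc) i j (ne ∘ cong suc)) (m≤n+m _ _)

toNat : Bool → ℕ
toNat b = if b then 1 else 0

module _ {A : Set} (p : A → Bool) where

  count-∷ : ∀ x xs → count p (x ∷ xs) ≡ toNat (p x) + count p xs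
  count-∷ x xs with p x
  ... | true  = refl
  ... | false = refl

  count-++ : ∀ xs ys → count p (xs ++ ys) ≡ count p xs + count p ys
  count-++ []       ys = refl
  count-++ (x ∷ xs) ys = trans (count-∷ x (xs ++ ys)) (trans (cong (toNat (p x) +_) (count-++ xs ys))
    (trans (symm (+-assoc (toNat (p x)) _ _)) (cong (_+ count p ys) (symm (count-∷ x xs)))))

  count-map : ∀ {n} {B : Set} (h : B → A) (g : Fin n → B) → count p (List.map h (tabulate g)) ≡ sumFin n (λ i → toNat (p (h (g i))))
  count-map {zero}  h g = refl
  count-map {suc n} h g = trans (count-∷ (h (g zero)) (List.map h (tabulate (g ∘ suc)))) (cong (toNat (p (h (g zero))) +_) (count-map h (g ∘ suc)))

  count-concatMap : ∀ {n} {B : Set} (f : B → List A) (g : Fin n → B) →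
    count p (concatMap f (tabulate g)) ≡ sumFin n (λ i → count p (f (g i)))
  count-concatMap {zero}  f g = refl
  count-concatMap {suc n} f g = trans (count-++ (f (g zero)) (concatMap f (tabulate (g ∘ suc)))) (cong (count p (f (g zero)) +_) (count-concatMap f (g ∘ suc)))

count-pairs : ∀ {n} (p : Fin n × Fin n → Bool) → count p (pairs n) ≡ sumFin n (λ i → sumFin n (λ j → toNat (p (i , j))))
count-pairs {n} p = trans (count-concatMap p (λ i → List.map (λ j → (i , j)) (allFin n)) id)
  (sumFin-cong n λ i → count-map p (λ j → (i , j)) id)

SymIrr : ∀ {n} → (Fin n → Fin n → Bool) → Set
SymIrr A = (∀ i j → A i j ≡ A j i) × (∀ i → A i i ≡ false)

-- Ordered pairs meet every unordered pair twice, and the diagonal contributes nothing.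
double-editDistance : ∀ {n} (A B : Fin n → Fin n → Bool) → SymIrr A → SymIrr B →
  sumFin n (λ i → sumFin n (λ j → toNat (A i j xor B i j))) ≡ 2 * editDistance A B
double-editDistance {n} A B (A-sym , A-irr) (B-sym , B-irr) = begin
  sumFin n (λ i → sumFin n (λ j → toNat (A i j xor B i j)))
    ≡⟨ sumFin-cong n (λ i → trans (sumFin-cong n (split i)) (sumFin-+ n (half i) (λ j → half j i))) ⟩
  sumFin n (λ i → sumFin n (half i) + sumFin n (λ j → half j i))
    ≡⟨ sumFin-+ n _ _ ⟩
  total + sumFin n (λ i → sumFin n (λ j → half j i))
    ≡⟨ cong (total +_) (trans (sumFin-swap n n (λ i j → half j i)) (symm (+-identityʳ total))) ⟩
  2 * total
    ≡⟨ cong (2 *_) (symm edits) ⟩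
  2 * editDistance A B ∎
  where
  open ≡-Reasoning
  diff : Fin n → Fin n → Bool
  diff i j = A i j xor B i j
  half : Fin n → Fin n → ℕ
  half i j = toNat ((toℕ i <ᵇ toℕ j) ∧ diff i j)
  total : ℕ
  total = sumFin n (λ i → sumFin n (half i))
  edits : editDistance A B ≡ total
  edits = count-pairs {n} _
  <ᵇ-false : ∀ {x y} → ¬ x < y → (x <ᵇ y) ≡ false
  <ᵇ-false {x} {y} ≮ with x <ᵇ y | proj₁ (<-⇔ᵇ x y)
  ... | true  | f = ⊥-elim (≮ (f refl))
  ... | false | _ = refl
  split : ∀ i j → toNat (diff i j) ≡ half i j + half j i
  split i j with <-cmp (toℕ i) (toℕ j)
  ... | tri< lt _ ≯ rewrite proj₂ (<-⇔ᵇ (toℕ i) (toℕ j)) lt | <ᵇ-false ≯ = symm (+-identityʳ _)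
  ... | tri> ≮ _ gt rewrite proj₂ (<-⇔ᵇ (toℕ j) (toℕ i)) gt | <ᵇ-false ≮ | A-sym i j | B-sym i j = refl
  ... | tri≈ ≮ eq ≯ rewrite <ᵇ-false ≮ | <ᵇ-false ≯ with toℕ-injective eq
  ...   | refl rewrite A-irr i | B-irr i = refl

-- Relates a graph on `Fin` to its copy on a set `V` of naturals, along a bijection `e`. It serves
-- the input graph, with `toℕ`, and the output graph, with the list of surviving vertices;
-- `transport` carries the edit counts across.
module Transfer (N k : ℕ) (E : Rel₂) (E-refl : ∀ x → Is (E x x)) (E-sym : ∀ x y → Is (E x y) → Is (E y x))
  (V : ℕ → Bool) (K : Graph) (e : Fin (n K) → ℕ)
  (e∈V : ∀ i → Is (V (e i))) (onto : ∀ x → Is (V x) → ∃ λ i → e i ≡ x) (e-injective : ∀ i j → e i ≡ e j → i ≡ j)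
  (adj-e : ∀ i j → E (e i) (e j) ≡ (e i ≡ᵇ e j) ∨ adj K i j)
  (transport : ∀ g → sumFin (n K) (g ∘ e) ≡ sum N (λ x → if V x then g x else 0)) where

  open Editing N k E E-refl E-sym

  private
    m : ℕ
    m = n K

    K-ok : SymIrr (adj K)
    K-ok = Graph.sym K , Graph.irr K

    same≡ : ∀ i → (e i ≡ᵇ e i) ≡ true
    same≡ i = proj₂ (≡-⇔ᵇ (e i) (e i)) refl

    apart≡ : ∀ {i j} → i ≢ j → (e i ≡ᵇ e j) ≡ false
    apart≡ {i} {j} ne with e i ≡ᵇ e j | proj₁ (≡-⇔ᵇ (e i) (e j))
    ... | true  | f = ⊥-elim (ne (e-injective i j (f refl)))
    ... | false | _ = refl

    distance≡ : ∀ (H : Rel₂) (A : Fin m → Fin m → Bool) → SymIrr A → (∀ i j → H (e i) (e j) ≡ (e i ≡ᵇ e j) ∨ A i j) →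
      distance V H ≡ 2 * editDistance (adj K) A
    distance≡ H A A-ok H-e = begin
      distance V H
        ≡⟨ sum-cong N (λ x _ → rows x) ⟩
      sum N (λ x → if V x then sum N (λ y → if V y then ne x y else 0) else 0)
        ≡⟨ symm (transport (λ x → sum N (λ y → if V y then ne x y else 0))) ⟩
      sumFin m (λ i → sum N (λ y → if V y then ne (e i) y else 0))
        ≡⟨ sumFin-cong m (λ i → symm (transport (ne (e i)))) ⟩
      sumFin m (λ i → sumFin m (λ j → ne (e i) (e j)))
        ≡⟨ sumFin-cong m (λ i → sumFin-cong m (λ j → pointwise i j)) ⟩
      sumFin m (λ i → sumFin m (λ j → toNat (adj K i j xor A i j)))
        ≡⟨ double-editDistance (adj K) A K-ok A-ok ⟩
      2 * editDistance (adj K) A ∎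
      where
      open ≡-Reasoning
      ne : ℕ → ℕ → ℕ
      ne x y = ind (¬? (E x y Bool.≟ H x y))
      rows : ∀ x → sum N (λ y → ind (differ? V H x y)) ≡ (if V x then sum N (λ y → if V y then ne x y else 0) else 0)
      rows x with V x
      ... | false = sum-0 N
      ... | true  = sum-cong N λ y _ → cell y
        where
        cell : ∀ y → ind (is? true ×-dec is? (V y) ×-dec ¬? (E x y Bool.≟ H x y)) ≡ (if V y then ne x y else 0)
        cell y with V y
        ... | false = refl
        ... | true  = refl
      xor-ne : ∀ a b → ind (¬? (a Bool.≟ b)) ≡ toNat (a xor b)
      xor-ne true  true  = refl
      xor-ne true  false = refl
      xor-ne false true  = refl
      xor-ne false false = refl
      pointwise : ∀ i j → ne (e i) (e j) ≡ toNat (adj K i j xor A i j)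
      pointwise i j with i Fin.≟ j
      ... | yes refl rewrite adj-e i i | H-e i i | same≡ i | proj₂ K-ok i | proj₂ A-ok i = refl
      ... | no i≢j   rewrite adj-e i j | H-e i j | apart≡ i≢j = xor-ne (adj K i j) (A i j)

    closed : ∀ {H : Rel₂} {A : Fin m → Fin m → Bool} → (∀ i j → H (e i) (e j) ≡ (e i ≡ᵇ e j) ∨ A i j) →
      ∀ i j → Is (H (e i) (e j)) → i ≡ j ⊎ A i j ≡ true
    closed {H} {A} H-e i j h with i Fin.≟ j
    ... | yes eq = inj₁ eq
    ... | no ne  = inj₂ (trans (symm (trans (H-e i j) (cong (_∨ A i j) (apart≡ ne)))) h)

    opened : ∀ {H : Rel₂} {A : Fin m → Fin m → Bool} → (∀ i j → H (e i) (e j) ≡ (e i ≡ᵇ e j) ∨ A i j) →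
      ∀ i j → i ≡ j ⊎ A i j ≡ true → Is (H (e i) (e j))
    opened {A = A} H-e i j (inj₁ refl) = trans (H-e i i) (cong (_∨ A i i) (same≡ i))
    opened H-e i j (inj₂ a)    = trans (H-e i j) (trans (cong ((e i ≡ᵇ e j) ∨_) a) (Bool.∨-zeroʳ _))

  -- An induced C₄ or P₄ is a path p u w q with neither p w nor u q adjacent.
  tp-closed : ∀ (A : Fin m → Fin m → Bool) → SymIrr A → TriviallyPerfect A → ∀ p u w q →
    p ≡ u ⊎ A p u ≡ true → u ≡ w ⊎ A u w ≡ true → w ≡ q ⊎ A w q ≡ true → (p ≡ w ⊎ A p w ≡ true) ⊎ (u ≡ q ⊎ A u q ≡ true)
  tp-closed A (A-sym , A-irr) (no-C₄ , no-P₄) p u w q pu uw wq =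
    decidable-stable (((p Fin.≟ w) ⊎-dec is? (A p w)) ⊎-dec ((u Fin.≟ q) ⊎-dec is? (A u q))) λ no-chord →
      let ¬pw = no-chord ∘ inj₁
          ¬uq = no-chord ∘ inj₂
      in go ¬pw ¬uq pu uw wq
    where
    false-of : ∀ {b} → ¬ (b ≡ true) → b ≡ false
    false-of {true}  h = ⊥-elim (h refl)
    false-of {false} h = refl
    irrefl : ∀ {i j} → A i j ≡ true → i ≢ j
    irrefl {i} a refl with () ← trans (symm a) (A-irr i)
    go : ¬ (p ≡ w ⊎ A p w ≡ true) → ¬ (u ≡ q ⊎ A u q ≡ true) →
      p ≡ u ⊎ A p u ≡ true → u ≡ w ⊎ A u w ≡ true → w ≡ q ⊎ A w q ≡ true → ⊥
    go ¬pw ¬uq (inj₁ refl) uw wq = ¬pw uw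
    go ¬pw ¬uq pu (inj₁ refl) wq = ¬pw pu
    go ¬pw ¬uq pu uw (inj₁ refl) = ¬uq uw
    go ¬pw ¬uq (inj₂ pu) (inj₂ uw) (inj₂ wq) = last (is? (A p q))
      where
      p≢q : p ≢ q
      p≢q refl = ¬uq (inj₂ (trans (A-sym u p) pu))
      distinct : AllDistinct p u w q
      distinct = irrefl pu , ¬pw ∘ inj₁ , p≢q , irrefl uw , ¬uq ∘ inj₁ , irrefl wq
      last : Dec (Is (A p q)) → ⊥
      last (yes pq) = no-C₄ (p , u , w , q , distinct , pu , uw , wq , trans (A-sym q p) pq , false-of (¬pw ∘ inj₂) , false-of (¬uq ∘ inj₂))
      last (no ¬pq) = no-P₄ (p , u , w , q , distinct , pu , uw , wq , false-of (¬pw ∘ inj₂) , false-of (¬uq ∘ inj₂) , false-of ¬pq)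

  toSolution : YesInstance K k → Solution V
  toSolution (A , A-sym , A-irr , few , tp) = record
    { H = H ; H-refl = H-refl ; H-sym = H-sym
    ; H-tp = λ p u w q Vp Vu Vw Vq → path (onto p Vp) (onto u Vu) (onto w Vw) (onto q Vq)
    ; H-few = ≤-trans (≤-reflexive (distance≡ H A (A-sym , A-irr) H-e)) (*-monoʳ-≤ 2 few) }
    where
    index? : ∀ x → Dec (∃ λ i → e i ≡ x)
    index? x = Fin.any? (λ i → e i ≟ x)
    via : ∀ {x y} → Dec (∃ λ i → e i ≡ x) → Dec (∃ λ i → e i ≡ y) → Bool
    via (yes (i , _)) (yes (j , _)) = A i j
    via _             _             = false
    H : Rel₂
    H x y = (x ≡ᵇ y) ∨ via (index? x) (index? y)
    H-refl : ∀ x → Is (H x x)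
    H-refl x rewrite proj₂ (≡-⇔ᵇ x x) refl = refl
    via-sym : ∀ {x y} (a : Dec (∃ λ i → e i ≡ x)) (b : Dec (∃ λ i → e i ≡ y)) → via a b ≡ via b a
    via-sym (yes (i , _)) (yes (j , _)) = A-sym i j
    via-sym (yes _) (no _) = refl
    via-sym (no _) (yes _) = refl
    via-sym (no _) (no _) = refl
    ≡ᵇ-sym : ∀ x y → (x ≡ᵇ y) ≡ (y ≡ᵇ x)
    ≡ᵇ-sym x y = Bool-iff (proj₂ (≡-⇔ᵇ y x) ∘ symm ∘ proj₁ (≡-⇔ᵇ x y)) (proj₂ (≡-⇔ᵇ x y) ∘ symm ∘ proj₁ (≡-⇔ᵇ y x))
    H-sym : ∀ x y → Is (H x y) → Is (H y x)
    H-sym x y = subst Is (cong₂ _∨_ (≡ᵇ-sym x y) (via-sym (index? x) (index? y)))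
    via-e : ∀ i j (a : Dec (∃ λ x → e x ≡ e i)) (b : Dec (∃ λ x → e x ≡ e j)) → via a b ≡ A i j
    via-e i j (yes (i′ , p)) (yes (j′ , q)) = cong₂ A (e-injective i′ i p) (e-injective j′ j q)
    via-e i j (no ¬p) _ = ⊥-elim (¬p (i , refl))
    via-e i j (yes _) (no ¬q) = ⊥-elim (¬q (j , refl))
    H-e : ∀ i j → H (e i) (e j) ≡ (e i ≡ᵇ e j) ∨ A i j
    H-e i j = cong ((e i ≡ᵇ e j) ∨_) (via-e i j (index? (e i)) (index? (e j)))
    path : ∀ {p u w q} → (∃ λ i → e i ≡ p) → (∃ λ i → e i ≡ u) → (∃ λ i → e i ≡ w) → (∃ λ i → e i ≡ q) →
      Is (H p u) → Is (H u w) → Is (H w q) → Is (H p w) ⊎ Is (H u q)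
    path (p , refl) (u , refl) (w , refl) (q , refl) pu uw wq =
      [ inj₁ ∘ opened {H} {A} H-e p w , inj₂ ∘ opened {H} {A} H-e u q ]′
        (tp-closed A (A-sym , A-irr) tp p u w q (closed {H} {A} H-e p u pu) (closed {H} {A} H-e u w uw) (closed {H} {A} H-e w q wq))

  fromSolution : Solution V → YesInstance K k
  fromSolution S = A , A-sym , A-irr ,
      *-cancelˡ-≤ 2 (≤-trans (≤-reflexive (symm (distance≡ H A (A-sym , A-irr) H-e))) H-few) , no-C₄ , no-P₄
    where
    open Solution S
    A : Fin m → Fin m → Bool
    A i j = not (e i ≡ᵇ e j) ∧ H (e i) (e j)
    A-sym : ∀ i j → A i j ≡ A j i
    A-sym i j = cong₂ (λ a b → not a ∧ b)
      (Bool-iff (proj₂ (≡-⇔ᵇ (e j) (e i)) ∘ symm ∘ proj₁ (≡-⇔ᵇ (e i) (e j))) (proj₂ (≡-⇔ᵇ (e i) (e j)) ∘ symm ∘ proj₁ (≡-⇔ᵇ (e j) (e i))))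
      (Bool-iff (H-sym (e i) (e j)) (H-sym (e j) (e i)))
    A-irr : ∀ i → A i i ≡ false
    A-irr i rewrite same≡ i = refl
    H-e : ∀ i j → H (e i) (e j) ≡ (e i ≡ᵇ e j) ∨ A i j
    H-e i j with i Fin.≟ j
    ... | yes refl rewrite same≡ i = H-refl (e i)
    ... | no ne rewrite apart≡ ne = refl
    chord : ∀ p u w q → A p u ≡ true → A u w ≡ true → A w q ≡ true → p ≢ w → u ≢ q → A p w ≡ true ⊎ A u q ≡ true
    chord p u w q pu uw wq p≢w u≢q =
      [ (λ h → inj₁ ([ ⊥-elim ∘ p≢w , id ]′ (closed {H} {A} H-e p w h)))
      , (λ h → inj₂ ([ ⊥-elim ∘ u≢q , id ]′ (closed {H} {A} H-e u q h))) ]′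
      (H-tp (e p) (e u) (e w) (e q) (e∈V p) (e∈V u) (e∈V w) (e∈V q)
        (opened {H} {A} H-e p u (inj₂ pu)) (opened {H} {A} H-e u w (inj₂ uw)) (opened {H} {A} H-e w q (inj₂ wq)))
    clash : ∀ {b} → b ≡ true → b ≡ false → ⊥
    clash refl ()
    no-C₄ : ¬ Σ (Fin m) λ a → Σ (Fin m) λ b → Σ (Fin m) λ c → Σ (Fin m) λ d → InducedC4 A a b c d
    no-C₄ (a , b , c , d , (_ , a≢c , _ , _ , b≢d , _) , ab , bc , cd , _ , ac , bd) =
      [ (λ h → clash h ac) , (λ h → clash h bd) ]′ (chord a b c d ab bc cd a≢c b≢d)
    no-P₄ : ¬ Σ (Fin m) λ a → Σ (Fin m) λ b → Σ (Fin m) λ c → Σ (Fin m) λ d → InducedP4 A a b c d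
    no-P₄ (a , b , c , d , (_ , a≢c , _ , _ , b≢d , _) , ab , bc , cd , ac , bd , _) =
      [ (λ h → clash h ac) , (λ h → clash h bd) ]′ (chord a b c d ab bc cd a≢c b≢d)

-- The kernelization program

module Sweeps (N : ℕ) (alive : (ℕ → Bool) → ℕ → Bool) (test : (ℕ → Bool) → ℕ → Bool) (kill : (ℕ → Bool) → ℕ → ℕ → Bool)
  (Sol : (ℕ → Bool) → Set)
  (safe : ∀ D v → v < N → Is (test D v) → Sol (kill D v) → Sol D)
  (shrinks : ∀ D v x → Is (alive (kill D v) x) → Is (alive D x))
  (test⇒alive : ∀ D v → v < N → Is (test D v) → Is (alive D v))
  (dies : ∀ D v → ¬ Is (alive (kill D v) v)) where

  visit : ℕ → (ℕ → Bool) → ℕ → Bool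
  visit v D = if test D v then kill D v else D

  sweepAll : (ℕ → Bool) → ℕ → Bool
  sweepAll = iterate N visit

  private
    size : (ℕ → Bool) → ℕ
    size D = card N (λ x → is? (alive D x))

    step-cases : ∀ v D → (test D v ≡ true × visit v D ≡ kill D v) ⊎ (test D v ≡ false × visit v D ≡ D)
    step-cases v D with test D v
    ... | true  = inj₁ (refl , refl)
    ... | false = inj₂ (refl , refl)

    step-safe : ∀ v D → v < N → Sol (visit v D) → Sol D
    step-safe v D v<N s with step-cases v D
    ... | inj₁ (t , eq) = safe D v v<N t (subst Sol eq s)
    ... | inj₂ (_ , eq) = subst Sol eq s

    step-shrinks : ∀ v D x → Is (alive (visit v D) x) → Is (alive D x)
    step-shrinks v D x a with step-cases v D
    ... | inj₁ (_ , eq) = shrinks D v x (subst (λ D → Is (alive D x)) eq a)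
    ... | inj₂ (_ , eq) = subst (λ D → Is (alive D x)) eq a

    sweep-safe : ∀ m D → m ≤ N → Sol (iterate m visit D) → Sol D
    sweep-safe zero    D le s = s
    sweep-safe (suc m) D le s = sweep-safe m D (<⇒≤ le) (step-safe m _ le s)

    sweep-shrinks : ∀ m D x → Is (alive (iterate m visit D) x) → Is (alive D x)
    sweep-shrinks zero    D x a = a
    sweep-shrinks (suc m) D x a = sweep-shrinks m D x (step-shrinks m _ x a)

    idle : ∀ m D → m ≤ N → (∀ x → x < N → test D x ≡ false) → iterate m visit D ≡ D
    idle zero    D le h = refl
    idle (suc m) D le h with iterate m visit D | idle m D (<⇒≤ le) h
    ... | _ | refl with step-cases m D
    ...   | inj₁ (t , _) with () ← trans (symm t) (h m le)
    ...   | inj₂ (_ , eq) = eq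

    kill-smaller : ∀ D v → v < N → Is (test D v) → size (kill D v) < size D
    kill-smaller D v v<N t = ≰⇒> λ le → dies D v
      (card-⊇ N (λ x → is? (alive (kill D v) x)) (λ x → is? (alive D x)) (λ x _ → shrinks D v x) le v v<N (test⇒alive D v v<N t))

    progress : ∀ m D → m ≤ N → (iterate m visit D ≡ D × (∀ x → x < m → test D x ≡ false)) ⊎ size (iterate m visit D) < size D
    progress zero    D le = inj₁ (refl , λ x ())
    progress (suc m) D le with progress m D (<⇒≤ le)
    ... | inj₂ smaller = inj₂ (≤-<-trans
            (card-mono N (λ x → is? (alive (visit m (iterate m visit D)) x)) (λ x → is? (alive (iterate m visit D) x))
              (λ x _ → step-shrinks m (iterate m visit D) x)) smaller)
    ... | inj₁ (same , h) rewrite same with step-cases m D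
    ...   | inj₁ (t , eq) = inj₂ (subst (λ D′ → size D′ < size D) (symm eq) (kill-smaller D m le t))
    ...   | inj₂ (f , eq) = inj₁ (eq , λ x x<1+m → [ h x , (λ { refl → f }) ]′ (m≤n⇒m<n∨m≡n (s≤s⁻¹ x<1+m)))

    Passed : (ℕ → Bool) → Set
    Passed D = ∀ x → x < N → test D x ≡ false

    -- A sweep that changes anything deletes a live vertex, and one that changes nothing has tested
    -- every vertex in the final state. Hence the size drops by one per sweep until stability.
    sweeps : ∀ r D → let D′ = iterate r (λ _ → sweepAll) D in Passed D′ ⊎ size D′ + r ≤ size D
    sweeps zero    D = inj₂ (≤-reflexive (+-identityʳ _))
    sweeps (suc r) D with iterate r (λ _ → sweepAll) D | sweeps r D
    ... | D′ | inj₁ stable = inj₁ (subst Passed (symm (idle N D′ ≤-refl stable)) stable)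
    ... | D′ | inj₂ bound with progress N D′ ≤-refl
    ...   | inj₁ (same , h) = inj₁ (subst Passed (symm same) h)
    ...   | inj₂ smaller = inj₂ (≤-trans (≤-reflexive (+-suc _ r)) (≤-trans (+-monoˡ-≤ r smaller) bound))

  final : (ℕ → Bool) → ℕ → Bool
  final = iterate N (λ _ → sweepAll)

  final-stable : ∀ D x → x < N → test (final D) x ≡ false
  final-stable D = [ id , exhausted ]′ (sweeps N D)
    where
    -- N deletions leave no live vertex, and the test accepts only live ones.
    exhausted : size (final D) + N ≤ size D → Passed (final D)
    exhausted le x x<N with test (final D) x in eq
    ... | false = refl
    ... | true = ⊥-elim (<⇒≱ positive (+-cancelʳ-≤ N _ _ (≤-trans le (card-≤ N (λ x → is? (alive D x))))))
      where
      positive : 0 < size (final D)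
      positive = ≤-trans (≤-reflexive (symm (ind-yes (is? (alive (final D) x)) (test⇒alive (final D) x x<N eq))))
                   (term≤sum N (λ x → ind (is? (alive (final D) x))) x<N)

  private
    many-safe : ∀ r D → Sol (iterate r (λ _ → sweepAll) D) → Sol D
    many-safe zero    D s = s
    many-safe (suc r) D s = many-safe r D (sweep-safe N _ ≤-refl s)

    many-shrink : ∀ r D x → Is (alive (iterate r (λ _ → sweepAll) D) x) → Is (alive D x)
    many-shrink zero    D x a = a
    many-shrink (suc r) D x a = many-shrink r D x (sweep-shrinks N _ x a)

  final-safe : ∀ D → Sol (final D) → Sol D
  final-safe = many-safe N

  final-shrinks : ∀ D x → Is (alive (final D) x) → Is (alive D x)
  final-shrinks = many-shrink N

-- Listing the surviving vertices

concatTo : {A : Set} → ℕ → (ℕ → List A) → List A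
concatTo zero    g = []
concatTo (suc n) g = concatTo n g ++ g n

concatTo-cong : {A : Set} → ∀ n {g h : ℕ → List A} → (∀ x → x < n → g x ≡ h x) → concatTo n g ≡ concatTo n h
concatTo-cong zero    e = refl
concatTo-cong (suc n) e = cong₂ _++_ (concatTo-cong n λ x p → e x (m≤n⇒m≤1+n p)) (e n ≤-refl)

collect : ℕ → (ℕ → Bool) → List ℕ
collect n V = concatTo n (λ x → if V x then x ∷ [] else [])

concatMap-collect : {A : Set} (g : ℕ → List A) (V : ℕ → Bool) → ∀ n →
  concatMap g (collect n V) ≡ concatTo n (λ x → if V x then g x else [])
concatMap-collect g V zero    = refl
concatMap-collect g V (suc n) = trans (List.concatMap-++ g (collect n V) _) (cong₂ _++_ (concatMap-collect g V n) (single (V n)))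
  where
  single : ∀ b → concatMap g (if b then n ∷ [] else []) ≡ (if b then g n else [])
  single true  = List.++-identityʳ (g n)
  single false = refl

concatTo-replicate : {A : Set} (a : A) → ∀ N k → k ≤ N → concatTo N (λ x → if x <ᵇ k then a ∷ [] else []) ≡ replicate k a
concatTo-replicate a N k k≤N = go N k≤N
  where
  snoc : ∀ n → replicate n a ++ a ∷ [] ≡ replicate (suc n) a
  snoc zero    = refl
  snoc (suc n) = cong (a ∷_) (snoc n)
  inside : ∀ n → n ≤ k → concatTo n (λ x → if x <ᵇ k then a ∷ [] else []) ≡ replicate n a
  inside zero    _  = refl
  inside (suc n) lt rewrite proj₂ (<-⇔ᵇ n k) lt = trans (cong (_++ a ∷ []) (inside n (<⇒≤ lt))) (snoc n)
  go : ∀ N → k ≤ N → concatTo N (λ x → if x <ᵇ k then a ∷ [] else []) ≡ replicate k a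
  go zero    z≤n = refl
  go (suc N) le with m≤n⇒m<n∨m≡n le
  ... | inj₂ refl = inside (suc N) ≤-refl
  ... | inj₁ lt with N <ᵇ k | proj₁ (<-⇔ᵇ N k)
  ...   | true  | f = ⊥-elim (<⇒≱ (f refl) (s≤s⁻¹ lt))
  ...   | false | _ = trans (List.++-identityʳ _) (go N (s≤s⁻¹ lt))

sumList : (ℕ → ℕ) → List ℕ → ℕ
sumList g []       = 0
sumList g (x ∷ xs) = g x + sumList g xs

sumList-++ : ∀ g xs ys → sumList g (xs ++ ys) ≡ sumList g xs + sumList g ys
sumList-++ g []       ys = refl
sumList-++ g (x ∷ xs) ys = trans (cong (g x +_) (sumList-++ g xs ys)) (symm (+-assoc (g x) _ _))

sumList-collect : ∀ g V n → sumList g (collect n V) ≡ sum n (λ x → if V x then g x else 0)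
sumList-collect g V zero    = refl
sumList-collect g V (suc n) = trans (sumList-++ g (collect n V) _)
  (trans (cong₂ _+_ (sumList-collect g V n) (single (V n))) (+-comm (sum n (λ x → if V x then g x else 0)) _))
  where
  single : ∀ b → sumList g (if b then n ∷ [] else []) ≡ (if b then g n else 0)
  single true  = +-identityʳ (g n)
  single false = refl

sumFin-lookup : ∀ g xs → sumFin (length xs) (g ∘ List.lookup xs) ≡ sumList g xs
sumFin-lookup g []       = refl
sumFin-lookup g (x ∷ xs) = cong (g x +_) (sumFin-lookup g xs)

sum-first : ∀ n f → sum (suc n) f ≡ f 0 + sum n (f ∘ suc)
sum-first zero    f = refl
sum-first (suc n) f = trans (cong (f (suc n) +_) (sum-first n f))
  (trans (symm (+-assoc (f (suc n)) (f 0) _)) (trans (cong (_+ sum n (f ∘ suc)) (+-comm (f (suc n)) (f 0))) (+-assoc (f 0) _ _)))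

sumFin-toℕ : ∀ n g → sumFin n (g ∘ toℕ) ≡ sum n g
sumFin-toℕ zero    g = refl
sumFin-toℕ (suc n) g = trans (cong (g 0 +_) (sumFin-toℕ n (g ∘ suc))) (symm (sum-first n g))

sum-prefix : ∀ m N (g F : ℕ → ℕ) → m ≤ N → (∀ x → x < m → F x ≡ g x) → (∀ x → m ≤ x → F x ≡ 0) → sum N F ≡ sum m g
sum-prefix zero    zero    g F le inside outside = refl
sum-prefix m       (suc N) g F le inside outside with m≤n⇒m<n∨m≡n le
... | inj₁ lt   = trans (cong (_+ sum N F) (outside N (s≤s⁻¹ lt))) (sum-prefix m N g F (s≤s⁻¹ lt) inside outside)
... | inj₂ refl = sum-cong (suc N) inside

module Collected (N : ℕ) (V : ℕ → Bool) (V< : ∀ x → Is (V x) → x < N) where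

  vertices : List ℕ
  vertices = collect N V

  vertex : Fin (length vertices) → ℕ
  vertex = List.lookup vertices

  -- The one counting fact behind the bijection: membership, surjectivity and injectivity of
  -- `vertex` follow from it, each with a suitable indicator function for `g`.
  transport : ∀ g → sumFin (length vertices) (g ∘ vertex) ≡ sum N (λ x → if V x then g x else 0)
  transport g = trans (sumFin-lookup g vertices) (sumList-collect g V N)

  vertex∈V : ∀ i → Is (V (vertex i))
  vertex∈V i = decidable-stable (is? _) λ ¬v → <⇒≱ (pos ¬v) (≤-reflexive none)
    where
    g : ℕ → ℕ
    g x = if V x then 0 else 1
    pos : ¬ Is (V (vertex i)) → 0 < sumFin (length vertices) (g ∘ vertex)
    pos ¬v = ≤-trans (one (V (vertex i)) ¬v) (term≤sumFin _ (g ∘ vertex) i)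
      where
      one : ∀ b → ¬ Is b → 1 ≤ (if b then 0 else 1)
      one true  h = ⊥-elim (h refl)
      one false h = ≤-refl
    none : sumFin (length vertices) (g ∘ vertex) ≡ 0
    none = trans (transport g) (trans (sum-cong N (λ x _ → zero′ (V x))) (sum-0 N))
      where
      zero′ : ∀ b → (if b then (if b then 0 else 1) else 0) ≡ 0
      zero′ true  = refl
      zero′ false = refl

  at : ℕ → ℕ → ℕ
  at a x = ind (x ≟ a)

  vertex-onto : ∀ x → Is (V x) → ∃ λ i → vertex i ≡ x
  vertex-onto x vx = decidable-stable (Fin.any? (λ i → vertex i ≟ x)) λ ∄ →
    <⇒≱ positive (≤-reflexive (trans (symm (transport (at x))) (trans (sumFin-cong (length vertices) (λ i → ind-no (vertex i ≟ x) (λ e → ∄ (i , e)))) (sumFin-0 (length vertices)))))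
    where
    positive : 0 < sum N (λ y → if V y then at x y else 0)
    positive = ≤-trans (≤-reflexive (symm here)) (term≤sum N (λ y → if V y then at x y else 0) (V< x vx))
      where
      here : (if V x then at x x else 0) ≡ 1
      here rewrite vx = ind-yes (x ≟ x) refl

  vertex-injective : ∀ i j → vertex i ≡ vertex j → i ≡ j
  vertex-injective i j eq = decidable-stable (i Fin.≟ j) λ i≢j → <⇒≱ (two i≢j) (begin
    sumFin (length vertices) (at (vertex i) ∘ vertex)       ≡⟨ transport (at (vertex i)) ⟩
    sum N (λ x → if V x then at (vertex i) x else 0)         ≤⟨ sum-mono N (λ x _ → drop (V x)) ⟩
    card N (_≟ vertex i)                                     ≤⟨ card-≟ N (vertex i) ⟩
    1                                                        ∎)
    where
    open ≤-Reasoning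
    drop : ∀ b {x} → (if b then x else 0) ≤ x
    drop true  = ≤-refl
    drop false = z≤n
    two : i ≢ j → 1 < sumFin (length vertices) (at (vertex i) ∘ vertex)
    two i≢j = ≤-trans (≤-reflexive (symm (cong₂ _+_ (ind-yes (vertex i ≟ vertex i) refl) (ind-yes (vertex j ≟ vertex i) (symm eq)))))
                (two-terms≤sumFin _ (at (vertex i) ∘ vertex) i j i≢j)

  length-vertices : length vertices ≡ card N (λ x → is? (V x))
  length-vertices = trans (symm (ones (length vertices))) (trans (transport (λ _ → 1)) (sum-cong N (λ x _ → same (V x))))
    where
    ones : ∀ n → sumFin n (λ _ → 1) ≡ n
    ones zero    = refl
    ones (suc n) = cong suc (ones n)
    same : ∀ b → (if b then 1 else 0) ≡ ind (is? b)
    same true  = refl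
    same false = refl

-- Vertices of different parity are adjacent, which gives the cycle 0, 1, 2, 3.
C₄ : Graph
C₄ = record
  { n = 4 ; adj = λ i j → odd i xor odd j
  ; sym = λ i j → Bool.xor-comm (odd i) (odd j) ; irr = λ i → Bool.xor-same (odd i) }
  where
  odd : Fin 4 → Bool
  odd 0F = false
  odd 1F = true
  odd 2F = false
  odd 3F = true

C₄-no : ¬ YesInstance C₄ 0
C₄-no (H , H-sym , H-irr , few , no-C₄ , _) =
  no-C₄ (0F , 1F , 2F , 3F , ((λ ()) , (λ ()) , (λ ()) , (λ ()) , (λ ()) , (λ ())) ,
    symm (same 0F 1F) , symm (same 1F 2F) , symm (same 2F 3F) , symm (same 3F 0F) , symm (same 0F 2F) , symm (same 1F 3F))
  where
  A = adj C₄
  zero-distance : sumFin 4 (λ i → sumFin 4 (λ j → toNat (A i j xor H i j))) ≤ 0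
  zero-distance = ≤-trans (≤-reflexive (double-editDistance A H (Graph.sym C₄ , Graph.irr C₄) (H-sym , H-irr))) (*-monoʳ-≤ 2 few)
  same : ∀ i j → A i j ≡ H i j
  same i j = agree (A i j) (H i j) (≤-trans (term≤sumFin 4 (λ j → toNat (A i j xor H i j)) j)
    (≤-trans (term≤sumFin 4 (λ i → sumFin 4 (λ j → toNat (A i j xor H i j))) i) zero-distance))
    where
    agree : ∀ a b → toNat (a xor b) ≤ 0 → a ≡ b
    agree true  true  _ = refl
    agree false false _ = refl
    agree true  false ()
    agree false true  ()

opaque

  testᵇ : Fm 1
  testᵇ = liveᵇ v0 andᵇ translate (reducibleᶠ v0)

  largeᵇ : Fm 0
  largeᵇ = thresholdᵗ 3440 7 <ᵗ sumᵗ (liveᵇ v0 ?ᵗ oneᵗ)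

-- Every loop runs once per tape cell; for the sweeps of `reduceᶜ` this is enough by `final-stable`.
-- Deleted vertices are only marked, and `writeGraphᶜ` skips them. `writeC₄ᶜ` spells `encode C₄ 0`:
-- the separator, then the adjacency matrix row by row.
reduceᶜ writeGraphᶜ writeC₄ᶜ kernelᶜ : Cmd 0
reduceᶜ = repeatᶜ (forᶜ (ifᶜ testᵇ (killᶜ v0) skipᶜ))
writeGraphᶜ = forᶜ (ifᶜ (belowKᵇ v0) (emitᶜ 2F) skipᶜ) ⍮ emitᶜ 3F
  ⍮ forᶜ (ifᶜ (liveᵇ v0) (forᶜ (ifᶜ (liveᵇ v0) (ifᶜ (edgeᵇ v1 v0) (emitᶜ 2F) (emitᶜ 1F)) skipᶜ)) skipᶜ)
writeC₄ᶜ = emitᶜ 3F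
  ⍮ emitᶜ 1F ⍮ emitᶜ 2F ⍮ emitᶜ 1F ⍮ emitᶜ 2F ⍮ emitᶜ 2F ⍮ emitᶜ 1F ⍮ emitᶜ 2F ⍮ emitᶜ 1F
  ⍮ emitᶜ 1F ⍮ emitᶜ 2F ⍮ emitᶜ 1F ⍮ emitᶜ 2F ⍮ emitᶜ 2F ⍮ emitᶜ 1F ⍮ emitᶜ 2F ⍮ emitᶜ 1F
kernelᶜ = reduceᶜ ⍮ ifᶜ largeᵇ writeC₄ᶜ writeGraphᶜ

concatMap-lookup : {A : Set} (F : ℕ → List A) (xs : List ℕ) → concatMap (F ∘ List.lookup xs) (allFin (length xs)) ≡ concatMap F xs
concatMap-lookup F xs = cong List.concat (trans (List.map-tabulate id (F ∘ List.lookup xs))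
  (trans (symm (List.map-tabulate (List.lookup xs) F)) (cong (List.map F) (List.tabulate-lookup xs))))

map-lookup : {A : Set} (h : ℕ → A) (xs : List ℕ) → List.map (h ∘ List.lookup xs) (allFin (length xs)) ≡ List.map h xs
map-lookup h xs = trans (List.map-tabulate id (h ∘ List.lookup xs))
  (trans (symm (List.map-tabulate (List.lookup xs) h)) (cong (List.map h) (List.tabulate-lookup xs)))

module Kernel (G : Graph) (k : ℕ) where

  open Encoding G k
  open Translation G k
  open Meaning N (nth w)

  kill : (ℕ → Bool) → ℕ → ℕ → Bool
  kill D v p = D p ∨ (v ≡ᵇ p)

  test : (ℕ → Bool) → ℕ → Bool
  test D v = fm testᵇ D (v ∷ [])

  Sol : (ℕ → Bool) → Set
  Sol D = Editing.Solution N k Ê Ê-refl Ê-sym (alive D)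

  Reducible : (ℕ → Bool) → ℕ → Set
  Reducible D v = Semantics.⟦_⟧ N k (alive D) (alive< D) Ê (reducibleᶠ v0) (v ∷ [])

  opaque
    unfolding testᵇ

    test-ok : ∀ D v → v < N → test D v ⇔ᵇ Is (alive D v) × Reducible D v
    test-ok D v v<N = ∧-⇔ᵇ (live-ok D v0 (v ∷ []) v<N) (λ a → translate-ok D (reducibleᶠ v0) (v ∷ []) (λ { zero → a }))

  kill-⇔ᵇ : ∀ D v x → alive (kill D v) x ⇔ᵇ Is (alive D x) × x ≢ v
  kill-⇔ᵇ D v x = ⇔ᵇ-map
    (λ (x<m , ¬d) → proj₂ (alive-⇔ᵇ D x) (x<m , ¬d ∘ proj₂ either ∘ inj₁) , λ { refl → ¬d (proj₂ either (inj₂ refl)) })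
    (λ (a , x≢v) → let (x<m , ¬d) = proj₁ (alive-⇔ᵇ D x) a in x<m , [ ¬d , x≢v ∘ symm ]′ ∘ proj₁ either)
    (alive-⇔ᵇ (kill D v) x)
    where
    either : kill D v x ⇔ᵇ Is (D x) ⊎ v ≡ x
    either = ∨-⇔ᵇ (is-⇔ᵇ (D x)) (≡-⇔ᵇ v x)

  safe : ∀ D v → v < N → Is (test D v) → Sol (kill D v) → Sol D
  safe D v v<N t S = let (a , red) = proj₁ (test-ok D v v<N) t in
    Editing.Deletion.reducible-safe N k Ê Ê-refl Ê-sym (alive D) (alive (kill D v)) (alive< D) v a
      (λ x → proj₁ ∘ proj₁ (kill-⇔ᵇ D v x)) (λ x → proj₂ ∘ proj₁ (kill-⇔ᵇ D v x))
      (λ x b x≢v → proj₂ (kill-⇔ᵇ D v x) (b , x≢v)) S red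

  shrinks : ∀ D v x → Is (alive (kill D v) x) → Is (alive D x)
  shrinks D v x = proj₁ ∘ proj₁ (kill-⇔ᵇ D v x)

  test⇒alive : ∀ D v → v < N → Is (test D v) → Is (alive D v)
  test⇒alive D v v<N = proj₁ ∘ proj₁ (test-ok D v v<N)

  dies : ∀ D v → ¬ Is (alive (kill D v) v)
  dies D v a = proj₂ (proj₁ (kill-⇔ᵇ D v v) a) refl

  open Sweeps N alive test kill Sol safe shrinks test⇒alive dies

  none final-dead : ℕ → Bool
  none _ = false
  final-dead = final none

  V₀ V′ : ℕ → Bool
  V₀ = alive none
  V′ = alive final-dead

  private
    iterate-pair : ∀ {A B : Set} (f : ℕ → A × B → A × B) (g : ℕ → A → A) → (∀ x a b → f x (a , b) ≡ (g x a , b)) →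
      ∀ n a b → iterate n f (a , b) ≡ (iterate n g a , b)
    iterate-pair f g h zero    a b = refl
    iterate-pair f g h (suc n) a b = trans (cong (f n) (iterate-pair f g h n a b)) (h n (iterate n g a) b)

    if-pair : ∀ {A B : Set} (c : Bool) (a a′ : A) (b : B) → (if c then (a , b) else (a′ , b)) ≡ ((if c then a else a′) , b)
    if-pair true  a a′ b = refl
    if-pair false a a′ b = refl

  exec-reduce : exec reduceᶜ [] (none , []) ≡ (final-dead , [])
  exec-reduce = iterate-pair (λ _ → exec (forᶜ (ifᶜ testᵇ (killᶜ v0) skipᶜ)) []) (λ _ → sweepAll)
    (λ _ D o → iterate-pair (λ x → exec (ifᶜ testᵇ (killᶜ v0) skipᶜ) (x ∷ [])) visit (λ x D o → if-pair (test D x) (kill D x) D o) N D o) N none []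

  private
    iterate-out : ∀ (f : ℕ → Store → Store) (D : ℕ → Bool) (g : ℕ → List (Fin 4)) → ∀ n → (∀ x o → x < n → f x (D , o) ≡ (D , o ++ g x)) →
      ∀ o → iterate n f (D , o) ≡ (D , o ++ concatTo n g)
    iterate-out f D g zero    h o = cong (D ,_) (symm (List.++-identityʳ o))
    iterate-out f D g (suc n) h o = trans (cong (f n) (iterate-out f D g n (λ x o p → h x o (m≤n⇒m≤1+n p)) o))
      (trans (h n (o ++ concatTo n g) ≤-refl) (cong (D ,_) (List.++-assoc o (concatTo n g) (g n))))

    if-out : ∀ (c b : Bool) (D : ℕ → Bool) (o : List (Fin 4)) xs σ → c ≡ b → (Is b → σ ≡ (D , o ++ xs)) →
      (if c then σ else (D , o)) ≡ (D , o ++ (if b then xs else []))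
    if-out true  true  D o xs σ refl h = h refl
    if-out false false D o xs σ refl h = cong (D ,_) (symm (List.++-identityʳ o))

    bool-≡ : ∀ {b c} → b ⇔ᵇ Is c → b ≡ c
    bool-≡ (f , g) = Bool-iff f g

  rowOf : (ℕ → Bool) → ℕ → List (Fin 4)
  rowOf D i = concatTo N (λ j → if alive D j then bit (edge i j) ∷ [] else [])

  rowsOf : (ℕ → Bool) → List (Fin 4)
  rowsOf D = concatTo N (λ i → if alive D i then rowOf D i else [])

  module _ (D : ℕ → Bool) where

    private
      cellᶜ : Cmd 2
      cellᶜ = ifᶜ (liveᵇ v0) (ifᶜ (edgeᵇ v1 v0) (emitᶜ 2F) (emitᶜ 1F)) skipᶜ

      rowᶜ : Cmd 1
      rowᶜ = ifᶜ (liveᵇ v0) (forᶜ cellᶜ) skipᶜ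

      header : exec (forᶜ (ifᶜ (belowKᵇ v0) (emitᶜ 2F) skipᶜ)) [] (D , []) ≡ (D , replicate k 2F)
      header = trans (iterate-out (λ x → exec (ifᶜ (belowKᵇ v0) (emitᶜ 2F) skipᶜ) (x ∷ [])) D (λ x → if x <ᵇ k then 2F ∷ [] else []) N
          (λ x o x<N → if-out (fm (belowKᵇ v0) D (x ∷ [])) (x <ᵇ k) D o (2F ∷ []) (D , o ++ 2F ∷ [])
            (bool-≡ (⇔ᵇ-map (proj₂ (<-⇔ᵇ x k)) (proj₁ (<-⇔ᵇ x k)) (belowK-ok D v0 (x ∷ []) x<N))) (λ _ → refl)) [])
        (cong (D ,_) (concatTo-replicate 2F N k (<⇒≤ k<N)))

      write-bit : ∀ o c b → c ≡ b → (if c then (D , o ∷ʳ 2F) else (D , o ∷ʳ 1F)) ≡ (D , o ++ bit b ∷ [])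
      write-bit o true  _ refl = refl
      write-bit o false _ refl = refl

      cell-written : ∀ i → Is (alive D i) → ∀ j o → j < N →
        exec cellᶜ (j ∷ i ∷ []) (D , o) ≡ (D , o ++ (if alive D j then bit (edge i j) ∷ [] else []))
      cell-written i vi j o j<N = if-out (fm (liveᵇ v0) D (j ∷ i ∷ [])) (alive D j) D o (bit (edge i j) ∷ [])
        (exec (ifᶜ (edgeᵇ v1 v0) (emitᶜ 2F) (emitᶜ 1F)) (j ∷ i ∷ []) (D , o)) (bool-≡ (live-ok D v0 (j ∷ i ∷ []) j<N)) λ vj →
        write-bit o (fm (edgeᵇ v1 v0) D (j ∷ i ∷ [])) (edge i j)
          (bool-≡ (edge-ok D v1 v0 (j ∷ i ∷ []) (alive<m D i vi) (alive<m D j vj)))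

      row-written : ∀ i o → i < N → exec rowᶜ (i ∷ []) (D , o) ≡ (D , o ++ (if alive D i then rowOf D i else []))
      row-written i o i<N = if-out (fm (liveᵇ v0) D (i ∷ [])) (alive D i) D o (rowOf D i) (exec (forᶜ cellᶜ) (i ∷ []) (D , o))
        (bool-≡ (live-ok D v0 (i ∷ []) i<N)) λ vi →
        iterate-out (λ j → exec cellᶜ (j ∷ i ∷ [])) D (λ j → if alive D j then bit (edge i j) ∷ [] else []) N (cell-written i vi) o

    exec-write : exec writeGraphᶜ [] (D , []) ≡ (D , replicate k 2F ++ 3F ∷ rowsOf D)
    exec-write = trans (cong (λ σ → exec (forᶜ rowᶜ) [] (exec (emitᶜ 3F) [] σ)) header)
      (trans (iterate-out (λ i → exec rowᶜ (i ∷ [])) D (λ i → if alive D i then rowOf D i else []) N row-written (replicate k 2F ∷ʳ 3F))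
             (cong (D ,_) (List.++-assoc (replicate k 2F) (3F ∷ []) (rowsOf D))))

  open Collected N V′ (alive< final-dead)

  G′ : Graph
  G′ = record
    { n = length vertices ; adj = λ i j → edge (vertex i) (vertex j)
    ; sym = λ i j → edge-sym (vertex i) (vertex j) ; irr = λ i → edge-irr (vertex i) }

  written-encodes : replicate k 2F ++ 3F ∷ rowsOf final-dead ≡ encode G′ k
  written-encodes = cong (λ l → replicate k 2F ++ 3F ∷ l) (symm (begin
    concatMap (λ i → List.map (λ j → bit (edge (vertex i) (vertex j))) (allFin (length vertices))) (allFin (length vertices))
      ≡⟨ List.concatMap-cong (λ i → map-lookup (λ y → bit (edge (vertex i) y)) vertices) (allFin (length vertices)) ⟩
    concatMap (λ i → List.map (λ y → bit (edge (vertex i) y)) vertices) (allFin (length vertices))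
      ≡⟨ concatMap-lookup (λ x → List.map (λ y → bit (edge x y)) vertices) vertices ⟩
    concatMap (λ x → List.map (λ y → bit (edge x y)) vertices) vertices
      ≡⟨ concatMap-collect (λ x → List.map (λ y → bit (edge x y)) vertices) V′ N ⟩
    concatTo N (λ x → if V′ x then List.map (λ y → bit (edge x y)) vertices else [])
      ≡⟨ concatTo-cong N (λ x _ → cong (λ l → if V′ x then l else []) (row-list x)) ⟩
    rowsOf final-dead ∎))
    where
    open ≡-Reasoning
    map-concatMap : ∀ {A B : Set} (h : A → B) xs → List.map h xs ≡ concatMap (λ x → h x ∷ []) xs
    map-concatMap h []       = refl
    map-concatMap h (x ∷ xs) = cong (h x ∷_) (map-concatMap h xs)
    row-list : ∀ x → List.map (λ y → bit (edge x y)) vertices ≡ rowOf final-dead x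
    row-list x = trans (map-concatMap (λ y → bit (edge x y)) vertices)
      (concatMap-collect (λ y → bit (edge x y) ∷ []) V′ N)

  size′ : ℕ
  size′ = card N (λ x → is? (V′ x))

  opaque
    unfolding largeᵇ

    large-ok : fm largeᵇ final-dead [] ⇔ᵇ suc k ^ 7 * 3440 < size′
    large-ok = lt-ok final-dead (thresholdᵗ 3440 7) (sumᵗ (liveᵇ v0 ?ᵗ oneᵗ)) [] (threshold-ok final-dead 3440 7 [])
      (count1-ok final-dead (liveᵇ v0) [] (λ x → is? (V′ x)) (λ x x<N → live-ok final-dead v0 (x ∷ []) x<N))
      (card-≤ N (λ x → is? (V′ x)))

  size′≤m : size′ ≤ m
  size′≤m = ≤-trans (card-mono N (λ x → is? (V′ x)) (_<? m) (λ x _ → alive<m final-dead x)) (≤-reflexive (card-< N m m≤N))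

  V₀-⇔ᵇ : ∀ x → V₀ x ⇔ᵇ x < m
  V₀-⇔ᵇ x = ⇔ᵇ-map proj₁ (λ x<m → x<m , λ ()) (alive-⇔ᵇ none x)

  toℕ∈V₀ : ∀ i → Is (V₀ (toℕ i))
  toℕ∈V₀ i = proj₂ (V₀-⇔ᵇ (toℕ i)) (toℕ<n i)

  toℕ-onto : ∀ x → Is (V₀ x) → ∃ λ (i : Fin m) → toℕ i ≡ x
  toℕ-onto x v = fromℕ< (alive<m none x v) , toℕ-fromℕ< (alive<m none x v)

  Ê-toℕ : ∀ i j → Ê (toℕ i) (toℕ j) ≡ (toℕ i ≡ᵇ toℕ j) ∨ adj G i j
  Ê-toℕ i j = cong ((toℕ i ≡ᵇ toℕ j) ∨_) (edge-toℕ i j)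

  Ê-vertex : ∀ i j → Ê (vertex i) (vertex j) ≡ (vertex i ≡ᵇ vertex j) ∨ adj G′ i j
  Ê-vertex i j = refl

  toℕ-transport : ∀ g → sumFin m (g ∘ toℕ) ≡ sum N (λ x → if V₀ x then g x else 0)
  toℕ-transport g = trans (sumFin-toℕ m g) (symm (sum-prefix m N g (λ x → if V₀ x then g x else 0) m≤N
    (λ x x<m → cong (λ b → if b then g x else 0) (proj₂ (V₀-⇔ᵇ x) x<m))
    (λ x m≤x → cong (λ b → if b then g x else 0) (not-alive x m≤x))))
    where
    not-alive : ∀ x → m ≤ x → V₀ x ≡ false
    not-alive x m≤x with V₀ x | alive<m none x
    ... | false | _ = refl
    ... | true  | f = ⊥-elim (<⇒≱ (f refl) m≤x)

  toℕ-injective′ : (i j : Fin m) → toℕ i ≡ toℕ j → i ≡ j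
  toℕ-injective′ _ _ = toℕ-injective

  module T₀ = Transfer N k Ê Ê-refl Ê-sym V₀ G toℕ toℕ∈V₀ toℕ-onto toℕ-injective′ Ê-toℕ toℕ-transport

  module T′ = Transfer N k Ê Ê-refl Ê-sym V′ G′ vertex vertex∈V vertex-onto vertex-injective Ê-vertex transport

  -- Live vertices only disappear, and neither obstructions nor edits can arise by passing to a
  -- subset.
  restrict : Sol none → Sol final-dead
  restrict S = record
    { H = H ; H-refl = H-refl ; H-sym = H-sym
    ; H-tp = TPon-⊆ (final-shrinks none) H-tp
    ; H-few = ≤-trans (sum-mono N λ x _ → sum-mono N λ y _ → ind-mono (differ? V′ H x y) (differ? V₀ H x y)
        (λ (vx , vy , ne) → final-shrinks none x vx , final-shrinks none y vy , ne)) H-few }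
    where
    open Editing N k Ê Ê-refl Ê-sym
    open Solution S

  irreducible : ∀ v → Is (V′ v) → ¬ Reducible final-dead v
  irreducible v a red with () ← trans (symm (proj₂ (test-ok final-dead v (alive< final-dead v a)) (a , red)))
                                      (final-stable none v (alive< final-dead v a))

  irreducible-bound : ∀ D → Sol D → (∀ v → Is (alive D v) → ¬ Reducible D v) → card N (λ x → is? (alive D x)) ≤ suc k ^ 7 * 3440
  irreducible-bound D S irr = Bound.vertex-bound N k Ê Ê-refl Ê-sym (alive D) (alive< D) S irr

  large⇒no : suc k ^ 7 * 3440 < size′ → ¬ YesInstance G k
  large⇒no big solvable = <⇒≱ big (irreducible-bound final-dead (restrict (T₀.toSolution solvable)) irreducible)

  G⇔G′ : YesInstance G k ⇔ YesInstance G′ k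
  G⇔G′ = mk⇔ (T′.fromSolution ∘ restrict ∘ T₀.toSolution) (T₀.fromSolution ∘ final-safe none ∘ T′.toSolution)

  result : List (Fin 4)
  result = proj₂ (exec kernelᶜ [] (none , []))

  result-small : fm largeᵇ final-dead [] ≡ false → result ≡ encode G′ k
  result-small eq = trans (cong (λ σ → proj₂ (exec (ifᶜ largeᵇ writeC₄ᶜ writeGraphᶜ) [] σ)) exec-reduce)
    (trans (cong (λ b → proj₂ (if b then exec writeC₄ᶜ [] (final-dead , []) else exec writeGraphᶜ [] (final-dead , []))) eq)
      (trans (cong proj₂ (exec-write final-dead)) written-encodes))

  result-large : fm largeᵇ final-dead [] ≡ true → result ≡ encode C₄ 0
  result-large eq = trans (cong (λ σ → proj₂ (exec (ifᶜ largeᵇ writeC₄ᶜ writeGraphᶜ) [] σ)) exec-reduce)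
    (cong (λ b → proj₂ (if b then exec writeC₄ᶜ [] (final-dead , []) else exec writeGraphᶜ [] (final-dead , []))) eq)

  -- The length bound is needed because the output is written on a track above the input cells.
  Outcome : Set
  Outcome = Σ Graph λ K → Σ ℕ λ k′ → result ≡ encode K k′ × length (encode K k′) ≤ N
    × (YesInstance G k ⇔ YesInstance K k′) × k′ ≤ k × n K ≤ 3440 * (k + 1) ^ 7

  bound-comm : suc k ^ 7 * 3440 ≡ 3440 * (k + 1) ^ 7
  bound-comm = trans (*-comm (suc k ^ 7) 3440) (cong (λ q → 3440 * q ^ 7) (+-comm 1 k))

  outcome : Outcome
  outcome = go (fm largeᵇ final-dead []) refl
    where
    go : ∀ b → fm largeᵇ final-dead [] ≡ b → Outcome
    go false eq = G′ , k , result-small eq , small , G⇔G′ , ≤-refl ,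
      ≤-trans (≤-reflexive length-vertices) (≤-trans (≮⇒≥ not-large) (≤-reflexive bound-comm))
      where
      not-large : ¬ suc k ^ 7 * 3440 < size′
      not-large lt with () ← trans (symm eq) (proj₂ large-ok lt)
      n′≤m : length vertices ≤ m
      n′≤m = ≤-trans (≤-reflexive length-vertices) size′≤m
      small : length (encode G′ k) ≤ N
      small = ≤-trans (≤-reflexive (Encoding.N≡ G′ k)) (≤-trans (+-monoʳ-≤ k (s≤s (*-mono-≤ n′≤m n′≤m))) (≤-reflexive (symm N≡)))
    go true eq = C₄ , 0 , result-large eq , small , mk⇔ (λ solvable → ⊥-elim (large⇒no big solvable)) (λ solvable → ⊥-elim (C₄-no solvable)) , z≤n ,
      ≤-trans 4≤3440 (≤-trans (≤-reflexive (symm (*-identityʳ 3440))) (*-monoʳ-≤ 3440 (≤-trans (1≤ 7) (≤-reflexive (cong (_^ 7) (+-comm 1 k))))))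
      where
      big : suc k ^ 7 * 3440 < size′
      big = proj₁ large-ok eq
      1≤ : ∀ e → 1 ≤ suc k ^ e
      1≤ e = ^-monoʳ-≤ (suc k) {0} {e} z≤n
      4≤3440 : 4 ≤ 3440
      4≤3440 = m≤m+n 4 3436
      -- `encode C₄ 0` has 17 symbols; they fit because in this case more than 3440 vertices are
      -- alive.
      17≤m : 17 ≤ m
      17≤m = ≤-trans (m≤m+n 17 3423) (≤-trans (≤-reflexive (symm (*-identityˡ 3440)))
        (≤-trans (*-monoˡ-≤ 3440 (1≤ 7)) (≤-trans (<⇒≤ big) size′≤m)))
      small : length (encode C₄ 0) ≤ N
      small = ≤-trans 17≤m m≤N

kernel-TM : Σ TM λ M → Σ ℕ λ a → Σ ℕ λ d → ∀ w → All (_≢ zero) w →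
  let out = proj₂ (Meaning.exec (length w) (nth w) kernelᶜ [] ((λ _ → false) , [])) in
  length out ≤ length w → All (_≢ zero) out →
  Σ ℕ λ t → t ≤ a * (length w + 1) ^ d × HaltsWithin M w t out
kernel-TM = program-TM kernelᶜ

theorem1 : Σ TM λ M → Σ ℕ λ a → Σ ℕ λ d → Σ ℕ λ c →
    (G : Graph) (k : ℕ) →
    Σ ℕ λ t → t ≤ a * (length (encode G k) + 1) ^ d ×
    Σ Graph λ G' → Σ ℕ λ k' →
    HaltsWithin M (encode G k) t (encode G' k')
    × (YesInstance G k ⇔ YesInstance G' k')
    × k' ≤ k
    × n G' ≤ c * (k + 1) ^ 7
theorem1 = proj₁ kernel-TM , proj₁ (proj₂ kernel-TM) , proj₁ (proj₂ (proj₂ kernel-TM)) , 3440 , λ G k →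
  let (K , k′ , eq , fits , equivalent , k′≤k , small) = Kernel.outcome G k
      (t , fast , halts) = proj₂ (proj₂ (proj₂ kernel-TM)) (encode G k) (Encoding.encode-ok G k)
        (subst (λ o → length o ≤ length (encode G k)) (symm eq) fits)
        (subst (All (_≢ zero)) (symm eq) (Encoding.encode-ok K k′))
  in t , fast , K , k′ , subst (HaltsWithin (proj₁ kernel-TM) (encode G k) t) eq halts , equivalent , k′≤k , small
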